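{- For every $\varepsilon>0$ there exist $\delta>0$ and a constant $C_\varepsilon>0$ such that the following holds for every prime $p$. Let $I\subset\mathbb{F}_p$ be an interval of length $p^{1-\delta}$, and let $H\subset\mathbb{F}_p$ be a multiplicative Hilbert cube of dimension $d$ with $H\cap I=\emptyset$. Then $d\le C_\varepsilon p^{\varepsilon}$.
   Context: Let $p$ be a prime. An interval in $\mathbb{F}_p$ of length $L$ is a set of consecutive residues $\{b, b+1,\dots,b+L-1\}$ (mod $p$) for some $b\in\mathbb{F}_p$. For a positive integer $d$, a multiplicative Hilbert cube of dimension $d$ is a set of the form $\mathcal{H}^\times(a_0;a_1,\dots,a_d)=\{a_0a_1^{n_1}\cdots a_d^{n_d} : n_1,\dots,n_d\in\{0,1\}\}$, where $a_0,a_1,\dots,a_d\in\mathbb{F}_p^\times$ and $a_1,\dots,a_d$ are pairwise distinct. -}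

module Defs where

open import Data.Nat using (ℕ; zero; suc; _+_; _*_; _^_; _≤_; _<_; NonZero)
open import Data.Nat.DivMod using (_%_)
open import Data.Nat.Primality using (Prime)
open import Data.Fin using (Fin) renaming (zero to fzero; suc to fsuc)
open import Data.Empty using (⊥)
open import Data.Bool using (Bool; true; false; if_then_else_)
open import Data.Product using (Σ; _×_)
open import Relation.Binary.PropositionalEquality using (_≡_; _≢_)

-- Elements of F_p are represented by natural numbers, compared modulo p.

selProd : (d : ℕ) → (Fin d → ℕ) → (Fin d → Bool) → ℕ
selProd zero    a n = 1
selProd (suc d) a n =
  (if n fzero then a fzero else 1) * selProd d (λ i → a (fsuc i)) (λ i → n (fsuc i))

IsCubeData : (p : ℕ) .{{_ : NonZero p}} (d : ℕ) → ℕ → (Fin d → ℕ) → Set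
IsCubeData p d a₀ a =
  (a₀ % p ≢ 0) × ((i : Fin d) → a i % p ≢ 0) ×
  ((i j : Fin d) → i ≢ j → a i % p ≢ a j % p)

cubeElem : (p : ℕ) .{{_ : NonZero p}} (d : ℕ) → ℕ → (Fin d → ℕ) → (Fin d → Bool) → ℕ
cubeElem p d a₀ a n = (a₀ * selProd d a n) % p

InInterval : (p : ℕ) .{{_ : NonZero p}} → ℕ → ℕ → ℕ → Set
InInterval p b L x = Σ ℕ (λ j → j < L × x % p ≡ (b + j) % p)

CubeDisjoint : (p : ℕ) .{{_ : NonZero p}} (d : ℕ) → ℕ → (Fin d → ℕ) → ℕ → ℕ → Set
CubeDisjoint p d a₀ a b L = (n : Fin d → Bool) → InInterval p b L (cubeElem p d a₀ a n) → ⊥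

module Submission where

-- Split the aᵢ into O(1) disjoint blocks of N ≫ p^ε elements.  Characters are replaced by positive definite
-- functions: if φ has mean zero on F_p, then K (v) = ∑ φ (z) φ (z + v) satisfies
-- (∑ᵢ K (xᵢ))² ≤ K (0) ∑ᵢⱼ K (xᵢ - xⱼ).  Taking for φ the balanced indicator function of an interval half as long
-- as I and averaging K over products of elements of the blocks gives positive definite functions κ₀, κ₁, … ,
-- where κᵣ is the sum of the dilates of κᵣ₋₁ by the elements of the r-th block, all of mass at most
-- κᵣ (0) p / N.  Because the cube avoids I, they are at least p^(-O(δ)) κᵣ (0) on a further block.
--
-- By positive definiteness, if x and x′ lie in the level set X of κᵣ₊₁ and a and a′ in the block, then
-- x a - x′ a′ lies in a slightly lower level set Y of κᵣ for a proportion of at least 1 / q of the quadruples,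
-- and the same is true with X replaced by any subset of it.  The sizes of the level sets are at most p, so at some
-- step |Y| ≤ q |X| with q a small power of N.  The Balog–Szemerédi–Gowers argument provides a large A ⊆ X with
-- |A - A| ≤ q^O(1) |A|, and the hereditary property, applied to A, makes A almost invariant under many ratios
-- a / a′.  If S is the set of popular differences of A, the multipliers r such that r S is covered by q^O(1)
-- translates of S + S are closed under field operations (with a loss in the exponent).  If Y is a set of
-- multipliers, either every element of F_p is a quotient of differences of Y, hence a multiplier, or for some
-- multiplier ρ the set Y + ρ Y has |Y|² elements; after boundedly many steps every element is a multiplier,
-- which is impossible as |S| is neither very small nor comparable with p.

open import Defs
open import Data.Nat
open import Data.Nat.Properties using (≮⇒≥)
import Data.Nat.Properties as ℕ
open import Data.Nat.DivMod using (_%_; m≡m%n+[m/n]*n; m%n<n; m/n*n≤m) renaming (_/_ to _div_)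
open import Data.Nat.Coprimality using (prime⇒coprime; coprime-Bézout)
open import Data.Nat.GCD using (module Bézout)
open import Data.Nat.Primality using (Prime)
open import Data.Nat.Tactic.RingSolver using (solve-∀)
open import Data.Integer as ℤ using (ℤ; 0ℤ; ∣_∣; +≤+; nonNegative) renaming (+_ to pos)
import Data.Integer.Properties as ℤ
open import Data.Integer.DivMod using (_/ℕ_; n%ℕd<d; a≡a%ℕn+[a/ℕn]*n)
import Data.Integer.Tactic.RingSolver as ℤ-Solver
open import Data.Bool using (Bool; true; false; if_then_else_; _∧_; _∨_; not)
open import Data.Empty using (⊥)
open import Data.Fin using (Fin; zero; suc; toℕ; fromℕ<)
import Data.Fin.Properties as Fin
open import Data.Fin.Permutation using (permutation)
open import Data.List using (List; []; _∷_; length; map; cartesianProductWith; allFin)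
open import Data.List.Properties using (length-map; length-++)
open import Data.List.Membership.Propositional using () renaming (_∈_ to _∈ˡ_)
open import Data.List.Membership.Propositional.Properties using (∈-map⁺; ∈-cartesianProductWith⁺; ∈-allFin)
open import Data.List.Relation.Unary.Any using (here; there)
import Data.Maybe
open import Data.Product using (Σ; ∃; ∃₂; _×_; _,_; proj₁; proj₂)
open import Data.Sum using (_⊎_; inj₁; inj₂)
open import Function using (_∘_)
open import Relation.Nullary using (Dec; yes; no; does; ¬_; contradiction)
open import Relation.Nullary.Decidable using (_×-dec_; _→-dec_; ¬?; dec⇒maybe)
open import Relation.Binary.PropositionalEquality hiding (J)
open import Algebra.Bundles using (CommutativeRing)
open import Algebra.Solver.Ring.AlmostCommutativeRing using (AlmostCommutativeRing; fromCommutativeRing; _-Raw-AlmostCommutative⟶_)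
import Algebra.Properties.Semiring.Sum ℕ.+-*-semiring as Σℕ
import Algebra.Properties.Semiring.Sum ℤ.+-*-semiring as Σℤ

-- The parameters are fixed in one direction. The loss in the closure of multipliers depends only on
-- `k` and decides how small a power `q` of `N` has to be; this decides the number `J` of level
-- sets, by `p < q ^ J`; and `J` decides `δ`, because a step down replaces a level `1 / τ` by
-- `1 / (2 τ²)` and up to `J` steps occur. So `1 / δ` is exponential in `J`. The interval is halved
-- in order to have as many shifts `z` as the half-interval has points for which the whole of
-- `z + x B₀` misses the half-interval, `B₀` being the first block. There the sum of `φ` over the
-- block has no cancellation, which bounds `κ₀ (x)` below without any estimate of character sums.
-- Averaging over a block also makes the mass small, since `φ` has mean zero and only equal pairs of
-- block elements contribute. Popular differences replace `A - A` because their repeated sums can be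
-- counted directly, so that Plünnecke's inequality is avoided. Real exponents and Fourier
-- coefficients are avoided by clearing denominators: all inequalities are between integers.

module FiniteSums where

  -- Finite sums and the Cauchy-Schwarz inequality.

  open import Data.Nat.Properties

  private
    variable
      m n : ℕ

  opaque
    ∑ : (Fin n → ℕ) → ℕ
    ∑ = Σℕ.sum

    ∑ᶻ : (Fin n → ℤ) → ℤ
    ∑ᶻ = Σℤ.sum

  opaque
    unfolding ∑ ∑ᶻ

    ∑-empty : {f : Fin 0 → ℕ} → ∑ f ≡ 0
    ∑-empty = refl

    ∑-suc : (f : Fin (suc n) → ℕ) → ∑ f ≡ f zero + ∑ (f ∘ suc)
    ∑-suc f = refl

    ∑-cong : {f g : Fin n → ℕ} → (∀ i → f i ≡ g i) → ∑ f ≡ ∑ g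
    ∑-cong = Σℕ.sum-cong-≗

    ∑-mono : {f g : Fin n → ℕ} → (∀ i → f i ≤ g i) → ∑ f ≤ ∑ g
    ∑-mono {zero} h = z≤n
    ∑-mono {suc n} h = +-mono-≤ (h zero) (∑-mono (h ∘ suc))

    ∑-const : ∀ n c → ∑ {n} (λ _ → c) ≡ n * c
    ∑-const zero c = refl
    ∑-const (suc n) c = cong (c +_) (∑-const n c)

    ∑-zero : ∀ n → ∑ {n} (λ _ → 0) ≡ 0
    ∑-zero n = trans (∑-const n 0) (*-zeroʳ n)

    ∑-swap : (f : Fin m → Fin n → ℕ) → ∑ (λ i → ∑ (f i)) ≡ ∑ (λ j → ∑ (λ i → f i j))
    ∑-swap = Σℕ.∑-comm

    ∑-+ : (f g : Fin n → ℕ) → ∑ (λ i → f i + g i) ≡ ∑ f + ∑ g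
    ∑-+ = Σℕ.∑-distrib-+

    ∑-*ˡ : ∀ c (f : Fin n → ℕ) → ∑ (λ i → c * f i) ≡ c * ∑ f
    ∑-*ˡ c f = sym (Σℕ.*-distribˡ-sum c f)

    ∑-*ʳ : ∀ c (f : Fin n → ℕ) → ∑ (λ i → f i * c) ≡ ∑ f * c
    ∑-*ʳ c f = sym (Σℕ.*-distribʳ-sum c f)

    ∑-reindex : (g h : Fin n → Fin n) → (∀ x → g (h x) ≡ x) → (∀ x → h (g x) ≡ x) →
                (f : Fin n → ℕ) → ∑ (λ x → f (g x)) ≡ ∑ f
    ∑-reindex g h gh hg f = sym (Σℕ.sum-permute f
      (permutation g h gh hg))

    ≤∑ : (f : Fin n → ℕ) (i : Fin n) → f i ≤ ∑ f
    ≤∑ f zero = m≤m+n _ _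
    ≤∑ f (suc i) = ≤-trans (≤∑ (f ∘ suc) i) (m≤n+m _ _)

    ∑ᶻ-cong : {f g : Fin n → ℤ} → (∀ i → f i ≡ g i) → ∑ᶻ f ≡ ∑ᶻ g
    ∑ᶻ-cong = Σℤ.sum-cong-≗

    ∑ᶻ-mono : {f g : Fin n → ℤ} → (∀ i → f i ℤ.≤ g i) → ∑ᶻ f ℤ.≤ ∑ᶻ g
    ∑ᶻ-mono {zero} h = ℤ.≤-refl
    ∑ᶻ-mono {suc n} h = ℤ.+-mono-≤ (h zero) (∑ᶻ-mono (h ∘ suc))

    ∑ᶻ-swap : (f : Fin m → Fin n → ℤ) → ∑ᶻ (λ i → ∑ᶻ (f i)) ≡ ∑ᶻ (λ j → ∑ᶻ (λ i → f i j))
    ∑ᶻ-swap = Σℤ.∑-comm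

    ∑ᶻ-+ : (f g : Fin n → ℤ) → ∑ᶻ (λ i → f i ℤ.+ g i) ≡ ∑ᶻ f ℤ.+ ∑ᶻ g
    ∑ᶻ-+ = Σℤ.∑-distrib-+

    ∑ᶻ-*ˡ : ∀ c (f : Fin n → ℤ) → ∑ᶻ (λ i → c ℤ.* f i) ≡ c ℤ.* ∑ᶻ f
    ∑ᶻ-*ˡ c f = sym (Σℤ.*-distribˡ-sum c f)

    ∑ᶻ-*ʳ : ∀ c (f : Fin n → ℤ) → ∑ᶻ (λ i → f i ℤ.* c) ≡ ∑ᶻ f ℤ.* c
    ∑ᶻ-*ʳ c f = sym (Σℤ.*-distribʳ-sum c f)

    ∑ᶻ-reindex : (g h : Fin n → Fin n) → (∀ x → g (h x) ≡ x) → (∀ x → h (g x) ≡ x) →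
                 (f : Fin n → ℤ) → ∑ᶻ (λ x → f (g x)) ≡ ∑ᶻ f
    ∑ᶻ-reindex g h gh hg f = sym (Σℤ.sum-permute f
      (permutation g h gh hg))

    pos-∑ : (f : Fin n → ℕ) → pos (∑ f) ≡ ∑ᶻ (λ i → pos (f i))
    pos-∑ {zero} f = refl
    pos-∑ {suc n} f = cong (ℤ._+_ (pos (f zero))) (pos-∑ (f ∘ suc))

    -- The way injectivity enters later counts: a fibre of an injective map has at most one element.
    ∑-subsingleton : (f : Fin n → ℕ) → (∀ i → f i ≤ 1) → (∀ i j → 1 ≤ f i → 1 ≤ f j → i ≡ j) → ∑ f ≤ 1
    ∑-subsingleton {zero} f f≤1 uniq = z≤n
    ∑-subsingleton {suc n} f f≤1 uniq with 1 ≤? f zero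
    ... | no f₀≱1 = subst (λ k → k + ∑ (f ∘ suc) ≤ 1) (sym (n<1⇒n≡0 (≰⇒> f₀≱1)))
                       (∑-subsingleton (f ∘ suc) (f≤1 ∘ suc) λ i j fi fj → Fin.suc-injective (uniq (suc i) (suc j) fi fj))
    ... | yes 1≤f₀ = subst (_≤ 1) (trans (sym (+-identityʳ _)) (cong (f zero +_) (sym (trans (∑-cong rest) (∑-zero n))))) (f≤1 zero)
      where
      rest : ∀ i → f (suc i) ≡ 0
      rest i = n<1⇒n≡0 (≰⇒> λ 1≤fi → contradiction (uniq zero (suc i) 1≤f₀ 1≤fi) λ ())

  ∑-× : (f : Fin m → ℕ) (g : Fin n → ℕ) → ∑ (λ i → ∑ (λ j → f i * g j)) ≡ ∑ f * ∑ g
  ∑-× f g = trans (∑-cong (λ i → ∑-*ˡ (f i) g)) (∑-*ʳ (∑ g) f)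

  -- If `g < f` wherever `w` is positive, the sum for `f` exceeds the sum for `g` by at least `∑ w`.
  -- The weight is usually an indicator, and `1 ≤ w i` then places the witness in its set.
  ∑-average : (w f g : Fin n → ℕ) → ∑ (λ i → w i * f i) ≤ ∑ (λ i → w i * g i) → 1 ≤ ∑ w →
              ∃ λ i → 1 ≤ w i × f i ≤ g i
  ∑-average {n} w f g fg 1≤w with Fin.any? (λ i → (1 ≤? w i) ×-dec (f i ≤? g i))
  ... | yes h = h
  ... | no h = contradiction fg (<⇒≱ (≤-trans (+-monoˡ-≤ _ 1≤w)
                  (≤-trans (≤-reflexive (sym (∑-+ w _))) (∑-mono step))))
    where
    step : ∀ i → w i + w i * g i ≤ w i * f i
    step i with w i in eq
    ... | zero = z≤n
    ... | suc k = subst (_≤ suc k * f i) (*-suc (suc k) (g i))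
                    (*-monoʳ-≤ (suc k) (≰⇒> λ fi≤gi → h (i , ≤-trans (s≤s z≤n) (≤-reflexive (sym eq)) , fi≤gi)))

  ∑ᶻ-× : (f : Fin m → ℤ) (g : Fin n → ℤ) →
         ∑ᶻ (λ i → ∑ᶻ (λ j → f i ℤ.* g j)) ≡ ∑ᶻ f ℤ.* ∑ᶻ g
  ∑ᶻ-× f g = trans (∑ᶻ-cong (λ i → ∑ᶻ-*ˡ (f i) g)) (∑ᶻ-*ʳ (∑ᶻ g) f)

  *-swap : ∀ a b c → a * (b * c) ≡ b * (a * c)
  *-swap = solve-∀

  square-nonneg : ∀ i → ℤ.0ℤ ℤ.≤ i ℤ.* i
  square-nonneg (pos n) = subst (ℤ.0ℤ ℤ.≤_) (ℤ.pos-* n n) (ℤ.+≤+ z≤n)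
  square-nonneg ℤ.-[1+ n ] = ℤ.+≤+ z≤n

  2xy≤x²+y² : ∀ x y → (pos 2) ℤ.* (x ℤ.* y) ℤ.≤ x ℤ.* x ℤ.+ y ℤ.* y
  2xy≤x²+y² x y = ℤ.0≤i-j⇒j≤i (subst (ℤ.0ℤ ℤ.≤_) (identity x y) (square-nonneg (x ℤ.- y)))
    where
    identity : ∀ x y → (x ℤ.- y) ℤ.* (x ℤ.- y) ≡ x ℤ.* x ℤ.+ y ℤ.* y ℤ.- (pos 2) ℤ.* (x ℤ.* y)
    identity = ℤ-Solver.solve-∀

  -- Each pair `i, j` contributes `(fᵢ gⱼ - gᵢ fⱼ)² ≥ 0`; the sum over all pairs is twice the
  -- inequality, whence the factor 2 that is cancelled.
  cauchy-schwarzᶻ : (f g : Fin n → ℤ) →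
    ∑ᶻ (λ i → f i ℤ.* g i) ℤ.* ∑ᶻ (λ i → f i ℤ.* g i) ℤ.≤
    ∑ᶻ (λ i → f i ℤ.* f i) ℤ.* ∑ᶻ (λ i → g i ℤ.* g i)
  cauchy-schwarzᶻ f g = ℤ.*-cancelˡ-≤-pos _ _ (pos 2) (begin
    pos 2 ℤ.* (S ℤ.* S)
      ≡⟨ cong (pos 2 ℤ.*_) (∑ᶻ-× fg fg) ⟨
    pos 2 ℤ.* ∑ᶻ (λ i → ∑ᶻ (λ j → fg i ℤ.* fg j))
      ≡⟨ ∑ᶻ-*ˡ (pos 2) _ ⟨
    ∑ᶻ (λ i → pos 2 ℤ.* ∑ᶻ (λ j → fg i ℤ.* fg j))
      ≡⟨ ∑ᶻ-cong (λ i → ∑ᶻ-*ˡ (pos 2) _) ⟨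
    ∑ᶻ (λ i → ∑ᶻ (λ j → pos 2 ℤ.* (fg i ℤ.* fg j)))
      ≤⟨ ∑ᶻ-mono (λ i → ∑ᶻ-mono (λ j → cross (f i) (g i) (f j) (g j))) ⟩
    ∑ᶻ (λ i → ∑ᶻ (λ j → ff i ℤ.* gg j ℤ.+ gg i ℤ.* ff j))
      ≡⟨ ∑ᶻ-cong (λ i → ∑ᶻ-+ _ _) ⟩
    ∑ᶻ (λ i → ∑ᶻ (λ j → ff i ℤ.* gg j) ℤ.+ ∑ᶻ (λ j → gg i ℤ.* ff j))
      ≡⟨ ∑ᶻ-+ _ _ ⟩
    ∑ᶻ (λ i → ∑ᶻ (λ j → ff i ℤ.* gg j)) ℤ.+ ∑ᶻ (λ i → ∑ᶻ (λ j → gg i ℤ.* ff j))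
      ≡⟨ cong₂ ℤ._+_ (∑ᶻ-× ff gg) (∑ᶻ-× gg ff) ⟩
    ∑ᶻ ff ℤ.* ∑ᶻ gg ℤ.+ ∑ᶻ gg ℤ.* ∑ᶻ ff
      ≡⟨ double (∑ᶻ ff) (∑ᶻ gg) ⟩
    pos 2 ℤ.* (∑ᶻ ff ℤ.* ∑ᶻ gg) ∎)
    where
    open ℤ.≤-Reasoning
    fg = λ i → f i ℤ.* g i
    ff = λ i → f i ℤ.* f i
    gg = λ i → g i ℤ.* g i
    S = ∑ᶻ fg
    double : ∀ x y → x ℤ.* y ℤ.+ y ℤ.* x ≡ pos 2 ℤ.* (x ℤ.* y)
    double = ℤ-Solver.solve-∀
    identity₁ : ∀ a b c d → pos 2 ℤ.* ((a ℤ.* d) ℤ.* (b ℤ.* c)) ≡ pos 2 ℤ.* ((a ℤ.* b) ℤ.* (c ℤ.* d))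
    identity₁ = ℤ-Solver.solve-∀
    identity₂ : ∀ a b c d → (a ℤ.* d) ℤ.* (a ℤ.* d) ℤ.+ (b ℤ.* c) ℤ.* (b ℤ.* c)
                          ≡ (a ℤ.* a) ℤ.* (d ℤ.* d) ℤ.+ (b ℤ.* b) ℤ.* (c ℤ.* c)
    identity₂ = ℤ-Solver.solve-∀
    cross : ∀ a b c d → pos 2 ℤ.* ((a ℤ.* b) ℤ.* (c ℤ.* d)) ℤ.≤
                        (a ℤ.* a) ℤ.* (d ℤ.* d) ℤ.+ (b ℤ.* b) ℤ.* (c ℤ.* c)
    cross a b c d = subst₂ ℤ._≤_ (identity₁ a b c d) (identity₂ a b c d) (2xy≤x²+y² (a ℤ.* d) (b ℤ.* c))

  cauchy-schwarz : (f g : Fin n → ℕ) →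
    ∑ (λ i → f i * g i) * ∑ (λ i → f i * g i) ≤ ∑ (λ i → f i * f i) * ∑ (λ i → g i * g i)
  cauchy-schwarz f g = ℤ.drop‿+≤+ (subst₂ ℤ._≤_ (cast f g f g) (cast f f g g)
    (cauchy-schwarzᶻ (λ i → pos (f i)) (λ i → pos (g i))))
    where
    cast₁ : ∀ u v → ∑ᶻ (λ i → pos (u i) ℤ.* pos (v i)) ≡ pos (∑ (λ i → u i * v i))
    cast₁ u v = sym (trans (pos-∑ _) (∑ᶻ-cong (λ i → ℤ.pos-* (u i) (v i))))
    cast : ∀ u v u′ v′ →
           ∑ᶻ (λ i → pos (u i) ℤ.* pos (v i)) ℤ.* ∑ᶻ (λ i → pos (u′ i) ℤ.* pos (v′ i))
           ≡ pos (∑ (λ i → u i * v i) * ∑ (λ i → u′ i * v′ i))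
    cast u v u′ v′ = trans (cong₂ ℤ._*_ (cast₁ u v) (cast₁ u′ v′))
      (sym (ℤ.pos-* (∑ (λ i → u i * v i)) (∑ (λ i → u′ i * v′ i))))

  𝟙 : Bool → ℕ
  𝟙 true = 1
  𝟙 false = 0

  𝟙≤1 : ∀ b → 𝟙 b ≤ 1
  𝟙≤1 true = ≤-refl
  𝟙≤1 false = z≤n

  𝟙-∧ : ∀ a b → 𝟙 (a ∧ b) ≡ 𝟙 a * 𝟙 b
  𝟙-∧ true b = sym (+-identityʳ _)
  𝟙-∧ false b = refl

  𝟙-true : ∀ {b} → b ≡ true → 𝟙 b ≡ 1
  𝟙-true refl = refl

  𝟙*𝟙⁻ : ∀ a b → 1 ≤ 𝟙 a * 𝟙 b → a ≡ true × b ≡ true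
  𝟙*𝟙⁻ true true _ = refl , refl

  𝟙⁻ : ∀ {b} → 1 ≤ 𝟙 b → b ≡ true
  𝟙⁻ {true} _ = refl

-- Choice of parameters with integer powers and roots.

module ParameterSelection where

  open import Data.Nat.Properties

  *-^ : ∀ k m n → (m * n) ^ k ≡ m ^ k * n ^ k
  *-^ zero m n = refl
  *-^ (suc k) m n = trans (cong (m * n *_) (*-^ k m n)) (interchange m n (m ^ k) (n ^ k))
    where
    interchange : ∀ a b c d → a * b * (c * d) ≡ a * c * (b * d)
    interchange = solve-∀

  ^-cancelˡ-< : ∀ k {m n} → m ^ k < n ^ k → m < n
  ^-cancelˡ-< k h = ≰⇒> λ n≤m → <⇒≱ h (^-monoˡ-≤ k n≤m)

  n<2^n : ∀ n → n < 2 ^ n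
  n<2^n zero = s≤s z≤n
  n<2^n (suc n) = ≤-trans (+-mono-≤ (m^n>0 2 n) (n<2^n n)) (≤-reflexive (cong (2 ^ n +_) (sym (+-identityʳ (2 ^ n)))))

  -- For `q ≥ 2` constants are absorbed into the exponent, so a compound requirement on `N` in terms
  -- of `q` reduces to one power of `q`, which an integer root of `N` satisfies.
  PolynomiallyBounded : (ℕ → ℕ) → Set
  PolynomiallyBounded f = ∃ λ e → ∀ q → 2 ≤ q → f q ≤ q ^ e

  pb-id : PolynomiallyBounded (λ q → q)
  pb-id = 1 , λ q _ → ≤-reflexive (sym (*-identityʳ q))

  pb-const : ∀ c → PolynomiallyBounded (λ _ → c)
  pb-const c = c , λ q 2≤q → ≤-trans (<⇒≤ (n<2^n c)) (^-monoˡ-≤ c 2≤q)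

  pb-* : ∀ {f g} → PolynomiallyBounded f → PolynomiallyBounded g → PolynomiallyBounded (λ q → f q * g q)
  pb-* (e , f≤) (e′ , g≤) = e + e′ , λ q 2≤q → ≤-trans (*-mono-≤ (f≤ q 2≤q) (g≤ q 2≤q)) (≤-reflexive (sym (^-distribˡ-+-* q e e′)))

  pb-^ : ∀ {f} n → PolynomiallyBounded f → PolynomiallyBounded (λ q → f q ^ n)
  pb-^ n (e , f≤) = e * n , λ q 2≤q → ≤-trans (^-monoˡ-≤ n (f≤ q 2≤q)) (≤-reflexive (^-*-assoc q e n))

  pb-+ : ∀ {f g} → PolynomiallyBounded f → PolynomiallyBounded g → PolynomiallyBounded (λ q → f q + g q)
  pb-+ {f} {g} (e , f≤) (e′ , g≤) = suc (e + e′) , bound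
    where
    sum≤product : ∀ a b → 1 ≤ a → 1 ≤ b → a + b ≤ 2 * (a * b)
    sum≤product a b 1≤a 1≤b = ≤-trans (+-mono-≤ (m≤m*n a b {{>-nonZero 1≤b}}) (m≤n*m b a {{>-nonZero 1≤a}})) (≤-reflexive (cong (a * b +_) (sym (+-identityʳ (a * b)))))
    bound : ∀ q → 2 ≤ q → f q + g q ≤ q ^ suc (e + e′)
    bound q 2≤q = begin
      f q + g q ≤⟨ +-mono-≤ (f≤ q 2≤q) (g≤ q 2≤q) ⟩
      q ^ e + q ^ e′ ≤⟨ sum≤product (q ^ e) (q ^ e′) (m^n>0 q e) (m^n>0 q e′) ⟩
      2 * (q ^ e * q ^ e′) ≤⟨ *-mono-≤ 2≤q (≤-reflexive (sym (^-distribˡ-+-* q e e′))) ⟩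
      q * q ^ (e + e′) ∎
      where
      open ≤-Reasoning
      instance
        q-nonZero : NonZero q
        q-nonZero = >-nonZero (≤-trans (s≤s z≤n) 2≤q)

  -- A discrete root: for `f = (_^ E)` it yields `q ^ E ≤ N < (q + 1) ^ E`.
  last-below : ∀ (f : ℕ → ℕ) N b → f 0 ≤ N → N < f b → ∃ λ q → f q ≤ N × N < f (suc q)
  last-below f N zero f0≤N N<f0 = contradiction f0≤N (<⇒≱ N<f0)
  last-below f N (suc b) f0≤N N<f with f b ≤? N
  ... | yes fb≤N = b , fb≤N , N<f
  ... | no fb≰N = last-below f N b f0≤N (≰⇒> fb≰N)

  -- A pivot either ends with the exponent `6 e + 5` or continues from `14 e + 14`; the sum bounds
  -- both outcomes.
  exponent-after : ℕ → ℕ → ℕ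
  exponent-after zero e = 0
  exponent-after (suc i) e = (6 * e + 5) + exponent-after i (14 * e + 14)

  -- `N` is the length of a block, `q` the loss per step, `σ` a bound for `p / ℓ` with `ℓ` half the
  -- length of the interval, `Q` the constant `8 q¹²` of Balog-Szemerédi-Gowers, and `c` a common
  -- bound for the sizes of covers. Of the `J + 2` blocks, `J + 1` build the kernels and the last
  -- supplies points of their level sets.
  record ParameterChoice (k J m d p : ℕ) : Set where
    field
      N q σ Q c : ℕ
      N-blocks : suc (suc J) * N ≤ d
      1≤N : 1 ≤ N
      p<N^ : p < N ^ suc k
      32≤q : 32 ≤ q
      p<q^J : p < q ^ J
      σ≤q : (2 * (σ * σ)) ^ (2 ^ J) ≤ q
      1≤σ : 1 ≤ σ
      interval-ratio : ∀ {L ℓ} → p ^ m ≤ L ^ suc m → L ≤ 2 * ℓ → p ≤ σ * ℓ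
      Q-def : Q ≡ 8 * ((q * q) * (q * q) * (q * q) * (q * q) * (q * q) * (q * q))
      Q≤c : Q ≤ c
      q-bound : 8 * (q * q * q) ≤ c
      W-bound : 2 * (2 * Q * Q) ^ 1 ≤ c
      T-bound : 2 * (2 * Q * Q) ^ 5 ≤ c
      q²≤N : 4 * (q * q) ≤ N
      K≤N : 16 * q * (c ^ exponent-after (suc k) 6 * c ^ exponent-after (suc k) 6) ≤ N
      N-large : 2 * (c ^ exponent-after (suc k) 6 * c ^ exponent-after (suc k) 6) * c * Q * q < N

  module Parameters (k : ℕ) where

    -- `c` and `threshold` are sums of the lower bounds required of `c` and `N`, so that each
    -- requirement holds because it is a summand. `K` is `c ^ (2 e)` with `e` the final exponent of
    -- the multipliers.
    Q c K threshold : ℕ → ℕ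
    Q q = 8 * ((q * q) * (q * q) * (q * q) * (q * q) * (q * q) * (q * q))
    c q = 2 * (2 * Q q * Q q) ^ 5 + (2 * (2 * Q q * Q q) ^ 1 + (8 * (q * q * q) + Q q))
    K q = c q ^ exponent-after (suc k) 6 * c q ^ exponent-after (suc k) 6
    threshold q = 4 * (q * q) + (16 * q * K q + (2 * K q * c q * Q q * q + 1))

    opaque
      threshold-bounded : PolynomiallyBounded threshold
      threshold-bounded = pb-+ (pb-* (pb-const 4) pb-q²) (pb-+ (pb-* (pb-* (pb-const 16) pb-id) pb-K)
          (pb-+ (pb-* (pb-* (pb-* (pb-* (pb-const 2) pb-K) pb-c) pb-Q) pb-id) (pb-const 1)))
        where
        pb-q² : PolynomiallyBounded (λ q → q * q)
        pb-q² = pb-* pb-id pb-id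
        pb-Q : PolynomiallyBounded Q
        pb-Q = pb-* (pb-const 8) (pb-* (pb-* (pb-* (pb-* (pb-* pb-q² pb-q²) pb-q²) pb-q²) pb-q²) pb-q²)
        pb-QQ : PolynomiallyBounded (λ q → 2 * Q q * Q q)
        pb-QQ = pb-* (pb-* (pb-const 2) pb-Q) pb-Q
        pb-c : PolynomiallyBounded c
        pb-c = pb-+ (pb-* (pb-const 2) (pb-^ 5 pb-QQ)) (pb-+ (pb-* (pb-const 2) (pb-^ 1 pb-QQ))
                 (pb-+ (pb-* (pb-const 8) (pb-* pb-q² pb-id)) pb-Q))
        pb-K : PolynomiallyBounded K
        pb-K = pb-* (pb-^ (exponent-after (suc k) 6) pb-c) (pb-^ (exponent-after (suc k) 6) pb-c)

    -- `q` will be about `N ^ (1 / E)`. As `q + 1 ≤ q²` and `p < N ^ (k + 1)`, the factor 2 in `J`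
    -- gives `p < q ^ J`. The value `q₀` is `f 4`, so that `q₀ ≤ q` forces `4 ≤ σ`; `u` is made for
    -- `p < σ ^ u`, and `m + 1 = 2 (u + 1)` leaves half of the exponent to absorb `2 ^ (m + 1)`.
    E J q₀ W blocks C u m : ℕ
    E = suc (proj₁ threshold-bounded)
    J = 2 * (E * suc k)
    q₀ = 32 ^ (2 ^ J)
    W = q₀ ^ E
    blocks = suc (suc J)
    C = blocks * (2 * W)
    u = 4 * (2 ^ J) * J
    m = suc (u + u)

    1≤W : 1 ≤ W
    1≤W = m^n>0 q₀ {{m^n≢0 32 (2 ^ J)}} E

    1≤C : 1 ≤ C
    1≤C = *-mono-≤ {1} {blocks} (s≤s z≤n) (*-mono-≤ {1} {2} (s≤s z≤n) 1≤W)

    f : ℕ → ℕ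
    f K = (2 * (K * K)) ^ (2 ^ J)

    module Choice {d p : ℕ} (1≤p : 1 ≤ p) (d-large : C ^ suc k * p < d ^ suc k) where

      N : ℕ
      N = d / blocks

      N-blocks : blocks * N ≤ d
      N-blocks = ≤-trans (≤-reflexive (*-comm blocks N)) (m/n*n≤m d blocks)

      private
        C<d : C < d
        C<d = ^-cancelˡ-< (suc k) (≤-<-trans (m≤m*n (C ^ suc k) p {{>-nonZero 1≤p}}) d-large)

        d<blocks : d < blocks * suc N
        d<blocks = begin-strict
          d ≡⟨ m≡m%n+[m/n]*n d blocks ⟩
          _ + N * blocks <⟨ +-monoˡ-< (N * blocks) (m%n<n d blocks) ⟩
          blocks + N * blocks ≡⟨ *-comm (suc N) blocks ⟩
          blocks * suc N ∎
          where open ≤-Reasoning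

      2W≤N : 2 * W ≤ N
      2W≤N = ≤-pred (*-cancelˡ-< blocks (2 * W) (suc N) (<-trans C<d d<blocks))

      W≤N : W ≤ N
      W≤N = ≤-trans (m≤n*m W 2) 2W≤N

      1≤N : 1 ≤ N
      1≤N = ≤-trans 1≤W W≤N

      p<N^ : p < N ^ suc k
      p<N^ = ≰⇒> λ N^≤p → contradiction d-large (≤⇒≯ (begin
        d ^ suc k ≤⟨ ^-monoˡ-≤ (suc k) (≤-trans (<⇒≤ d<blocks) (*-monoʳ-≤ blocks (sucN≤ 1≤N))) ⟩
        (blocks * (2 * N)) ^ suc k ≡⟨ cong (_^ suc k) (*-assoc blocks 2 N) ⟨
        (blocks * 2 * N) ^ suc k ≡⟨ *-^ (suc k) (blocks * 2) N ⟩
        (blocks * 2) ^ suc k * N ^ suc k ≤⟨ *-mono-≤ (^-monoˡ-≤ (suc k) 2blocks≤C) N^≤p ⟩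
        C ^ suc k * p ∎))
        where
        open ≤-Reasoning
        sucN≤ : ∀ {n} → 1 ≤ n → suc n ≤ 2 * n
        sucN≤ {n} 1≤n = ≤-trans (+-monoˡ-≤ n 1≤n) (≤-reflexive (cong (n +_) (sym (+-identityʳ n))))
        2blocks≤C : blocks * 2 ≤ C
        2blocks≤C = *-monoʳ-≤ blocks (m≤m*n 2 W {{>-nonZero 1≤W}})

      private
        root : ∃ λ q → q ^ E ≤ N × N < suc q ^ E
        root = last-below (_^ E) N (suc N) z≤n (m≤m*n (suc N) (suc N ^ proj₁ threshold-bounded) {{m^n≢0 (suc N) (proj₁ threshold-bounded)}})

      q : ℕ
      q = proj₁ root

      q₀≤q : q₀ ≤ q
      q₀≤q = ≤-pred (^-cancelˡ-< E (≤-<-trans W≤N (proj₂ (proj₂ root))))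

      32≤q : 32 ≤ q
      32≤q = ≤-trans (≤-trans (≤-reflexive (sym (*-identityʳ 32))) (^-monoʳ-≤ 32 (m^n>0 2 J))) q₀≤q

      private
        instance
          q-nonZero : NonZero q
          q-nonZero = >-nonZero (≤-trans (s≤s z≤n) 32≤q)

        2≤q : 2 ≤ q
        2≤q = ≤-trans (s≤s (s≤s z≤n)) 32≤q

      threshold≤N : threshold q ≤ N
      threshold≤N = begin
        threshold q ≤⟨ proj₂ threshold-bounded q 2≤q ⟩
        q ^ proj₁ threshold-bounded ≤⟨ m≤n*m (q ^ proj₁ threshold-bounded) q ⟩
        q ^ E ≤⟨ proj₁ (proj₂ root) ⟩
        N ∎
        where open ≤-Reasoning

      p<q^J : p < q ^ J
      p<q^J = begin-strict
        p <⟨ p<N^ ⟩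
        N ^ suc k ≤⟨ ^-monoˡ-≤ (suc k) (<⇒≤ (proj₂ (proj₂ root))) ⟩
        (suc q ^ E) ^ suc k ≤⟨ ^-monoˡ-≤ (suc k) (^-monoˡ-≤ E suc-q≤) ⟩
        ((q ^ 2) ^ E) ^ suc k ≡⟨ trans (^-*-assoc (q ^ 2) E (suc k)) (^-*-assoc q 2 (E * suc k)) ⟩
        q ^ J ∎
        where
        open ≤-Reasoning
        suc-q≤ : suc q ≤ q ^ 2
        suc-q≤ = ≤-trans (+-mono-≤ (≤-trans (s≤s z≤n) 2≤q) (≤-refl {q})) (≤-trans (≤-reflexive (cong (q +_) (sym (+-identityʳ q))))
                   (≤-trans (*-monoˡ-≤ q 2≤q) (≤-reflexive (cong (q *_) (sym (*-identityʳ q))))))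

      private
        f-root : ∃ λ τ → f τ ≤ q × q < f (suc τ)
        f-root = last-below f q q f0≤q q<fq
          where
          f0≤q : f 0 ≤ q
          f0≤q = ≤-trans (^-monoˡ-≤ (2 ^ J) {0} {1} z≤n) (≤-trans (≤-reflexive (^-zeroˡ (2 ^ J))) (≤-trans (s≤s z≤n) 2≤q))
          q<fq : q < f q
          q<fq = begin-strict
            q <⟨ m<m*n q q 2≤q ⟩
            q * q ≤⟨ m≤n*m (q * q) 2 ⟩
            2 * (q * q) ≡⟨ *-identityʳ (2 * (q * q)) ⟨
            (2 * (q * q)) ^ 1 ≤⟨ ^-monoʳ-≤ (2 * (q * q)) {{m*n≢0 2 (q * q) {{_}} {{m*n≢0 q q}}}} (m^n>0 2 J) ⟩
            f q ∎
            where open ≤-Reasoning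

      σ : ℕ
      σ = proj₁ f-root

      fσ≤q : f σ ≤ q
      fσ≤q = proj₁ (proj₂ f-root)

      4≤σ : 4 ≤ σ
      4≤σ = ≤-pred (≰⇒> λ sucσ≤4 → contradiction (proj₂ (proj₂ f-root)) (≤⇒≯ (≤-trans (^-monoˡ-≤ (2 ^ J) (*-monoʳ-≤ 2 (*-mono-≤ sucσ≤4 sucσ≤4))) q₀≤q)))

      private
        instance
          σ-nonZero : NonZero σ
          σ-nonZero = >-nonZero (≤-trans (s≤s z≤n) 4≤σ)

        p<σ^u : p < σ ^ u
        p<σ^u = begin-strict
          p ≤⟨ <⇒≤ p<q^J ⟩
          q ^ J <⟨ ^-monoˡ-< J {{J-nonZero}} (<-≤-trans (proj₂ (proj₂ f-root)) (^-monoˡ-≤ (2 ^ J) growth)) ⟩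
          ((σ ^ 4) ^ (2 ^ J)) ^ J ≡⟨ trans (cong (_^ J) (^-*-assoc σ 4 (2 ^ J))) (^-*-assoc σ (4 * 2 ^ J) J) ⟩
          σ ^ u ∎
          where
          open ≤-Reasoning
          J-nonZero : NonZero J
          J-nonZero = >-nonZero (*-mono-≤ {1} {2} (s≤s z≤n) (*-mono-≤ {1} {E} (s≤s z≤n) (s≤s z≤n)))
          growth : 2 * (suc σ * suc σ) ≤ σ ^ 4
          growth = begin
            2 * (suc σ * suc σ) ≤⟨ *-monoʳ-≤ 2 (*-mono-≤ sucσ≤ sucσ≤) ⟩
            2 * (2 * σ * (2 * σ)) ≡⟨ g₁ σ ⟩
            4 * 2 * (σ * σ) ≤⟨ *-monoˡ-≤ (σ * σ) (*-mono-≤ 4≤σ (≤-trans (s≤s (s≤s z≤n)) 4≤σ)) ⟩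
            σ * σ * (σ * σ) ≡⟨ g₂ σ ⟩
            σ * (σ * (σ * (σ * 1))) ∎
            where
            sucσ≤ : suc σ ≤ 2 * σ
            sucσ≤ = ≤-trans (+-monoˡ-≤ σ (≤-trans (s≤s z≤n) 4≤σ)) (≤-reflexive (cong (σ +_) (sym (+-identityʳ σ))))
            g₁ : ∀ σ → 2 * (2 * σ * (2 * σ)) ≡ 4 * 2 * (σ * σ)
            g₁ = solve-∀
            g₂ : ∀ σ → σ * σ * (σ * σ) ≡ σ * (σ * (σ * (σ * 1)))
            g₂ = solve-∀

      -- If `σ ℓ < p`, then `σ L ≤ 2 σ ℓ < 2 p`. Raised to the power `m + 1`, this gives `σ ^ (m +
      -- 1) p ^ m < 2 ^ (m + 1) σ ^ u p ^ m` by `p < σ ^ u`, which `4 ≤ σ` forbids.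
      interval-ratio : ∀ {L ℓ} → p ^ m ≤ L ^ suc m → L ≤ 2 * ℓ → p ≤ σ * ℓ
      interval-ratio {L} {ℓ} p≤L L≤2ℓ = ≮⇒≥ λ σℓ<p → <-irrefl refl (begin-strict
        σ ^ suc m * p ^ m ≤⟨ *-monoʳ-≤ (σ ^ suc m) p≤L ⟩
        σ ^ suc m * L ^ suc m ≡⟨ *-^ (suc m) σ L ⟨
        (σ * L) ^ suc m ≤⟨ ^-monoˡ-≤ (suc m) (≤-trans (*-monoʳ-≤ σ L≤2ℓ) (≤-trans (≤-reflexive (swap σ ℓ)) (*-monoʳ-≤ 2 (<⇒≤ σℓ<p)))) ⟩
        (2 * p) ^ suc m ≡⟨ *-^ (suc m) 2 p ⟩
        2 ^ suc m * (p * p ^ m) <⟨ *-monoʳ-< (2 ^ suc m) {{m^n≢0 2 (suc m)}} (*-monoˡ-< (p ^ m) {{m^n≢0 p m {{>-nonZero 1≤p}}}} p<σ^u) ⟩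
        2 ^ suc m * (σ ^ u * p ^ m) ≡⟨ *-assoc (2 ^ suc m) (σ ^ u) (p ^ m) ⟨
        2 ^ suc m * σ ^ u * p ^ m ≤⟨ *-monoˡ-≤ (p ^ m) collapse ⟩
        σ ^ suc m * p ^ m ∎)
        where
        open ≤-Reasoning
        swap : ∀ a b → a * (2 * b) ≡ 2 * (a * b)
        swap = solve-∀
        exponent : suc m ≡ 2 * suc u
        exponent = double u
          where
          double : ∀ u → suc (suc (u + u)) ≡ 2 * suc u
          double = solve-∀
        collapse : 2 ^ suc m * σ ^ u ≤ σ ^ suc m
        collapse = begin
          2 ^ suc m * σ ^ u ≡⟨ cong (λ t → 2 ^ t * σ ^ u) exponent ⟩
          2 ^ (2 * suc u) * σ ^ u ≡⟨ cong (_* σ ^ u) (^-*-assoc 2 2 (suc u)) ⟨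
          4 ^ suc u * σ ^ u ≤⟨ *-mono-≤ (^-monoˡ-≤ (suc u) 4≤σ) (^-monoʳ-≤ σ (n≤1+n u)) ⟩
          σ ^ suc u * σ ^ suc u ≡⟨ ^-distribˡ-+-* σ (suc u) (suc u) ⟨
          σ ^ (suc u + suc u) ≡⟨ cong (σ ^_) (trans (cong (suc u +_) (sym (+-identityʳ (suc u)))) (sym exponent)) ⟩
          σ ^ suc m ∎

    choose : ∀ {d p} → 1 ≤ p → C ^ suc k * p < d ^ suc k → ParameterChoice k J m d p
    choose {d} {p} 1≤p d-large = record
      { N = N ; q = q ; σ = σ ; Q = Q q ; c = c q
      ; N-blocks = N-blocks ; 1≤N = 1≤N ; p<N^ = p<N^ ; 32≤q = 32≤q ; p<q^J = p<q^J ; σ≤q = fσ≤q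
      ; 1≤σ = ≤-trans (s≤s z≤n) 4≤σ
      ; interval-ratio = λ {L} {ℓ} → interval-ratio {L} {ℓ}
      ; Q-def = refl
      ; Q≤c = ≤-trans (m≤n+m (Q q) (8 * (q * q * q))) tail
      ; q-bound = ≤-trans (m≤m+n (8 * (q * q * q)) (Q q)) tail
      ; W-bound = ≤-trans (m≤m+n (2 * (2 * Q q * Q q) ^ 1) _) (m≤n+m _ (2 * (2 * Q q * Q q) ^ 5))
      ; T-bound = m≤m+n (2 * (2 * Q q * Q q) ^ 5) _
      ; q²≤N = m+n≤o⇒m≤o (4 * (q * q)) threshold≤N
      ; K≤N = m+n≤o⇒m≤o (16 * q * K q) threshold-tail
      ; N-large = ≤-trans (≤-reflexive (+-comm 1 (2 * K q * c q * Q q * q))) (m+n≤o⇒n≤o (16 * q * K q) threshold-tail) }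
      where
      open Choice {d} {p} 1≤p d-large
      tail : 8 * (q * q * q) + Q q ≤ c q
      tail = ≤-trans (m≤n+m (8 * (q * q * q) + Q q) (2 * (2 * Q q * Q q) ^ 1)) (m≤n+m _ (2 * (2 * Q q * Q q) ^ 5))
      threshold-tail : 16 * q * K q + (2 * K q * c q * Q q * q + 1) ≤ N
      threshold-tail = m+n≤o⇒n≤o (4 * (q * q)) threshold≤N

-- The field with `p` elements, carried by `Fin p`.

module PrimeField (p : ℕ) .{{_ : NonZero p}} (p-prime : Prime p) where

  private
    P : ℤ
    P = pos p

  remainder-unique : ∀ {r s} → r < p → s < p → ∀ a b →
                     pos r ℤ.+ a ℤ.* P ≡ pos s ℤ.+ b ℤ.* P → r ≡ s
  remainder-unique {r} {s} r<p s<p a b eq = ℤ.+-injective (ℤ.i-j≡0⇒i≡j (pos r) (pos s) (ℤ.∣i∣≡0⇒i≡0 (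
    trans (cong ∣_∣ diff) (trans (ℤ.abs-* (b ℤ.- a) P) (cong (_* p) c≡0)))))
    where
    identity₁ : ∀ x y u v → x ℤ.- y ≡ (x ℤ.+ u) ℤ.- (y ℤ.+ v) ℤ.+ (v ℤ.- u)
    identity₁ = ℤ-Solver.solve-∀
    identity₂ : ∀ x a b z → z ℤ.- z ℤ.+ (b ℤ.* x ℤ.- a ℤ.* x) ≡ (b ℤ.- a) ℤ.* x
    identity₂ = ℤ-Solver.solve-∀
    diff : pos r ℤ.- pos s ≡ (b ℤ.- a) ℤ.* P
    diff = trans (identity₁ (pos r) (pos s) (a ℤ.* P) (b ℤ.* P))
          (trans (cong (λ t → t ℤ.- (pos s ℤ.+ b ℤ.* P) ℤ.+ (b ℤ.* P ℤ.- a ℤ.* P)) eq) (identity₂ P a b (pos s ℤ.+ b ℤ.* P)))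
    small : ∣ b ℤ.- a ∣ * p < 1 * p
    small = subst₂ _<_ (trans (cong ∣_∣ (trans (sym (ℤ.m-n≡m⊖n r s)) diff)) (ℤ.abs-* (b ℤ.- a) P)) (sym (ℕ.*-identityˡ p))
              (ℕ.≤-<-trans (ℤ.∣m⊝n∣≤m⊔n r s) (ℕ.⊔-lub r<p s<p))
    c≡0 : ∣ b ℤ.- a ∣ ≡ 0
    c≡0 = ℕ.n<1⇒n≡0 (ℕ.*-cancelʳ-< p _ _ small)

  F : Set
  F = Fin p

  opaque
    -- Reduction modulo `p`. Each ring law of `F` is transported from `ℤ` along this surjection,
    -- which is also the coefficient map of the ring solver.
    ⟦_⟧ : ℤ → F
    ⟦ z ⟧ = fromℕ< (n%ℕd<d z p)

    ι : F → ℤ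
    ι x = pos (toℕ x)

    ι-def : ∀ x → ι x ≡ pos (toℕ x)
    ι-def x = refl

    ⟦⟧-toℕ : ∀ z → pos (toℕ ⟦ z ⟧) ℤ.+ (z /ℕ p) ℤ.* P ≡ z
    ⟦⟧-toℕ z = trans (cong (λ r → pos r ℤ.+ (z /ℕ p) ℤ.* P) (Fin.toℕ-fromℕ< (n%ℕd<d z p)))
                     (sym (a≡a%ℕn+[a/ℕn]*n z p))

    ⟦⟧-unique : ∀ z x k → z ≡ pos (toℕ x) ℤ.+ k ℤ.* P → ⟦ z ⟧ ≡ x
    ⟦⟧-unique z x k eq = Fin.toℕ-injective (remainder-unique (Fin.toℕ<n ⟦ z ⟧) (Fin.toℕ<n x) (z /ℕ p) k
                          (trans (⟦⟧-toℕ z) eq))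

    ⟦ι⟧ : ∀ x → ⟦ ι x ⟧ ≡ x
    ⟦ι⟧ x = ⟦⟧-unique (ι x) x (pos 0) (sym (ℤ.+-identityʳ _))

    ⟦⟧-mod : ∀ z w k → z ≡ w ℤ.+ k ℤ.* P → ⟦ z ⟧ ≡ ⟦ w ⟧
    ⟦⟧-mod z w k eq = ⟦⟧-unique z ⟦ w ⟧ (w /ℕ p ℤ.+ k) (trans eq (trans (cong (ℤ._+ k ℤ.* P) (sym (⟦⟧-toℕ w)))
      (identity (pos (toℕ ⟦ w ⟧)) (w /ℕ p) k P)))
      where
      identity : ∀ r a k P → (r ℤ.+ a ℤ.* P) ℤ.+ k ℤ.* P ≡ r ℤ.+ (a ℤ.+ k) ℤ.* P
      identity = ℤ-Solver.solve-∀

    ι⟦⟧ : ∀ z → ∃ λ k → ι ⟦ z ⟧ ≡ z ℤ.+ k ℤ.* P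
    ι⟦⟧ z = ℤ.- (z /ℕ p) , trans (identity (ι ⟦ z ⟧) (z /ℕ p) P) (cong (λ t → t ℤ.+ (ℤ.- (z /ℕ p)) ℤ.* P) (⟦⟧-toℕ z))
      where
      identity : ∀ r a P → r ≡ (r ℤ.+ a ℤ.* P) ℤ.+ (ℤ.- a) ℤ.* P
      identity = ℤ-Solver.solve-∀

  infixl 6 _⊕_ _⊖_
  infixl 7 _⊗_
  infix 8 ⊝_

  0# 1# : F
  0# = ⟦ pos 0 ⟧
  1# = ⟦ pos 1 ⟧

  opaque
    _⊕_ _⊗_ : F → F → F
    x ⊕ y = ⟦ ι x ℤ.+ ι y ⟧
    x ⊗ y = ⟦ ι x ℤ.* ι y ⟧

    ⊝_ : F → F
    ⊝ x = ⟦ ℤ.- ι x ⟧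

    +-homo : ∀ z w → ⟦ z ℤ.+ w ⟧ ≡ ⟦ z ⟧ ⊕ ⟦ w ⟧
    +-homo z w with ι⟦⟧ z | ι⟦⟧ w
    ... | k , eq₁ | l , eq₂ = sym (⟦⟧-mod _ _ (k ℤ.+ l) (trans (cong₂ ℤ._+_ eq₁ eq₂) (identity z w k l P)))
      where
      identity : ∀ z w k l P → (z ℤ.+ k ℤ.* P) ℤ.+ (w ℤ.+ l ℤ.* P) ≡ (z ℤ.+ w) ℤ.+ (k ℤ.+ l) ℤ.* P
      identity = ℤ-Solver.solve-∀

    *-homo : ∀ z w → ⟦ z ℤ.* w ⟧ ≡ ⟦ z ⟧ ⊗ ⟦ w ⟧
    *-homo z w with ι⟦⟧ z | ι⟦⟧ w
    ... | k , eq₁ | l , eq₂ = sym (⟦⟧-mod _ _ (z ℤ.* l ℤ.+ k ℤ.* w ℤ.+ k ℤ.* l ℤ.* P)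
          (trans (cong₂ ℤ._*_ eq₁ eq₂) (identity z w k l P)))
      where
      identity : ∀ z w k l P → (z ℤ.+ k ℤ.* P) ℤ.* (w ℤ.+ l ℤ.* P)
               ≡ (z ℤ.* w) ℤ.+ (z ℤ.* l ℤ.+ k ℤ.* w ℤ.+ k ℤ.* l ℤ.* P) ℤ.* P
      identity = ℤ-Solver.solve-∀

    neg-homo : ∀ z → ⟦ ℤ.- z ⟧ ≡ ⊝ ⟦ z ⟧
    neg-homo z with ι⟦⟧ z
    ... | k , eq = sym (⟦⟧-mod _ _ (ℤ.- k) (trans (cong ℤ.-_ eq) (identity z k P)))
      where
      identity : ∀ z k P → ℤ.- (z ℤ.+ k ℤ.* P) ≡ (ℤ.- z) ℤ.+ (ℤ.- k) ℤ.* P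
      identity = ℤ-Solver.solve-∀

  _⊖_ : F → F → F
  x ⊖ y = x ⊕ (⊝ y)

  private
    lift₁ : {f g : F → F} → (∀ z → f ⟦ z ⟧ ≡ g ⟦ z ⟧) → ∀ x → f x ≡ g x
    lift₁ {f} {g} h x = subst (λ y → f y ≡ g y) (⟦ι⟧ x) (h (ι x))

    lift₂ : {f g : F → F → F} → (∀ z w → f ⟦ z ⟧ ⟦ w ⟧ ≡ g ⟦ z ⟧ ⟦ w ⟧) → ∀ x y → f x y ≡ g x y
    lift₂ {f} {g} h x = lift₁ λ w → lift₁ {λ y → f y ⟦ w ⟧} {λ y → g y ⟦ w ⟧} (λ z → h z w) x

    lift₃ : {f g : F → F → F → F} → (∀ z w v → f ⟦ z ⟧ ⟦ w ⟧ ⟦ v ⟧ ≡ g ⟦ z ⟧ ⟦ w ⟧ ⟦ v ⟧) → ∀ x y u → f x y u ≡ g x y u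
    lift₃ {f} {g} h x y = lift₁ λ v → lift₂ {λ x y → f x y ⟦ v ⟧} {λ x y → g x y ⟦ v ⟧} (λ z w → h z w v) x y

    +-assoc : ∀ x y z → (x ⊕ y) ⊕ z ≡ x ⊕ (y ⊕ z)
    +-assoc = lift₃ λ z w v → begin
      (⟦ z ⟧ ⊕ ⟦ w ⟧) ⊕ ⟦ v ⟧ ≡⟨ cong (_⊕ ⟦ v ⟧) (+-homo z w) ⟨
      ⟦ z ℤ.+ w ⟧ ⊕ ⟦ v ⟧ ≡⟨ +-homo (z ℤ.+ w) v ⟨
      ⟦ (z ℤ.+ w) ℤ.+ v ⟧ ≡⟨ cong ⟦_⟧ (ℤ.+-assoc z w v) ⟩
      ⟦ z ℤ.+ (w ℤ.+ v) ⟧ ≡⟨ +-homo z (w ℤ.+ v) ⟩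
      ⟦ z ⟧ ⊕ ⟦ w ℤ.+ v ⟧ ≡⟨ cong (⟦ z ⟧ ⊕_) (+-homo w v) ⟩
      ⟦ z ⟧ ⊕ (⟦ w ⟧ ⊕ ⟦ v ⟧) ∎
      where open ≡-Reasoning

    *-assoc : ∀ x y z → (x ⊗ y) ⊗ z ≡ x ⊗ (y ⊗ z)
    *-assoc = lift₃ λ z w v → begin
      (⟦ z ⟧ ⊗ ⟦ w ⟧) ⊗ ⟦ v ⟧ ≡⟨ cong (_⊗ ⟦ v ⟧) (*-homo z w) ⟨
      ⟦ z ℤ.* w ⟧ ⊗ ⟦ v ⟧ ≡⟨ *-homo (z ℤ.* w) v ⟨
      ⟦ (z ℤ.* w) ℤ.* v ⟧ ≡⟨ cong ⟦_⟧ (ℤ.*-assoc z w v) ⟩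
      ⟦ z ℤ.* (w ℤ.* v) ⟧ ≡⟨ *-homo z (w ℤ.* v) ⟩
      ⟦ z ⟧ ⊗ ⟦ w ℤ.* v ⟧ ≡⟨ cong (⟦ z ⟧ ⊗_) (*-homo w v) ⟩
      ⟦ z ⟧ ⊗ (⟦ w ⟧ ⊗ ⟦ v ⟧) ∎
      where open ≡-Reasoning

    +-comm : ∀ x y → x ⊕ y ≡ y ⊕ x
    +-comm = lift₂ λ z w → trans (sym (+-homo z w)) (trans (cong ⟦_⟧ (ℤ.+-comm z w)) (+-homo w z))

    *-comm : ∀ x y → x ⊗ y ≡ y ⊗ x
    *-comm = lift₂ λ z w → trans (sym (*-homo z w)) (trans (cong ⟦_⟧ (ℤ.*-comm z w)) (*-homo w z))

    +-identityˡ : ∀ x → 0# ⊕ x ≡ x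
    +-identityˡ = lift₁ λ z → trans (sym (+-homo (pos 0) z)) (cong ⟦_⟧ (ℤ.+-identityˡ z))

    *-identityˡ : ∀ x → 1# ⊗ x ≡ x
    *-identityˡ = lift₁ λ z → trans (sym (*-homo (pos 1) z)) (cong ⟦_⟧ (ℤ.*-identityˡ z))

    -‿inverseˡ : ∀ x → (⊝ x) ⊕ x ≡ 0#
    -‿inverseˡ = lift₁ {λ x → (⊝ x) ⊕ x} {λ _ → 0#} λ z →
      trans (cong (_⊕ ⟦ z ⟧) (sym (neg-homo z))) (trans (sym (+-homo (ℤ.- z) z)) (cong ⟦_⟧ (ℤ.+-inverseˡ z)))

    *-distribˡ-+ : ∀ x y z → x ⊗ (y ⊕ z) ≡ x ⊗ y ⊕ x ⊗ z
    *-distribˡ-+ = lift₃ λ z w v → begin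
      ⟦ z ⟧ ⊗ (⟦ w ⟧ ⊕ ⟦ v ⟧) ≡⟨ cong (⟦ z ⟧ ⊗_) (+-homo w v) ⟨
      ⟦ z ⟧ ⊗ ⟦ w ℤ.+ v ⟧ ≡⟨ *-homo z (w ℤ.+ v) ⟨
      ⟦ z ℤ.* (w ℤ.+ v) ⟧ ≡⟨ cong ⟦_⟧ (ℤ.*-distribˡ-+ z w v) ⟩
      ⟦ z ℤ.* w ℤ.+ z ℤ.* v ⟧ ≡⟨ +-homo (z ℤ.* w) (z ℤ.* v) ⟩
      ⟦ z ℤ.* w ⟧ ⊕ ⟦ z ℤ.* v ⟧ ≡⟨ cong₂ _⊕_ (*-homo z w) (*-homo z v) ⟩
      ⟦ z ⟧ ⊗ ⟦ w ⟧ ⊕ ⟦ z ⟧ ⊗ ⟦ v ⟧ ∎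
      where open ≡-Reasoning

    comm∧idˡ⇒id : ∀ {_∙_ : F → F → F} {e} → (∀ x y → x ∙ y ≡ y ∙ x) → (∀ x → e ∙ x ≡ x) →
                  (∀ x → e ∙ x ≡ x) × (∀ x → x ∙ e ≡ x)
    comm∧idˡ⇒id comm idˡ = idˡ , λ x → trans (comm x _) (idˡ x)

  commutativeRing : CommutativeRing _ _
  commutativeRing = record
    { Carrier = F ; _≈_ = _≡_ ; _+_ = _⊕_ ; _*_ = _⊗_ ; -_ = λ x → ⊝ x ; 0# = 0# ; 1# = 1#
    ; isCommutativeRing = record
      { isRing = record
        { +-isAbelianGroup = record
          { isGroup = record
            { isMonoid = record
              { isSemigroup = record
                { isMagma = record { isEquivalence = isEquivalence ; ∙-cong = cong₂ _⊕_ }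
                ; assoc = +-assoc }
              ; identity = comm∧idˡ⇒id +-comm +-identityˡ }
            ; inverse = -‿inverseˡ , λ x → trans (+-comm x (⊝ x)) (-‿inverseˡ x)
            ; ⁻¹-cong = cong (λ x → ⊝ x) }
          ; comm = +-comm }
        ; *-cong = cong₂ _⊗_
        ; *-assoc = *-assoc
        ; *-identity = comm∧idˡ⇒id *-comm *-identityˡ
        ; distrib = *-distribˡ-+ , λ x y z →
            trans (*-comm (y ⊕ z) x) (trans (*-distribˡ-+ x y z) (cong₂ _⊕_ (*-comm x y) (*-comm x z))) }
      ; *-comm = *-comm } }

  private
    F-ring : AlmostCommutativeRing _ _
    F-ring = fromCommutativeRing commutativeRing

    ℤ⟶F : CommutativeRing.rawRing ℤ.+-*-commutativeRing -Raw-AlmostCommutative⟶ F-ring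
    ℤ⟶F = record { ⟦_⟧ = ⟦_⟧ ; +-homo = +-homo ; *-homo = *-homo ; -‿homo = neg-homo
                 ; 0-homo = refl ; 1-homo = refl }

  open import Algebra.Solver.Ring (CommutativeRing.rawRing ℤ.+-*-commutativeRing) F-ring ℤ⟶F
    (λ z w → Data.Maybe.map (cong ⟦_⟧) (dec⇒maybe (z ℤ.≟ w)))
    public using (solve; _:=_; _:+_; _:*_; :-_; _:-_; con)

  -- The field is exhausted by adding `1#` repeatedly. A set of quotients other than the whole field
  -- must therefore have a member `x` with `x ⊕ 1#` outside, which is where the pivot comes from.
  generated : (Q : F → Set) → Q 0# → (∀ x → Q x → Q (x ⊕ 1#)) → ∀ x → Q x
  generated Q q₀ qs x = subst Q (trans (cong ⟦_⟧ (sym (ι-def x))) (⟦ι⟧ x)) (go (toℕ x))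
    where
    go : ∀ n → Q ⟦ pos n ⟧
    go zero = q₀
    go (suc n) = subst Q (trans (sym (+-homo (pos n) (pos 1))) (cong (⟦_⟧ ∘ pos) (ℕ.+-comm n 1))) (qs _ (go n))

  inverse : ∀ x → x ≢ 0# → ∃ λ y → x ⊗ y ≡ 1#
  inverse x x≢0 with coprime-Bézout (prime⇒coprime p-prime {{≢-nonZero toℕx≢0}} (Fin.toℕ<n x))
    where
    toℕx≢0 : toℕ x ≢ 0
    toℕx≢0 eq = x≢0 (trans (sym (⟦ι⟧ x)) (cong ⟦_⟧ (trans (ι-def x) (cong pos eq))))
  ... | Bézout.+- u v eq = ⟦ ℤ.- pos v ⟧ , trans (cong (_⊗ ⟦ ℤ.- pos v ⟧) (sym (⟦ι⟧ x)))
          (trans (sym (*-homo (ι x) (ℤ.- pos v))) (⟦⟧-mod _ _ (ℤ.- pos u)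
            (trans (cong (λ t → t ℤ.* ℤ.- pos v) (ι-def x)) (identity (pos v) (pos (toℕ x)) (pos u) P casted))))
    where
    casted : pos 1 ℤ.+ pos v ℤ.* pos (toℕ x) ≡ pos u ℤ.* P
    casted = trans (cong (λ t → pos 1 ℤ.+ t) (sym (ℤ.pos-* v (toℕ x)))) (trans (cong pos eq) (ℤ.pos-* u p))
    identity : ∀ v x u P → pos 1 ℤ.+ v ℤ.* x ≡ u ℤ.* P → x ℤ.* ℤ.- v ≡ pos 1 ℤ.+ ℤ.- u ℤ.* P
    identity v x u P h = trans (i₁ v x) (trans (cong (λ t → pos 1 ℤ.- t) h) (i₂ u P))
      where
      i₁ : ∀ v x → x ℤ.* ℤ.- v ≡ pos 1 ℤ.- (pos 1 ℤ.+ v ℤ.* x)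
      i₁ = ℤ-Solver.solve-∀
      i₂ : ∀ u P → pos 1 ℤ.- u ℤ.* P ≡ pos 1 ℤ.+ ℤ.- u ℤ.* P
      i₂ = ℤ-Solver.solve-∀
  ... | Bézout.-+ u v eq = ⟦ pos v ⟧ , trans (cong (_⊗ ⟦ pos v ⟧) (sym (⟦ι⟧ x)))
          (trans (sym (*-homo (ι x) (pos v))) (⟦⟧-mod _ _ (pos u)
            (trans (cong (λ t → t ℤ.* pos v) (ι-def x)) (trans (ℤ.*-comm (pos (toℕ x)) (pos v)) (sym casted)))))
    where
    casted : pos 1 ℤ.+ pos u ℤ.* P ≡ pos v ℤ.* pos (toℕ x)
    casted = trans (cong (λ t → pos 1 ℤ.+ t) (sym (ℤ.pos-* u p))) (trans (cong pos eq) (ℤ.pos-* v (toℕ x)))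

-- Subsets of the field, their sizes and convolutions.

module Subsets (p : ℕ) .{{_ : NonZero p}} (p-prime : Prime p) where

  open import Data.Nat.Properties
  open FiniteSums
  open PrimeField p p-prime

  ⊕-⊖ : ∀ x c → (x ⊖ c) ⊕ c ≡ x
  ⊕-⊖ = solve 2 (λ x c → (x :- c) :+ c := x) refl

  ⊖-⊕ : ∀ x c → (x ⊕ c) ⊖ c ≡ x
  ⊖-⊕ = solve 2 (λ x c → (x :+ c) :- c := x) refl

  ⊖-⊖ : ∀ c x → c ⊖ (c ⊖ x) ≡ x
  ⊖-⊖ = solve 2 (λ c x → c :- (c :- x) := x) refl

  ⊖-self : ∀ x → x ⊖ x ≡ 0#
  ⊖-self = solve 1 (λ x → x :- x := con ℤ.0ℤ) refl

  ⊖≡0⇒≡ : ∀ {x y} → x ⊖ y ≡ 0# → x ≡ y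
  ⊖≡0⇒≡ {x} {y} eq = trans (solve 2 (λ x y → x := (x :- y) :+ y) refl x y)
                   (trans (cong (_⊕ y) eq) (solve 1 (λ y → con ℤ.0ℤ :+ y := y) refl y))

  ⊗-cancel : ∀ {u v} → u ⊗ v ≡ 1# → ∀ x → (x ⊗ u) ⊗ v ≡ x
  ⊗-cancel {u} {v} uv x = trans (solve 3 (λ x u v → (x :* u) :* v := x :* (u :* v)) refl x u v)
                         (trans (cong (x ⊗_) uv) (solve 1 (λ x → x :* con ℤ.1ℤ := x) refl x))

  ⊗-comm : ∀ x y → x ⊗ y ≡ y ⊗ x
  ⊗-comm = solve 2 (λ x y → x :* y := y :* x) refl

  ⊗-cancelʳ : ∀ {u v} → u ⊗ v ≡ 1# → ∀ {x y} → x ⊗ u ≡ y ⊗ u → x ≡ y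
  ⊗-cancelʳ {u} {v} uv {x} {y} eq = trans (sym (⊗-cancel uv x)) (trans (cong (_⊗ v) eq) (⊗-cancel uv y))

  ∑-shift : ∀ c (f : F → ℕ) → ∑ (λ x → f (x ⊕ c)) ≡ ∑ f
  ∑-shift c = ∑-reindex (_⊕ c) (_⊖ c) (λ x → ⊕-⊖ x c) (λ x → ⊖-⊕ x c)

  ∑-reflect : ∀ c (f : F → ℕ) → ∑ (λ x → f (c ⊖ x)) ≡ ∑ f
  ∑-reflect c = ∑-reindex (c ⊖_) (c ⊖_) (⊖-⊖ c) (⊖-⊖ c)

  ∑-dilate : ∀ {u v} → u ⊗ v ≡ 1# → (f : F → ℕ) → ∑ (λ x → f (x ⊗ u)) ≡ ∑ f
  ∑-dilate {u} {v} uv = ∑-reindex (_⊗ u) (_⊗ v) (⊗-cancel (trans (⊗-comm v u) uv)) (⊗-cancel uv)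

  Subset : Set
  Subset = F → Bool

  infix 4 _∈_ _⊆_ _∈?_

  _∈_ : F → Subset → Set
  x ∈ X = X x ≡ true

  _∈?_ : ∀ x X → Dec (x ∈ X)
  x ∈? X = X x Data.Bool.≟ true

  _⊆_ : Subset → Subset → Set
  X ⊆ Y = ∀ {x} → x ∈ X → x ∈ Y

  does⁺ : ∀ {P : Set} (d : Dec P) → P → does d ≡ true
  does⁺ (yes _) _ = refl
  does⁺ (no ¬p) p = contradiction p ¬p

  does⁻ : ∀ {P : Set} (d : Dec P) → does d ≡ true → P
  does⁻ (yes p) _ = p

  #_ : Subset → ℕ
  # X = ∑ λ x → 𝟙 (X x)

  infix 9 #_

  𝟙-mono : ∀ {a b} → (a ≡ true → b ≡ true) → 𝟙 a ≤ 𝟙 b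
  𝟙-mono {false} h = z≤n
  𝟙-mono {true} {b} h rewrite h refl = ≤-refl

  #-mono : ∀ {X Y} → X ⊆ Y → # X ≤ # Y
  #-mono X⊆Y = ∑-mono λ x → 𝟙-mono X⊆Y

  #≤p : ∀ X → # X ≤ p
  #≤p X = ≤-trans (∑-mono λ x → 𝟙≤1 (X x)) (≤-reflexive (trans (∑-const p 1) (*-identityʳ p)))

  ∈⇒1≤# : ∀ {X x} → x ∈ X → 1 ≤ # X
  ∈⇒1≤# {X} {x} x∈X = ≤-trans (≤-reflexive (sym (𝟙-true x∈X))) (≤∑ (λ x → 𝟙 (X x)) x)

  1≤#⇒∈ : ∀ {X} → 1 ≤ # X → ∃ λ x → x ∈ X
  1≤#⇒∈ {X} 1≤X with ∑-average (λ x → 𝟙 (X x)) (λ _ → 0) (λ _ → 0) ≤-refl 1≤X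
  ... | x , 1≤ , _ = x , 𝟙⁻ 1≤

  injection⇒≤# : ∀ {n X} (f : Fin n → F) → (∀ i → f i ∈ X) → (∀ i j → f i ≡ f j → i ≡ j) → n ≤ # X
  injection⇒≤# {n} {X} f f∈X inj = begin
    n ≡⟨ trans (∑-const n 1) (*-identityʳ n) ⟨
    ∑ {n} (λ _ → 1) ≤⟨ ∑-mono (λ i → hit i) ⟩
    ∑ (λ i → ∑ (λ y → 𝟙 (does (f i Fin.≟ y)))) ≡⟨ ∑-swap _ ⟩
    ∑ (λ y → ∑ (λ i → 𝟙 (does (f i Fin.≟ y)))) ≤⟨ ∑-mono fibre ⟩
    # X ∎
    where
    open ≤-Reasoning
    hit : ∀ i → 1 ≤ ∑ (λ y → 𝟙 (does (f i Fin.≟ y)))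
    hit i = ≤-trans (≤-reflexive (sym (𝟙-true (does⁺ (f i Fin.≟ f i) refl)))) (≤∑ (λ y → 𝟙 (does (f i Fin.≟ y))) (f i))
    fibre : ∀ y → ∑ (λ i → 𝟙 (does (f i Fin.≟ y))) ≤ 𝟙 (X y)
    fibre y with Fin.any? (λ i → f i Fin.≟ y)
    ... | yes (i , refl) = ≤-trans (∑-subsingleton _ (λ j → 𝟙≤1 _)
            λ j k hj hk → inj j k (trans (does⁻ (f j Fin.≟ y) (𝟙⁻ hj)) (sym (does⁻ (f k Fin.≟ y) (𝟙⁻ hk)))))
            (≤-reflexive (sym (𝟙-true (f∈X i))))
    ... | no ¬h = ≤-trans (∑-mono empty) (≤-trans (≤-reflexive (∑-zero n)) z≤n)
      where
      empty : ∀ i → 𝟙 (does (f i Fin.≟ y)) ≤ 0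
      empty i with f i Fin.≟ y
      ... | yes eq = contradiction (i , eq) ¬h
      ... | no _ = z≤n

  -- Markov's inequality with the denominator cleared.
  #-bound : ∀ {X c} (f : F → ℕ) → (∀ {x} → x ∈ X → c ≤ f x) → # X * c ≤ ∑ f
  #-bound {X} {c} f h = ≤-trans (≤-reflexive (sym (∑-*ʳ c _))) (∑-mono pointwise)
    where
    pointwise : ∀ x → 𝟙 (X x) * c ≤ f x
    pointwise x with X x in eq
    ... | true = ≤-trans (≤-reflexive (*-identityˡ c)) (h eq)
    ... | false = z≤n

  infixl 6 _⋆_

  _⋆_ : (F → ℕ) → (F → ℕ) → F → ℕ
  (f ⋆ g) d = ∑ λ e → f e * g (d ⊖ e)

  ∑-⋆ : ∀ f g → ∑ (f ⋆ g) ≡ ∑ f * ∑ g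
  ∑-⋆ f g = begin
    ∑ (λ d → ∑ (λ e → f e * g (d ⊖ e))) ≡⟨ ∑-swap _ ⟩
    ∑ (λ e → ∑ (λ d → f e * g (d ⊖ e))) ≡⟨ ∑-cong (λ e → trans (∑-*ˡ (f e) _) (cong (f e *_) (∑-shift (⊝ e) g))) ⟩
    ∑ (λ e → f e * ∑ g) ≡⟨ ∑-*ʳ (∑ g) f ⟩
    ∑ f * ∑ g ∎
    where open ≡-Reasoning

  -- The number of representations of `d` as a difference of two elements of `Y`.
  corr : Subset → F → ℕ
  corr Y d = ∑ λ y → 𝟙 (Y y) * 𝟙 (Y (y ⊕ d))

  ∑-corr : ∀ Y → ∑ (corr Y) ≡ # Y * # Y
  ∑-corr Y = begin
    ∑ (λ d → ∑ (λ y → 𝟙 (Y y) * 𝟙 (Y (y ⊕ d)))) ≡⟨ ∑-swap _ ⟩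
    ∑ (λ y → ∑ (λ d → 𝟙 (Y y) * 𝟙 (Y (y ⊕ d)))) ≡⟨ ∑-cong (λ y → trans (∑-*ˡ (𝟙 (Y y)) _) (cong (𝟙 (Y y) *_)
        (∑-reindex (y ⊕_) (_⊖ y) (λ x → solve 2 (λ x y → y :+ (x :- y) := x) refl x y)
                                 (λ x → solve 2 (λ x y → (y :+ x) :- y := x) refl x y) (λ x → 𝟙 (Y x))))) ⟩
    ∑ (λ y → 𝟙 (Y y) * # Y) ≡⟨ ∑-*ʳ (# Y) _ ⟩
    # Y * # Y ∎
    where open ≡-Reasoning

-- The Balog-Szemerédi-Gowers theorem, by averaging over neighbourhoods.

module BalogSzemerédiGowers (p : ℕ) .{{_ : NonZero p}} (p-prime : Prime p) where

  open import Data.Nat.Properties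
  open FiniteSums
  open PrimeField p p-prime
  open Subsets p p-prime

  ∧⁻ˡ : ∀ {a b} → a ∧ b ≡ true → a ≡ true
  ∧⁻ˡ {true} _ = refl

  ∧⁻ʳ : ∀ {a b} → a ∧ b ≡ true → b ≡ true
  ∧⁻ʳ {true} h = h

  𝟙² : ∀ b → 𝟙 b * 𝟙 b ≡ 𝟙 b
  𝟙² true = refl
  𝟙² false = refl

  square-cancel-≤ : ∀ {m n} → m * m ≤ n * n → m ≤ n
  square-cancel-≤ {m} {n} h = ≮⇒≥ λ n<m → <⇒≱ (*-mono-< n<m n<m) h

  opaque
    κ : ℕ → ℕ
    κ q = q * (q * q)

    κ-def : ∀ q → κ q ≡ q * (q * q)
    κ-def q = refl

  -- `D` is any set of differences of `X′`, so that the full difference set may be inserted later.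
  -- The constant is `8 q¹²`.
  HasStableSubset : Subset → ℕ → Set
  HasStableSubset X q = ∃ λ X′ → (X′ ⊆ X) × (# X ≤ 4 * q * # X′) ×
    (∀ D → (∀ {d} → d ∈ D → ∃₂ λ u t → u ∈ X′ × t ∈ X′ × d ≡ u ⊖ t) →
     # D ≤ 8 * ((q * q) * (q * q) * (q * q) * (q * q) * (q * q) * (q * q)) * # X′)

  module _ (X Y : Subset) {a a⁻¹ b b⁻¹ : F} (aa⁻¹ : a ⊗ a⁻¹ ≡ 1#) (bb⁻¹ : b ⊗ b⁻¹ ≡ 1#) (q : ℕ) .{{_ : NonZero q}} (32≤q : 32 ≤ q) where
    private
      n = # X
      -- The neighbourhood of `y` in the bipartite graph on two copies of `X` in which `y` is joined
      -- to `x` when `x a - y b` lies in `Y`.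
      V : F → Subset
      V y x = X x ∧ Y (x ⊗ a ⊖ y ⊗ b)
      v : F → F → ℕ
      v y x = 𝟙 (V y x)

    common : F → F → ℕ
    common u w = ∑ λ y → 𝟙 (X y) * (v y u * v y w)

    -- Pairs in `X` with fewer than `n / q³` common neighbours. They are few inside an average
    -- neighbourhood, and every other pair has a difference with many representations.
    bad : F → F → Bool
    bad u w = X u ∧ (X w ∧ does (κ q * common u w <? n))

    private
      badAt : F → ℕ
      badAt y = ∑ λ u → ∑ λ w → (v y u * v y w) * 𝟙 (bad u w)

      bad-bound : κ q * ∑ (λ y → 𝟙 (X y) * badAt y) ≤ n * n * n
      bad-bound = begin
        κ q * ∑ (λ y → 𝟙 (X y) * badAt y)
          ≡⟨ cong (κ q *_) (∑-cong λ y → trans (sym (∑-*ˡ (𝟙 (X y)) _)) (∑-cong λ u → sym (∑-*ˡ (𝟙 (X y)) _))) ⟩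
        κ q * ∑ (λ y → ∑ λ u → ∑ λ w → 𝟙 (X y) * ((v y u * v y w) * 𝟙 (bad u w)))
          ≡⟨ cong (κ q *_) (trans (∑-swap _) (∑-cong λ u → ∑-swap _)) ⟩
        κ q * ∑ (λ u → ∑ λ w → ∑ λ y → 𝟙 (X y) * ((v y u * v y w) * 𝟙 (bad u w)))
          ≡⟨ cong (κ q *_) (∑-cong λ u → ∑-cong λ w →
               trans (∑-cong λ y → sym (*-assoc (𝟙 (X y)) (v y u * v y w) (𝟙 (bad u w)))) (∑-*ʳ (𝟙 (bad u w)) _)) ⟩
        κ q * ∑ (λ u → ∑ λ w → common u w * 𝟙 (bad u w))
          ≡⟨ trans (sym (∑-*ˡ (κ q) _)) (∑-cong λ u → sym (∑-*ˡ (κ q) _)) ⟩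
        ∑ (λ u → ∑ λ w → κ q * (common u w * 𝟙 (bad u w)))
          ≤⟨ ∑-mono (λ u → ∑-mono λ w → pointwise u w) ⟩
        ∑ (λ u → ∑ λ w → (𝟙 (X u) * 𝟙 (X w)) * n)
          ≡⟨ trans (∑-cong λ u → ∑-*ʳ n _) (trans (∑-*ʳ n _) (cong (_* n) (∑-× _ _))) ⟩
        n * n * n ∎
        where
        open ≤-Reasoning
        weighted : ∀ b₁ b₂ c (d : Dec (κ q * c < n)) → κ q * (c * 𝟙 (b₁ ∧ (b₂ ∧ does d))) ≤ (𝟙 b₁ * 𝟙 b₂) * n
        weighted true true c (yes h) = ≤-trans (≤-reflexive (cong (κ q *_) (*-identityʳ c))) (≤-trans (<⇒≤ h) (≤-reflexive (sym (*-identityˡ n))))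
        weighted true true c (no _) = ≤-trans (≤-reflexive (trans (cong (κ q *_) (*-zeroʳ c)) (*-zeroʳ (κ q)))) z≤n
        weighted true false c _ = ≤-trans (≤-reflexive (trans (cong (κ q *_) (*-zeroʳ c)) (*-zeroʳ (κ q)))) z≤n
        weighted false _ c _ = ≤-trans (≤-reflexive (trans (cong (κ q *_) (*-zeroʳ c)) (*-zeroʳ (κ q)))) z≤n
        pointwise : ∀ u w → κ q * (common u w * 𝟙 (bad u w)) ≤ (𝟙 (X u) * 𝟙 (X w)) * n
        pointwise u w = weighted (X u) (X w) (common u w) (κ q * common u w <? n)

      -- Cauchy-Schwarz turns an average degree of `n / q` into a mean square of the degrees of
      -- `n² / q²`.
      second-moment : 1 ≤ n → n * n ≤ q * ∑ (λ y → 𝟙 (X y) * # (V y)) →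
        n * n * n ≤ q * q * ∑ (λ y → 𝟙 (X y) * (# (V y) * # (V y)))
      second-moment 1≤n h = *-cancelʳ-≤ _ _ n {{>-nonZero 1≤n}} (begin
        n * n * n * n ≡⟨ solve-4 n ⟩
        (n * n) * (n * n) ≤⟨ *-mono-≤ h h ⟩
        (q * Γ) * (q * Γ) ≡⟨ regroup q Γ ⟩
        q * q * (Γ * Γ) ≤⟨ *-monoʳ-≤ (q * q) cs ⟩
        q * q * (n * W) ≡⟨ regroup′ (q * q) n W ⟩
        q * q * W * n ∎)
        where
        open ≤-Reasoning
        Γ = ∑ (λ y → 𝟙 (X y) * # (V y))
        W = ∑ (λ y → 𝟙 (X y) * (# (V y) * # (V y)))
        solve-4 : ∀ n → n * n * n * n ≡ (n * n) * (n * n)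
        solve-4 = solve-∀
        regroup : ∀ q g → (q * g) * (q * g) ≡ q * q * (g * g)
        regroup = solve-∀
        regroup′ : ∀ a b c → a * (b * c) ≡ a * c * b
        regroup′ = solve-∀
        square : ∀ y c → (𝟙 (X y) * c) * (𝟙 (X y) * c) ≡ 𝟙 (X y) * (c * c)
        square y c = trans (regroup (𝟙 (X y)) c) (cong (_* (c * c)) (𝟙² (X y)))
        cs : Γ * Γ ≤ n * W
        cs = subst₂ _≤_
          (cong₂ _*_ eq eq)
          (cong₂ _*_ (∑-cong (λ y → 𝟙² (X y))) (∑-cong (λ y → square y (# (V y)))))
          (cauchy-schwarz (λ y → 𝟙 (X y)) (λ y → 𝟙 (X y) * # (V y)))
          where
          eq : ∑ (λ y → 𝟙 (X y) * (𝟙 (X y) * # (V y))) ≡ Γ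
          eq = ∑-cong λ y → trans (sym (*-assoc (𝟙 (X y)) (𝟙 (X y)) (# (V y)))) (cong (_* # (V y)) (𝟙² (X y)))

      -- A single average of `n² + q³ badAt y` against `2 q² |V y|²` yields a `y` with both
      -- properties. The second one reads `q badAt y ≤ 2 |V y|²`, where `32 ≤ q` provides the factor
      -- 16.
      choose : 1 ≤ n → n * n ≤ q * ∑ (λ y → 𝟙 (X y) * # (V y)) →
        ∃ λ y → n * n ≤ 2 * (q * q) * (# (V y) * # (V y)) × 16 * badAt y ≤ # (V y) * # (V y)
      choose 1≤n h = conclude (∑-average (λ y → 𝟙 (X y)) (λ y → n * n + κ q * badAt y) (λ y → 2 * (q * q) * (# (V y) * # (V y))) total 1≤n)
        where
        open ≤-Reasoning
        double : ∀ n Q W → n * n * n ≤ Q * W → n * (n * n) + n * n * n ≤ 2 * Q * W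
        double n Q W h = subst₂ _≤_ (i₁ n) (sym (i₂ Q W)) (+-mono-≤ h h)
          where
          i₁ : ∀ n → n * n * n + n * n * n ≡ n * (n * n) + n * n * n
          i₁ = solve-∀
          i₂ : ∀ Q W → 2 * Q * W ≡ Q * W + Q * W
          i₂ = solve-∀
        W = ∑ (λ y → 𝟙 (X y) * (# (V y) * # (V y)))
        weighted : ∀ c (h : F → ℕ) → ∑ (λ y → 𝟙 (X y) * (c * h y)) ≡ c * ∑ (λ y → 𝟙 (X y) * h y)
        weighted c h = trans (∑-cong λ y → *-swap (𝟙 (X y)) c (h y)) (∑-*ˡ c _)
        left : ∑ (λ y → 𝟙 (X y) * (n * n + κ q * badAt y)) ≡ n * (n * n) + κ q * ∑ (λ y → 𝟙 (X y) * badAt y)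
        left = trans (∑-cong λ y → *-distribˡ-+ (𝟙 (X y)) (n * n) (κ q * badAt y))
          (trans (∑-+ _ _)
                 (cong₂ _+_ (∑-*ʳ (n * n) _) (weighted (κ q) badAt)))
        total : ∑ (λ y → 𝟙 (X y) * (n * n + κ q * badAt y)) ≤ ∑ (λ y → 𝟙 (X y) * (2 * (q * q) * (# (V y) * # (V y))))
        total = subst₂ _≤_ (sym left) (sym (weighted (2 * (q * q)) (λ y → # (V y) * # (V y))))
          (≤-trans (+-monoʳ-≤ (n * (n * n)) bad-bound) (double n (q * q) W (second-moment 1≤n h)))
        conclude : (∃ λ y → 1 ≤ 𝟙 (X y) × n * n + κ q * badAt y ≤ 2 * (q * q) * (# (V y) * # (V y))) →
          ∃ λ y → n * n ≤ 2 * (q * q) * (# (V y) * # (V y)) × 16 * badAt y ≤ # (V y) * # (V y)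
        conclude (y , _ , hy) = y , m+n≤o⇒m≤o (n * n) hy , *-cancelˡ-≤ 2 (begin
          2 * (16 * badAt y) ≡⟨ *-assoc 2 16 (badAt y) ⟨
          32 * badAt y ≤⟨ *-monoˡ-≤ (badAt y) 32≤q ⟩
          q * badAt y ≤⟨ *-cancelˡ-≤ (q * q) {{m*n≢0 q q}} (≤-trans (≤-reflexive
                                           (trans (i₃ q (badAt y)) (cong (_* badAt y) (sym (κ-def q)))))
                                           (≤-trans (m+n≤o⇒n≤o (n * n) hy) (≤-reflexive (i₄ (q * q) (# (V y) * # (V y)))))) ⟩
          2 * (# (V y) * # (V y)) ∎)
          where
          i₃ : ∀ q x → q * q * (q * x) ≡ q * (q * q) * x
          i₃ = solve-∀
          i₄ : ∀ Q m → 2 * Q * m ≡ Q * (2 * m)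
          i₄ = solve-∀

      -- As `b` is a unit, `y ↦ s a - y b` is a bijection of the field, and the two arguments of `Y`
      -- always differ by `(t - s) a`. Hence every common neighbour of `s` and `t` gives a
      -- representation of `(t - s) a` in `Y - Y`.
      corr-affine : ∀ s t → ∑ (λ y → 𝟙 (Y (s ⊗ a ⊖ y ⊗ b)) * 𝟙 (Y (t ⊗ a ⊖ y ⊗ b))) ≡ corr Y ((t ⊖ s) ⊗ a)
      corr-affine s t = begin
        ∑ (λ y → f (s ⊗ a ⊖ y ⊗ b) (t ⊗ a ⊖ y ⊗ b))
          ≡⟨ ∑-dilate bb⁻¹ (λ y → f (s ⊗ a ⊖ y) (t ⊗ a ⊖ y)) ⟩
        ∑ (λ y → f (s ⊗ a ⊖ y) (t ⊗ a ⊖ y))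
          ≡⟨ ∑-cong (λ y → cong (f (s ⊗ a ⊖ y)) (solve 4 (λ s t a y → t :* a :- y := (s :* a :- y) :+ (t :- s) :* a) refl s t a y)) ⟩
        ∑ (λ y → f (s ⊗ a ⊖ y) ((s ⊗ a ⊖ y) ⊕ (t ⊖ s) ⊗ a))
          ≡⟨ ∑-reflect (s ⊗ a) (λ z → f z (z ⊕ (t ⊖ s) ⊗ a)) ⟩
        corr Y ((t ⊖ s) ⊗ a) ∎
        where
        open ≡-Reasoning
        f : F → F → ℕ
        f z w = 𝟙 (Y z) * 𝟙 (Y w)

      common≤corr : ∀ s t → common s t ≤ corr Y ((t ⊖ s) ⊗ a)
      common≤corr s t = ≤-trans (∑-mono pointwise) (≤-reflexive (corr-affine s t))
        where
        pointwise : ∀ y → 𝟙 (X y) * (v y s * v y t) ≤ 𝟙 (Y (s ⊗ a ⊖ y ⊗ b)) * 𝟙 (Y (t ⊗ a ⊖ y ⊗ b))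
        pointwise y = ≤-trans (*-mono-≤ (𝟙≤1 (X y)) (*-mono-≤ (𝟙-mono (∧⁻ʳ {X s})) (𝟙-mono (∧⁻ʳ {X t})))) (≤-reflexive (*-identityˡ _))

      common-sym : ∀ s t → common s t ≡ common t s
      common-sym s t = ∑-cong λ y → cong (𝟙 (X y) *_) (*-comm (v y s) (v y t))

      -- The number of representations as a sum of two differences of `Y`.
      r₄ : F → ℕ
      r₄ = corr Y ⋆ corr Y

      r₄-path : ∀ u t → r₄ ((u ⊖ t) ⊗ a) ≡ ∑ λ w → corr Y ((u ⊖ w) ⊗ a) * corr Y ((w ⊖ t) ⊗ a)
      r₄-path u t = begin
        ∑ (λ e → corr Y e * corr Y ((u ⊖ t) ⊗ a ⊖ e))
          ≡⟨ ∑-dilate aa⁻¹ (λ e → corr Y e * corr Y ((u ⊖ t) ⊗ a ⊖ e)) ⟨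
        ∑ (λ e → corr Y (e ⊗ a) * corr Y ((u ⊖ t) ⊗ a ⊖ e ⊗ a))
          ≡⟨ ∑-reflect u (λ e → corr Y (e ⊗ a) * corr Y ((u ⊖ t) ⊗ a ⊖ e ⊗ a)) ⟨
        ∑ (λ w → corr Y ((u ⊖ w) ⊗ a) * corr Y ((u ⊖ t) ⊗ a ⊖ (u ⊖ w) ⊗ a))
          ≡⟨ ∑-cong (λ w → cong (λ z → corr Y ((u ⊖ w) ⊗ a) * corr Y z)
               (solve 4 (λ u t a w → (u :- t) :* a :- (u :- w) :* a := (w :- t) :* a) refl u t a w)) ⟩
        ∑ (λ w → corr Y ((u ⊖ w) ⊗ a) * corr Y ((w ⊖ t) ⊗ a)) ∎
        where open ≡-Reasoning

      ∑-r₄ : ∑ (λ d → r₄ (d ⊗ a)) ≡ (# Y * # Y) * (# Y * # Y)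
      ∑-r₄ = trans (∑-dilate aa⁻¹ r₄) (trans (∑-⋆ (corr Y) (corr Y)) (cong₂ _*_ (∑-corr Y) (∑-corr Y)))

      module Refine (y : F) (badAt≤ : 16 * badAt y ≤ # (V y) * # (V y)) where
        m = # (V y)

        degree : F → ℕ
        degree u = ∑ λ w → v y w * 𝟙 (bad u w)

        -- Vertices with at most `m / 4` bad partners in the neighbourhood, so that for any two of
        -- them at least half of the neighbourhood is bad with neither.
        X′ : Subset
        X′ u = V y u ∧ does (4 * degree u ≤? m)

        badAt-degree : badAt y ≡ ∑ λ u → v y u * degree u
        badAt-degree = ∑-cong λ u → trans (∑-cong λ w → *-assoc (v y u) (v y w) (𝟙 (bad u w))) (∑-*ˡ (v y u) _)

        -- A vertex of the neighbourhood left out of `X′` has more than `m / 4` bad partners, and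
        -- there are at most `m² / 16` bad pairs.
        X′-large : 1 ≤ m → m ≤ 2 * # X′
        X′-large 1≤m = conclude (# X′) 1≤m (begin
          4 * (m * m) ≡⟨ cong (4 *_) (∑-*ʳ m (v y)) ⟨
          4 * ∑ (λ u → v y u * m) ≤⟨ *-monoʳ-≤ 4 (∑-mono λ u → split (V y u) (degree u) (4 * degree u ≤? m)) ⟩
          4 * ∑ (λ u → 𝟙 (X′ u) * m + 4 * (v y u * degree u))
            ≡⟨ cong (4 *_) (trans (∑-+ _ _) (cong₂ _+_ (∑-*ʳ m _) (∑-*ˡ 4 _))) ⟩
          4 * (# X′ * m + 4 * ∑ (λ u → v y u * degree u)) ≡⟨ cong (λ z → 4 * (# X′ * m + 4 * z)) badAt-degree ⟨
          4 * (# X′ * m + 4 * badAt y) ≡⟨ expand (# X′ * m) (badAt y) ⟩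
          4 * (# X′ * m) + 16 * badAt y ≤⟨ +-monoʳ-≤ (4 * (# X′ * m)) badAt≤ ⟩
          4 * (# X′ * m) + m * m ∎)
          where
          open ≤-Reasoning
          expand : ∀ x z → 4 * (x + 4 * z) ≡ 4 * x + 16 * z
          expand = solve-∀
          split : ∀ c δ (d : Dec (4 * δ ≤ m)) → 𝟙 c * m ≤ 𝟙 (c ∧ does d) * m + 4 * (𝟙 c * δ)
          split true δ (yes _) = m≤m+n _ _
          split true δ (no h) = ≤-trans (≤-reflexive (*-identityˡ m)) (≤-trans (<⇒≤ (≰⇒> h)) (≤-reflexive (cong (4 *_) (sym (*-identityˡ δ)))))
          split false δ _ = z≤n
          conclude : ∀ x {m} → 1 ≤ m → 4 * (m * m) ≤ 4 * (x * m) + m * m → m ≤ 2 * x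
          conclude x {m} 1≤m h = *-cancelʳ-≤ m (2 * x) (2 * m) {{m*n≢0 2 m {{_}} {{>-nonZero 1≤m}}}}
            (≤-trans (m≤m+n _ _) (+-cancelʳ-≤ (m * m) _ _ (subst₂ _≤_ (e₁ m) (e₂ x m) h)))
            where
            e₁ : ∀ m → 4 * (m * m) ≡ (m * (2 * m) + m * m) + m * m
            e₁ = solve-∀
            e₂ : ∀ x m → 4 * (x * m) + m * m ≡ 2 * x * (2 * m) + m * m
            e₂ = solve-∀

        -- At least half of the `w` in the neighbourhood are bad with neither `u` nor `t`; the path
        -- from `u` to `t` through each such `w` gives at least `(n / q³)²` representations.
        r₄-large : ∀ {u t} → u ∈ X′ → t ∈ X′ → m * (n * n) ≤ 2 * (κ q * κ q) * r₄ ((u ⊖ t) ⊗ a)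
        r₄-large {u} {t} u∈ t∈ = begin
          m * (n * n) ≤⟨ *-monoˡ-≤ (n * n) m≤2g ⟩
          2 * # G * (n * n) ≡⟨ *-assoc 2 (# G) (n * n) ⟩
          2 * (# G * (n * n)) ≤⟨ *-monoʳ-≤ 2 (#-bound {G} (λ w → (κ q * κ q) * (corr Y ((u ⊖ w) ⊗ a) * corr Y ((w ⊖ t) ⊗ a))) good) ⟩
          2 * ∑ (λ w → (κ q * κ q) * (corr Y ((u ⊖ w) ⊗ a) * corr Y ((w ⊖ t) ⊗ a)))
            ≡⟨ cong (2 *_) (trans (∑-*ˡ (κ q * κ q) _) (cong ((κ q * κ q) *_) (sym (r₄-path u t)))) ⟩
          2 * ((κ q * κ q) * r₄ ((u ⊖ t) ⊗ a))
            ≡⟨ *-assoc 2 (κ q * κ q) _ ⟨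
          2 * (κ q * κ q) * r₄ ((u ⊖ t) ⊗ a) ∎
          where
          open ≤-Reasoning
          G : Subset
          G w = V y w ∧ (not (bad u w) ∧ not (bad t w))
          regroup : ∀ k c d → (k * c) * (k * d) ≡ (k * k) * (c * d)
          regroup = solve-∀
          refute : ∀ {a b} {P : Set} (d : Dec P) → a ≡ true → b ≡ true → not (a ∧ (b ∧ does d)) ≡ true → ¬ P
          refute (no ¬p) refl refl _ = ¬p
          refute (yes _) refl refl ()
          not-bad : ∀ {s w} → s ∈ X → w ∈ X → not (bad s w) ≡ true → n ≤ κ q * common s w
          not-bad {s} {w} s∈ w∈ h = ≮⇒≥ (refute (κ q * common s w <? n) s∈ w∈ h)
          good : ∀ {w} → w ∈ G → n * n ≤ (κ q * κ q) * (corr Y ((u ⊖ w) ⊗ a) * corr Y ((w ⊖ t) ⊗ a))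
          good {w} w∈ = ≤-trans
            (*-mono-≤ (≤-trans (not-bad (∧⁻ˡ (∧⁻ˡ {V y u} u∈)) w∈X (∧⁻ˡ {not (bad u w)} bads))
                               (*-monoʳ-≤ (κ q) (≤-trans (≤-reflexive (common-sym u w)) (common≤corr w u))))
                      (≤-trans (not-bad (∧⁻ˡ (∧⁻ˡ {V y t} t∈)) w∈X (∧⁻ʳ {not (bad u w)} bads))
                               (*-monoʳ-≤ (κ q) (common≤corr t w))))
            (≤-reflexive (regroup (κ q) _ _))
            where
            w∈X : w ∈ X
            w∈X = ∧⁻ˡ (∧⁻ˡ {V y w} w∈)
            bads = ∧⁻ʳ {V y w} w∈
          cover : ∀ c b₁ b₂ → 𝟙 c ≤ 𝟙 (c ∧ (not b₁ ∧ not b₂)) + (𝟙 c * 𝟙 b₁ + 𝟙 c * 𝟙 b₂)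
          cover false _ _ = z≤n
          cover true true _ = s≤s z≤n
          cover true false true = s≤s z≤n
          cover true false false = s≤s z≤n
          low : ∀ {u} → u ∈ X′ → 4 * degree u ≤ m
          low {u} u∈ = does⁻ (4 * degree u ≤? m) (∧⁻ʳ {V y u} u∈)
          m≤g+δ : m ≤ # G + (degree u + degree t)
          m≤g+δ = ≤-trans (∑-mono λ w → cover (V y w) (bad u w) (bad t w))
                    (≤-reflexive (trans (∑-+ _ _) (cong (# G +_) (∑-+ _ _))))
          m≤2g : m ≤ 2 * # G
          m≤2g = *-cancelˡ-≤ 2 (+-cancelʳ-≤ (m + m) _ _ (begin
            2 * m + (m + m) ≡⟨ f₁ m ⟩
            4 * m ≤⟨ *-monoʳ-≤ 4 m≤g+δ ⟩
            4 * (# G + (degree u + degree t)) ≡⟨ f₂ (# G) (degree u) (degree t) ⟩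
            2 * (2 * # G) + (4 * degree u + 4 * degree t) ≤⟨ +-monoʳ-≤ (2 * (2 * # G)) (+-mono-≤ (low u∈) (low t∈)) ⟩
            2 * (2 * # G) + (m + m) ∎))
            where
            f₁ : ∀ m → 2 * m + (m + m) ≡ 4 * m
            f₁ = solve-∀
            f₂ : ∀ g x y → 4 * (g + (x + y)) ≡ 2 * (2 * g) + (4 * x + 4 * y)
            f₂ = solve-∀

        -- Each difference uses up `m n² / (2 q⁶)` of the `|Y|⁴ ≤ (q n)⁴` sums counted by `r₄`; then
        -- `n² ≤ 2 q² m²` and `m ≤ 2 |X′|` bring in `|X′|`.
        difference-bound : # Y ≤ q * n → n * n ≤ 2 * (q * q) * (m * m) → 1 ≤ n → 1 ≤ m → ∀ D →
          (∀ {d} → d ∈ D → ∃₂ λ u t → u ∈ X′ × t ∈ X′ × d ≡ u ⊖ t) → # D ≤ 8 * ((q * q) * (q * q) * (q * q) * (q * q) * (q * q) * (q * q)) * # X′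
        difference-bound Y≤ n≤m 1≤n 1≤m D D⊆ = *-cancelʳ-≤ (# D) _ (m * (n * n))
          {{m*n≢0 m (n * n) {{>-nonZero 1≤m}} {{m*n≢0 n n {{>-nonZero 1≤n}} {{>-nonZero 1≤n}}}}}} (begin
          # D * (m * (n * n))
            ≤⟨ #-bound {D} (λ d → 2 * (κ q * κ q) * r₄ (d ⊗ a)) each ⟩
          ∑ (λ d → 2 * (κ q * κ q) * r₄ (d ⊗ a))
            ≡⟨ trans (∑-*ˡ (2 * (κ q * κ q)) _) (cong (2 * (κ q * κ q) *_) ∑-r₄) ⟩
          2 * (κ q * κ q) * ((# Y * # Y) * (# Y * # Y))
            ≤⟨ *-monoʳ-≤ (2 * (κ q * κ q)) (*-mono-≤ (*-mono-≤ Y≤ Y≤) (*-mono-≤ Y≤ Y≤)) ⟩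
          2 * (κ q * κ q) * ((q * n * (q * n)) * (q * n * (q * n)))
            ≡⟨ cong (λ k → 2 * (k * k) * ((q * n * (q * n)) * (q * n * (q * n)))) (κ-def q) ⟩
          2 * (q * (q * q) * (q * (q * q))) * ((q * n * (q * n)) * (q * n * (q * n)))
            ≡⟨ g₁ q n ⟩
          q⁸ * (n * n) * (2 * (q * q) * (n * n))
            ≤⟨ *-monoˡ-≤ (2 * (q * q) * (n * n)) (*-monoʳ-≤ q⁸ n≤m) ⟩
          q⁸ * (2 * (q * q) * (m * m)) * (2 * (q * q) * (n * n))
            ≤⟨ *-monoˡ-≤ (2 * (q * q) * (n * n)) (*-monoʳ-≤ q⁸ (*-monoʳ-≤ (2 * (q * q)) (*-monoˡ-≤ m (X′-large 1≤m)))) ⟩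
          q⁸ * (2 * (q * q) * (2 * # X′ * m)) * (2 * (q * q) * (n * n))
            ≡⟨ g₂ q⁸ (q * q) (# X′) m n ⟩
          8 * (q⁸ * (q * q) * (q * q)) * # X′ * (m * (n * n)) ∎)
          where
          open ≤-Reasoning
          q⁸ = (q * q) * (q * q) * (q * q) * (q * q)
          each : ∀ {d} → d ∈ D → m * (n * n) ≤ 2 * (κ q * κ q) * r₄ (d ⊗ a)
          each d∈ with D⊆ d∈
          ... | u , t , u∈ , t∈ , refl = r₄-large u∈ t∈
          g₁ : ∀ q n → 2 * (q * (q * q) * (q * (q * q))) * ((q * n * (q * n)) * (q * n * (q * n)))
                     ≡ (q * q) * (q * q) * (q * q) * (q * q) * (n * n) * (2 * (q * q) * (n * n))
          g₁ = solve-∀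
          g₂ : ∀ a b x m n → a * (2 * b * (2 * x * m)) * (2 * b * (n * n)) ≡ 8 * (a * b * b) * x * (m * (n * n))
          g₂ = solve-∀

    balog-szemerédi-gowers : # Y ≤ q * # X → 1 ≤ # X →
      # X * # X ≤ q * ∑ (λ y → 𝟙 (X y) * ∑ λ x → 𝟙 (X x) * 𝟙 (Y (x ⊗ a ⊖ y ⊗ b))) →
      HasStableSubset X q
    balog-szemerédi-gowers Y≤ 1≤n dense = conclude (choose 1≤n (≤-trans dense (≤-reflexive (cong (q *_)
      (∑-cong λ y → cong (𝟙 (X y) *_) (∑-cong λ x → sym (𝟙-∧ (X x) (Y (x ⊗ a ⊖ y ⊗ b)))))))))
      where
      conclude : (∃ λ y → n * n ≤ 2 * (q * q) * (# (V y) * # (V y)) × 16 * badAt y ≤ # (V y) * # (V y)) →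
        HasStableSubset X q
      conclude (y , n≤m , badAt≤) = X′ , (λ {u} u∈ → ∧⁻ˡ (∧⁻ˡ {V y u} u∈)) , square-cancel-≤ large , difference-bound Y≤ n≤m 1≤n 1≤m
        where
        open Refine y badAt≤
        1≤m : 1 ≤ m
        1≤m = n≢0⇒n>0 λ eq → contradiction (≤-trans (*-mono-≤ 1≤n 1≤n) (≤-trans n≤m (≤-reflexive
          (trans (cong (λ k → 2 * (q * q) * (k * k)) eq) (*-zeroʳ (2 * (q * q))))))) λ ()
        large : n * n ≤ 4 * q * # X′ * (4 * q * # X′)
        large = ≤-trans n≤m (≤-trans (*-monoʳ-≤ (2 * (q * q)) (*-mono-≤ (X′-large 1≤m) (X′-large 1≤m)))
          (≤-trans (≤-reflexive (h₁ q (# X′))) (≤-trans (m≤m+n _ (8 * (q * q * (# X′ * # X′)))) (≤-reflexive (h₂ q (# X′))))))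
          where
          h₁ : ∀ q x → 2 * (q * q) * (2 * x * (2 * x)) ≡ 8 * (q * q * (x * x))
          h₁ = solve-∀
          h₂ : ∀ q x → 8 * (q * q * (x * x)) + 8 * (q * q * (x * x)) ≡ 4 * q * x * (4 * q * x)
          h₂ = solve-∀

-- Ruzsa covering and the closure of multipliers under field operations.

module Covering (p : ℕ) .{{_ : NonZero p}} (p-prime : Prime p) where

  open import Data.Nat.Properties
  open FiniteSums
  open ParameterSelection
  open PrimeField p p-prime
  open Subsets p p-prime

  private
    -- Counts the `z` in `Z` with `w ∈ z + B`. Kept below the indicator of a set `W`, it says at
    -- once that the translates are disjoint and that they lie in `W`.
    hits : Subset → List F → F → ℕ
    hits B [] w = 0
    hits B (z ∷ Z) w = 𝟙 (B (w ⊖ z)) + hits B Z w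

    ∑-hits : ∀ B Z → ∑ (hits B Z) ≡ length Z * # B
    ∑-hits B [] = ∑-zero p
    ∑-hits B (z ∷ Z) = trans (∑-+ _ (hits B Z))
                         (cong₂ _+_ (∑-shift (⊝ z) (λ w → 𝟙 (B w))) (∑-hits B Z))

    hit : ∀ B Z w → 1 ≤ hits B Z w → ∃ λ z → z ∈ˡ Z × w ⊖ z ∈ B
    hit B (z ∷ Z) w h with B (w ⊖ z) in eq
    ... | true = z , here refl , eq
    ... | false with hit B Z w h
    ... | z′ , z′∈ , w∈ = z′ , there z′∈ , w∈

  Covered : Subset → List F → F → Set
  Covered B Z a = ∃ λ z → z ∈ˡ Z × ∃₂ λ b b′ → b ∈ B × b′ ∈ B × a ≡ z ⊕ (b ⊖ b′)

  -- Ruzsa's covering lemma: Z is a maximal subset of A whose translates of B are disjoint.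
  opaque
    covering : ∀ A B W → 1 ≤ # B → (∀ {a b} → a ∈ A → b ∈ B → a ⊕ b ∈ W) →
      ∃ λ Z → length Z * # B ≤ # W × (∀ {a} → a ∈ A → Covered B Z a)
    covering A B W 1≤B A⊕B⊆W with greedy (allFin p)
      where
      greedy : ∀ xs → ∃ λ Z → (∀ w → hits B Z w ≤ 𝟙 (W w)) × (∀ {a} → a ∈ˡ xs → a ∈ A → Covered B Z a)
      greedy [] = [] , (λ w → z≤n) , λ ()
      greedy (x ∷ xs) with greedy xs | x ∈? A
      ... | Z , disjoint , covers | no x∉A = Z , disjoint , λ
            { (here refl) a∈A → contradiction a∈A x∉A
            ; (there a∈) → covers a∈ }
      ... | Z , disjoint , covers | yes x∈A with Fin.any? (λ w → ((w ⊖ x) ∈? B) ×-dec (1 ≤? hits B Z w))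
      ... | yes (w , w∈ , h) = Z , disjoint , λ
              { (here refl) _ → let z , z∈ , w∈′ = hit B Z w h in
                  z , z∈ , w ⊖ z , w ⊖ x , w∈′ , w∈ , solve 3 (λ x z w → x := z :+ ((w :- z) :- (w :- x))) refl x z w
              ; (there a∈) → covers a∈ }
      ... | no ¬meets = x ∷ Z , disjoint′ , λ
              { (here refl) _ → let b , b∈ = 1≤#⇒∈ 1≤B in
                  x , here refl , b , b , b∈ , b∈ , solve 2 (λ x b → x := x :+ (b :- b)) refl x b
              ; (there a∈) a∈A → let z , z∈ , rest = covers a∈ a∈A in z , there z∈ , rest }
        where
        disjoint′ : ∀ w → 𝟙 (B (w ⊖ x)) + hits B Z w ≤ 𝟙 (W w)
        disjoint′ w with B (w ⊖ x) in eq
        ... | false = disjoint w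
        ... | true = ≤-trans (+-monoʳ-≤ 1 (≤-pred (≰⇒> (λ h → ¬meets (w , eq , h)))))
                        (≤-reflexive (sym (𝟙-true (subst (_∈ W) (solve 2 (λ x w → x :+ (w :- x) := w) refl x w) (A⊕B⊆W x∈A eq)))))
    ... | Z , disjoint , covers = Z , ≤-trans (≤-reflexive (sym (∑-hits B Z))) (∑-mono disjoint) , λ {a} a∈ → covers (∈-allFin a) a∈

  opaque
    translates : ∀ Z T → ∃ λ W → # W ≤ length Z * # T × (∀ {z t} → z ∈ˡ Z → t ∈ T → t ⊕ z ∈ W)
    translates [] T = (λ _ → false) , ≤-reflexive (∑-zero p) , λ ()
    translates (z ∷ Z) T with translates Z T
    ... | W , W≤ , T⊆W = (λ w → T (w ⊖ z) ∨ W w) ,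
          ≤-trans (∑-mono λ w → 𝟙-∨ (T (w ⊖ z)) (W w))
            (≤-trans (≤-reflexive (trans (∑-+ _ _) (cong (_+ # W) (∑-shift (⊝ z) (λ w → 𝟙 (T w)))))) (+-monoʳ-≤ (# T) W≤)) ,
          λ { {_} {t} (here refl) t∈ → ∨ˡ (subst (_∈ T) (sym (⊖-⊕ t z)) t∈) ; (there z∈) t∈ → ∨ʳ (T⊆W z∈ t∈) }
      where
      𝟙-∨ : ∀ a b → 𝟙 (a ∨ b) ≤ 𝟙 a + 𝟙 b
      𝟙-∨ true b = s≤s z≤n
      𝟙-∨ false b = ≤-refl
      ∨ˡ : ∀ {a b} → a ≡ true → a ∨ b ≡ true
      ∨ˡ refl = refl
      ∨ʳ : ∀ {a b} → b ≡ true → a ∨ b ≡ true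
      ∨ʳ {true} refl = refl
      ∨ʳ {false} refl = refl

  _⊕ˡ_ : List F → List F → List F
  _⊕ˡ_ = cartesianProductWith _⊕_

  length-⊕ˡ : ∀ Z Z′ → length (Z ⊕ˡ Z′) ≡ length Z * length Z′
  length-⊕ˡ [] Z′ = refl
  length-⊕ˡ (z ∷ Z) Z′ = trans (length-++ (map (z ⊕_) Z′)) (cong₂ _+_ (length-map (z ⊕_) Z′) (length-⊕ˡ Z Z′))

  -- `T` is a set of controlled size around the fivefold sums of `S`: five because covering `4S` by
  -- translates of `S - S` involves the sums in `4S + S`.
  module Multipliers (S T : Subset) (c : ℕ) (0∈S : 0# ∈ S) (⊝-closed : ∀ {s} → s ∈ S → ⊝ s ∈ S)
    (5S⊆T : ∀ {a b c d e} → a ∈ S → b ∈ S → c ∈ S → d ∈ S → e ∈ S → (((a ⊕ b) ⊕ c) ⊕ d) ⊕ e ∈ T)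
    (T≤ : # T ≤ c * # S) where

    private
      1≤S : 1 ≤ # S
      1≤S = ∈⇒1≤# 0∈S

      cancel-S : ∀ {m n} → m * # S ≤ n * # S → m ≤ n
      cancel-S {m} {n} = *-cancelʳ-≤ m n (# S) {{>-nonZero 1≤S}}

    4S⊆T : ∀ {a b c d} → a ∈ S → b ∈ S → c ∈ S → d ∈ S → ((a ⊕ b) ⊕ c) ⊕ d ∈ T
    4S⊆T {a} {b} {c} {d} a∈ b∈ c∈ d∈ = subst (_∈ T) (solve 1 (λ x → x :+ con ℤ.0ℤ := x) refl (((a ⊕ b) ⊕ c) ⊕ d)) (5S⊆T a∈ b∈ c∈ d∈ 0∈S)

    3S⊆T : ∀ {a b c} → a ∈ S → b ∈ S → c ∈ S → (a ⊕ b) ⊕ c ∈ T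
    3S⊆T {a} {b} {c} a∈ b∈ c∈ = subst (_∈ T) (solve 1 (λ x → x :+ con ℤ.0ℤ := x) refl ((a ⊕ b) ⊕ c)) (4S⊆T a∈ b∈ c∈ 0∈S)

    Near : List F → F → Set
    Near Z x = ∃₂ λ s t → s ∈ S × t ∈ S × ∃ λ z → z ∈ˡ Z × x ≡ (s ⊕ t) ⊕ z

    private
      4S : Subset
      4S x = does (Fin.any? λ s → (s ∈? S) ×-dec Fin.any? λ t → (t ∈? S) ×-dec Fin.any? λ u → (u ∈? S) ×-dec
                   ((((x ⊖ s) ⊖ t) ⊖ u) ∈? S))

      4S⁺ : ∀ {s t u v} → s ∈ S → t ∈ S → u ∈ S → v ∈ S → (s ⊕ t) ⊕ (u ⊕ v) ∈ 4S
      4S⁺ {s} {t} {u} {v} s∈ t∈ u∈ v∈ = does⁺ (Fin.any? _) (s , s∈ , t , t∈ , u , u∈ ,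
        subst (_∈ S) (solve 4 (λ s t u v → v := ((((s :+ t) :+ (u :+ v)) :- s) :- t) :- u) refl s t u v) v∈)

      opaque
        4S-cover : ∃ λ Z → length Z * # S ≤ # T × (∀ {a} → a ∈ 4S → Covered S Z a)
        4S-cover = covering 4S S T 1≤S λ {a} {b} a∈ b∈ → plus (does⁻ (Fin.any? _) a∈) b∈
          where
          plus : ∀ {a b} → (∃ λ s → s ∈ S × ∃ λ t → t ∈ S × ∃ λ u → u ∈ S × (((a ⊖ s) ⊖ t) ⊖ u) ∈ S) → b ∈ S → a ⊕ b ∈ T
          plus {a} {b} (s , s∈ , t , t∈ , u , u∈ , v∈) b∈ = subst (_∈ T)
            (solve 5 (λ a s t u b → (((s :+ t) :+ u) :+ (((a :- s) :- t) :- u)) :+ b := a :+ b) refl a s t u b)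
            (5S⊆T s∈ t∈ u∈ v∈ b∈)

    Z₀ : List F
    Z₀ = proj₁ 4S-cover

    Z₀≤c : length Z₀ ≤ c
    Z₀≤c = cancel-S (≤-trans (proj₁ (proj₂ 4S-cover)) T≤)

    1≤c : 1 ≤ c
    1≤c = n≢0⇒n>0 λ eq → contradiction (≤-trans (∈⇒1≤# (3S⊆T 0∈S 0∈S 0∈S)) (subst (λ k → # T ≤ k * # S) eq T≤)) λ ()

    -- The four summands from `S` are brought back to two by the cover `Z₀` of `4S`, at the cost of
    -- one factor `c`.
    near-⊕ : ∀ {Z Z′ x y} → Near Z x → Near Z′ y → Near ((Z₀ ⊕ˡ Z) ⊕ˡ Z′) (x ⊕ y)
    near-⊕ {Z} {Z′} (s , t , s∈ , t∈ , z , z∈ , refl) (s′ , t′ , s′∈ , t′∈ , z′ , z′∈ , refl) =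
      combine (proj₂ (proj₂ 4S-cover) (4S⁺ s∈ t∈ s′∈ t′∈))
      where
      combine : Covered S Z₀ ((s ⊕ t) ⊕ (s′ ⊕ t′)) →
        Near ((Z₀ ⊕ˡ Z) ⊕ˡ Z′) (((s ⊕ t) ⊕ z) ⊕ ((s′ ⊕ t′) ⊕ z′))
      combine (w , w∈ , b , b′ , b∈ , b′∈ , eq) = b , ⊝ b′ , b∈ , ⊝-closed b′∈ , (w ⊕ z) ⊕ z′ ,
          ∈-cartesianProductWith⁺ _⊕_ (∈-cartesianProductWith⁺ _⊕_ w∈ z∈) z′∈ ,
          trans (solve 4 (λ x z y z′ → (x :+ z) :+ (y :+ z′) := (x :+ y) :+ (z :+ z′)) refl (s ⊕ t) z (s′ ⊕ t′) z′)
          (trans (cong (_⊕ (z ⊕ z′)) eq)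
          (solve 5 (λ w b b′ z z′ → (w :+ (b :- b′)) :+ (z :+ z′) := (b :+ (:- b′)) :+ ((w :+ z) :+ z′)) refl w b b′ z z′))

    near-shift : ∀ {Z Z′ x y} → Near Z x → y ∈ˡ Z′ → Near (Z ⊕ˡ Z′) (x ⊕ y)
    near-shift {y = y} (s , t , s∈ , t∈ , z , z∈ , refl) y∈ = s , t , s∈ , t∈ , z ⊕ y , ∈-cartesianProductWith⁺ _⊕_ z∈ y∈ ,
      solve 4 (λ s t z y → ((s :+ t) :+ z) :+ y := (s :+ t) :+ (z :+ y)) refl s t z y

    near-⊝ : ∀ {Z x} → Near Z x → Near (map ⊝_ Z) (⊝ x)
    near-⊝ (s , t , s∈ , t∈ , z , z∈ , refl) = ⊝ s , ⊝ t , ⊝-closed s∈ , ⊝-closed t∈ , ⊝ z , ∈-map⁺ ⊝_ z∈ ,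
      solve 3 (λ s t z → :- ((s :+ t) :+ z) := ((:- s) :+ (:- t)) :+ (:- z)) refl s t z

    Good : ℕ → F → Set
    Good e r = ∃ λ Z → length Z ≤ c ^ e × (∀ {s} → s ∈ S → Near Z (r ⊗ s))

    good-weaken : ∀ {e e′ r} → e ≤ e′ → Good e r → Good e′ r
    good-weaken e≤e′ (Z , Z≤ , h) = Z , ≤-trans Z≤ (^-monoʳ-≤ c {{>-nonZero 1≤c}} e≤e′) , h

    good-1 : Good 0 1#
    good-1 = 0# ∷ [] , ≤-refl , λ {s} s∈ → s , 0# , s∈ , 0∈S , 0# , here refl ,
      solve 1 (λ s → con ℤ.1ℤ :* s := (s :+ con ℤ.0ℤ) :+ con ℤ.0ℤ) refl s

    good-⊕ : ∀ {e f r t} → Good e r → Good f t → Good (1 + e + f) (r ⊕ t)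
    good-⊕ {e} {f} {r} {t} (Z , Z≤ , h) (Z′ , Z′≤ , h′) = (Z₀ ⊕ˡ Z) ⊕ˡ Z′ ,
      (begin
        length ((Z₀ ⊕ˡ Z) ⊕ˡ Z′) ≡⟨ trans (length-⊕ˡ (Z₀ ⊕ˡ Z) Z′) (cong (_* length Z′) (length-⊕ˡ Z₀ Z)) ⟩
        length Z₀ * length Z * length Z′ ≤⟨ *-mono-≤ (*-mono-≤ Z₀≤c Z≤) Z′≤ ⟩
        c * c ^ e * c ^ f ≡⟨ ^-distribˡ-+-* c (1 + e) f ⟨
        c ^ (1 + e + f) ∎) ,
      λ {s} s∈ → subst (Near _) (solve 3 (λ r t s → r :* s :+ t :* s := (r :+ t) :* s) refl r t s) (near-⊕ (h s∈) (h′ s∈))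
      where open ≤-Reasoning

    good-⊝ : ∀ {e r} → Good e r → Good e (⊝ r)
    good-⊝ {r = r} (Z , Z≤ , h) = map ⊝_ Z , ≤-trans (≤-reflexive (length-map ⊝_ Z)) Z≤ ,
      λ {s} s∈ → subst (Near _) (solve 2 (λ r s → :- (r :* s) := (:- r) :* s) refl r s) (near-⊝ (h s∈))

    -- `r (t s) = r s₁ + r s₂ + r z` uses the cover of `r S` twice, that of `t S` once and `Z₀`
    -- once, whence the exponent.
    good-⊗ : ∀ {e f r t} → Good e r → Good f t → Good (1 + e + e + f) (r ⊗ t)
    good-⊗ {e} {f} {r} {t} (Z , Z≤ , h) (Z′ , Z′≤ , h′) = ((Z₀ ⊕ˡ Z) ⊕ˡ Z) ⊕ˡ map (r ⊗_) Z′ ,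
      (begin
        length (((Z₀ ⊕ˡ Z) ⊕ˡ Z) ⊕ˡ map (r ⊗_) Z′)
          ≡⟨ trans (length-⊕ˡ ((Z₀ ⊕ˡ Z) ⊕ˡ Z) (map (r ⊗_) Z′))
               (cong₂ _*_ (trans (length-⊕ˡ (Z₀ ⊕ˡ Z) Z) (cong (_* length Z) (length-⊕ˡ Z₀ Z))) (length-map (r ⊗_) Z′)) ⟩
        length Z₀ * length Z * length Z * length Z′ ≤⟨ *-mono-≤ (*-mono-≤ (*-mono-≤ Z₀≤c Z≤) Z≤) Z′≤ ⟩
        c * c ^ e * c ^ e * c ^ f ≡⟨ cong (_* c ^ f) (^-distribˡ-+-* c (1 + e) e) ⟨
        c ^ (1 + e + e) * c ^ f ≡⟨ ^-distribˡ-+-* c (1 + e + e) f ⟨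
        c ^ (1 + e + e + f) ∎) , near
      where
      open ≤-Reasoning
      near : ∀ {s} → s ∈ S → Near (((Z₀ ⊕ˡ Z) ⊕ˡ Z) ⊕ˡ map (r ⊗_) Z′) ((r ⊗ t) ⊗ s)
      near {s} s∈ = combine (h′ s∈)
        where
        combine : Near Z′ (t ⊗ s) → Near (((Z₀ ⊕ˡ Z) ⊕ˡ Z) ⊕ˡ map (r ⊗_) Z′) ((r ⊗ t) ⊗ s)
        combine (s₁ , s₂ , s₁∈ , s₂∈ , z , z∈ , eq) = subst (Near _)
            (trans (solve 4 (λ r s₁ s₂ z → (r :* s₁ :+ r :* s₂) :+ r :* z := r :* ((s₁ :+ s₂) :+ z)) refl r s₁ s₂ z)
            (trans (cong (r ⊗_) (sym eq)) (solve 3 (λ r t s → r :* (t :* s) := (r :* t) :* s) refl r t s)))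
            (near-shift (near-⊕ (h s₁∈) (h s₂∈)) (∈-map⁺ (r ⊗_) z∈))

    -- `S + r S` lies in `T + Z`, so that `S` is covered by few translates of `r S - r S`; division
    -- by `r` then covers `S / r` by translates of `S - S`.
    good-inverse : ∀ {e r u} → r ⊗ u ≡ 1# → Good e r → Good (1 + e) u
    good-inverse {e} {r} {u} ru (Z , Z≤ , h) = map (u ⊗_) Z′ , (begin
        length (map (u ⊗_) Z′) ≡⟨ length-map (u ⊗_) Z′ ⟩
        length Z′ ≤⟨ cancel-S bound ⟩
        c * c ^ e ∎) , near
      where
      open ≤-Reasoning
      ur : u ⊗ r ≡ 1#
      ur = trans (⊗-comm u r) ru
      rS : Subset
      rS w = S (w ⊗ u)
      #rS : # rS ≡ # S
      #rS = ∑-dilate ur (λ w → 𝟙 (S w))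
      hull = translates Z T
      W = proj₁ hull
      meet : ∀ {a b} → a ∈ S → b ∈ rS → a ⊕ b ∈ W
      meet {a} {b} a∈ b∈ = inside (h b∈)
        where
        inside : Near Z (r ⊗ (b ⊗ u)) → a ⊕ b ∈ W
        inside (s , t , s∈ , t∈ , z , z∈ , eq) = subst (_∈ W)
            (trans (solve 4 (λ a s t z → ((a :+ s) :+ t) :+ z := a :+ ((s :+ t) :+ z)) refl a s t z)
              (cong (a ⊕_) (trans (sym eq) (trans (⊗-comm r (b ⊗ u)) (⊗-cancel ur b)))))
            (proj₂ (proj₂ hull) z∈ (3S⊆T a∈ s∈ t∈))
      cover = covering S rS W (≤-trans 1≤S (≤-reflexive (sym #rS))) meet
      Z′ = proj₁ cover
      bound : length Z′ * # S ≤ c * c ^ e * # S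
      bound = begin
        length Z′ * # S ≡⟨ cong (length Z′ *_) #rS ⟨
        length Z′ * # rS ≤⟨ proj₁ (proj₂ cover) ⟩
        # W ≤⟨ proj₁ (proj₂ hull) ⟩
        length Z * # T ≤⟨ *-mono-≤ Z≤ T≤ ⟩
        c ^ e * (c * # S) ≡⟨ trans (sym (*-assoc (c ^ e) c (# S))) (cong (_* # S) (*-comm (c ^ e) c)) ⟩
        c * c ^ e * # S ∎
      near : ∀ {s} → s ∈ S → Near (map (u ⊗_) Z′) (u ⊗ s)
      near {s} s∈ = combine (proj₂ (proj₂ cover) s∈)
        where
        combine : Covered rS Z′ s → Near (map (u ⊗_) Z′) (u ⊗ s)
        combine (z , z∈ , b , b′ , b∈ , b′∈ , eq) = b ⊗ u , ⊝ (b′ ⊗ u) , b∈ , ⊝-closed b′∈ , u ⊗ z , ∈-map⁺ (u ⊗_) z∈ ,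
            trans (cong (u ⊗_) eq) (solve 4 (λ u z b b′ → u :* (z :+ (b :- b′)) := (b :* u :+ (:- (b′ :* u))) :+ u :* z) refl u z b b′)

    Quotient : Subset → F → Set
    Quotient Y ρ = ∃ λ a → a ∈ Y × ∃ λ b → b ∈ Y × ∃ λ c → c ∈ Y × ∃ λ d → d ∈ Y × c ≢ d × ρ ⊗ (c ⊖ d) ≡ a ⊖ b

    quotient? : ∀ Y ρ → Dec (Quotient Y ρ)
    quotient? Y ρ = Fin.any? λ a → (a ∈? Y) ×-dec Fin.any? λ b → (b ∈? Y) ×-dec Fin.any? λ c → (c ∈? Y) ×-dec
      Fin.any? λ d → (d ∈? Y) ×-dec ¬? (c Fin.≟ d) ×-dec (ρ ⊗ (c ⊖ d) Fin.≟ a ⊖ b)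

    good-⊖ : ∀ {e f r t} → Good e r → Good f t → Good (1 + e + f) (r ⊖ t)
    good-⊖ {e} {f} g h = good-⊕ {e} {f} g (good-⊝ {f} h)

    good-quotient : ∀ {Y e ρ} → (∀ {y} → y ∈ Y → Good e y) → Quotient Y ρ → Good (6 * e + 5) ρ
    good-quotient {Y} {e} {ρ} Y-good (a , a∈ , b , b∈ , c′ , c∈ , d , d∈ , c≢d , eq) =
      subst₂ Good (exponent e) value
        (good-⊗ {1 + e + e} {1 + (1 + e + e)} (good-⊖ {e} {e} (Y-good a∈) (Y-good b∈))
                                              (good-inverse {1 + e + e} cu (good-⊖ {e} {e} (Y-good c∈) (Y-good d∈))))
      where
      c-d-inverse = inverse (c′ ⊖ d) (λ h → c≢d (⊖≡0⇒≡ h))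
      u = proj₁ c-d-inverse
      cu : (c′ ⊖ d) ⊗ u ≡ 1#
      cu = proj₂ c-d-inverse
      exponent : ∀ e → 1 + (1 + e + e) + (1 + e + e) + (1 + (1 + e + e)) ≡ 6 * e + 5
      exponent = solve-∀
      value : (a ⊖ b) ⊗ u ≡ ρ
      value = trans (cong (_⊗ u) (sym eq)) (⊗-cancel cu ρ)

    pivot-set : Subset → F → Subset
    pivot-set Y ρ w = does (Fin.any? λ y → (y ∈? Y) ×-dec Fin.any? λ z → (z ∈? Y) ×-dec (w Fin.≟ y ⊕ ρ ⊗ z))

    -- If ρ is not a quotient of differences then (y , z) ↦ y + ρ z is injective on Y × Y.
    pivot-large : ∀ Y ρ → ¬ Quotient Y ρ → # Y * # Y ≤ # (pivot-set Y ρ)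
    pivot-large Y ρ ¬quot = begin
      # Y * # Y
        ≡⟨ ∑-× _ _ ⟨
      ∑ (λ y → ∑ λ z → 𝟙 (Y y) * 𝟙 (Y z))
        ≡⟨ ∑-swap _ ⟩
      ∑ (λ z → ∑ λ y → 𝟙 (Y y) * 𝟙 (Y z))
        ≡⟨ ∑-cong (λ z → ∑-shift (⊝ (ρ ⊗ z)) (λ y → 𝟙 (Y y) * 𝟙 (Y z))) ⟨
      ∑ (λ z → ∑ λ w → 𝟙 (Y (w ⊖ ρ ⊗ z)) * 𝟙 (Y z))
        ≡⟨ ∑-swap _ ⟩
      ∑ (λ w → ∑ λ z → 𝟙 (Y (w ⊖ ρ ⊗ z)) * 𝟙 (Y z))
        ≤⟨ ∑-mono fibre ⟩
      # (pivot-set Y ρ) ∎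
      where
      open ≤-Reasoning
      product≤1 : ∀ a b → 𝟙 a * 𝟙 b ≤ 1
      product≤1 a b = *-mono-≤ (𝟙≤1 a) (𝟙≤1 b)
      fibre : ∀ w → ∑ (λ z → 𝟙 (Y (w ⊖ ρ ⊗ z)) * 𝟙 (Y z)) ≤ 𝟙 (pivot-set Y ρ w)
      fibre w with (Fin.any? λ y → (y ∈? Y) ×-dec Fin.any? λ z → (z ∈? Y) ×-dec (w Fin.≟ y ⊕ ρ ⊗ z))
      ... | yes _ = ∑-subsingleton _ (λ z → product≤1 (Y (w ⊖ ρ ⊗ z)) (Y z)) unique
        where
        unique : ∀ z z′ → 1 ≤ 𝟙 (Y (w ⊖ ρ ⊗ z)) * 𝟙 (Y z) → 1 ≤ 𝟙 (Y (w ⊖ ρ ⊗ z′)) * 𝟙 (Y z′) → z ≡ z′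
        unique z z′ h h′ with 𝟙*𝟙⁻ (Y (w ⊖ ρ ⊗ z)) (Y z) h | 𝟙*𝟙⁻ (Y (w ⊖ ρ ⊗ z′)) (Y z′) h′ | z Fin.≟ z′
        ... | _ | _ | yes eq = eq
        ... | y∈ , z∈ | y′∈ , z′∈ | no z≢z′ = contradiction
              (_ , y′∈ , _ , y∈ , z , z∈ , z′ , z′∈ , z≢z′ ,
                solve 4 (λ w ρ z z′ → ρ :* (z :- z′) := (w :- ρ :* z′) :- (w :- ρ :* z)) refl w ρ z z′) ¬quot
      ... | no ¬rep = ≤-trans (∑-mono empty) (≤-trans (≤-reflexive (∑-zero p)) z≤n)
        where
        empty : ∀ z → 𝟙 (Y (w ⊖ ρ ⊗ z)) * 𝟙 (Y z) ≤ 0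
        empty z = ≤-pred (≰⇒> λ h → let y∈ , z∈ = 𝟙*𝟙⁻ (Y (w ⊖ ρ ⊗ z)) (Y z) h in
          ¬rep (w ⊖ ρ ⊗ z , y∈ , z , z∈ , sym (⊕-⊖ w (ρ ⊗ z))))

    two-elements : ∀ {Y} → 2 ≤ # Y → ∃₂ λ y z → y ∈ Y × z ∈ Y × y ≢ z
    two-elements {Y} 2≤Y with (Fin.any? λ y → (y ∈? Y) ×-dec Fin.any? λ z → (z ∈? Y) ×-dec ¬? (y Fin.≟ z))
    ... | yes (y , y∈ , z , z∈ , y≢z) = y , z , y∈ , z∈ , y≢z
    ... | no ¬two = contradiction 2≤Y (≤⇒≯ (∑-subsingleton _ (λ y → 𝟙≤1 (Y y)) unique))
      where
      unique : ∀ y z → 1 ≤ 𝟙 (Y y) → 1 ≤ 𝟙 (Y z) → y ≡ z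
      unique y z y∈ z∈ with y Fin.≟ z
      ... | yes eq = eq
      ... | no y≢z = contradiction (y , 𝟙⁻ y∈ , z , 𝟙⁻ z∈ , y≢z) ¬two

    -- If the quotients of differences are not closed under adding `1#`, some quotient `x` has a
    -- successor that is no quotient. The successor is still a multiplier, hence so are all
    -- `y + (x + 1) z`, and these are pairwise distinct.
    pivot : ∀ {Y e} → 2 ≤ # Y → (∀ {y} → y ∈ Y → Good e y) →
            (∀ r → Good (6 * e + 5) r) ⊎ ∃ λ Y′ → # Y * # Y ≤ # Y′ × (∀ {y} → y ∈ Y′ → Good (14 * e + 14) y)
    pivot {Y} {e} 2≤Y Y-good with Fin.all? (λ x → quotient? Y x →-dec quotient? Y (x ⊕ 1#))
    ... | yes closed = inj₁ λ r → good-quotient {Y} {e} Y-good (generated (Quotient Y) zero-quotient closed r)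
      where
      zero-quotient : Quotient Y 0#
      zero-quotient with two-elements 2≤Y
      ... | y , z , y∈ , z∈ , y≢z = y , y∈ , y , y∈ , y , y∈ , z , z∈ , y≢z ,
            solve 2 (λ y z → con ℤ.0ℤ :* (y :- z) := y :- y) refl y z
    ... | no ¬closed with Fin.¬∀⟶∃¬ p _ (λ x → quotient? Y x →-dec quotient? Y (x ⊕ 1#)) ¬closed
    ... | x , ¬step with quotient? Y x | quotient? Y (x ⊕ 1#)
    ... | no ¬q | _ = contradiction (λ q → contradiction q ¬q) ¬step
    ... | yes _ | yes q = contradiction (λ _ → q) ¬step
    ... | yes q | no ¬q′ = inj₂ (pivot-set Y (x ⊕ 1#) , pivot-large Y (x ⊕ 1#) ¬q′ , λ w∈ → image (does⁻ (Fin.any? _) w∈))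
      where
      exponent : ∀ e → 1 + e + (1 + (1 + (6 * e + 5) + 0) + (1 + (6 * e + 5) + 0) + e) ≡ 14 * e + 14
      exponent = solve-∀
      image : ∀ {w} → (∃ λ y → y ∈ Y × ∃ λ z → z ∈ Y × w ≡ y ⊕ (x ⊕ 1#) ⊗ z) → Good (14 * e + 14) w
      image (y , y∈ , z , z∈ , refl) = subst (λ k → Good k (y ⊕ (x ⊕ 1#) ⊗ z)) (exponent e)
        (good-⊕ {e} (Y-good y∈) (good-⊗ {1 + (6 * e + 5) + 0} {e} (good-⊕ {6 * e + 5} {0} (good-quotient {Y} {e} Y-good q) good-1) (Y-good z∈)))

    -- A pivot squares the size of `Y`, so the hypothesis on `p` passes from `i + 1` to `i`; at
    -- `i = 0` it contradicts `# Y ≤ p`. Hence the first alternative of `pivot` must have occurred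
    -- before.
    all-good : ∀ i {Y e} → 2 ≤ # Y → (∀ {y} → y ∈ Y → Good e y) → p < # Y ^ (2 ^ i) → ∀ r → Good (exponent-after i e) r
    all-good zero {Y} 2≤Y Y-good p< r = contradiction (≤-trans p< (≤-trans (≤-reflexive (*-identityʳ (# Y))) (#≤p Y))) (<-irrefl refl)
    all-good (suc i) {Y} {e} 2≤Y Y-good p< r with pivot {Y} {e} 2≤Y Y-good
    ... | inj₁ all = good-weaken {6 * e + 5} (m≤m+n _ _) (all r)
    ... | inj₂ (Y′ , large , Y′-good) = good-weaken {exponent-after i (14 * e + 14)} (m≤n+m _ (6 * e + 5)) (all-good i {Y′} {14 * e + 14} 2≤Y′ Y′-good p<′ r)
      where
      2≤Y′ : 2 ≤ # Y′
      2≤Y′ = ≤-trans 2≤Y (≤-trans (m≤m*n (# Y) (# Y) {{>-nonZero (≤-trans (s≤s z≤n) 2≤Y)}}) large)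
      p<′ : p < # Y′ ^ (2 ^ i)
      p<′ = ≤-trans p< (≤-trans (≤-reflexive (trans (sym (^-*-assoc (# Y) 2 (2 ^ i))) (cong (_^ (2 ^ i)) (cong (# Y *_) (*-identityʳ (# Y))))))
              (^-monoˡ-≤ (2 ^ i) large))

    private
      sumˡ : List F → (F → ℕ) → ℕ
      sumˡ [] f = 0
      sumˡ (z ∷ Z) f = f z + sumˡ Z f

      ∑-sumˡ : ∀ Z (f : F → F → ℕ) → ∑ (λ s → sumˡ Z (f s)) ≡ sumˡ Z (λ z → ∑ λ s → f s z)
      ∑-sumˡ [] f = ∑-zero p
      ∑-sumˡ (z ∷ Z) f = trans (∑-+ _ _) (cong (_ +_) (∑-sumˡ Z f))

      ∈⇒≤sumˡ : ∀ {Z z} (f : F → ℕ) → z ∈ˡ Z → f z ≤ sumˡ Z f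
      ∈⇒≤sumˡ f (here refl) = m≤m+n _ _
      ∈⇒≤sumˡ {x ∷ _} f (there z∈) = ≤-trans (∈⇒≤sumˡ f z∈) (m≤n+m _ (f x))

      opaque
        pigeonholeˡ : ∀ Z (f : F → ℕ) {k} → 1 ≤ k → k ≤ sumˡ Z f → ∃ λ z → k ≤ length Z * f z
        pigeonholeˡ Z f {suc k} _ h with go Z
          where
          go : ∀ Z′ → (∃ λ z → suc k ≤ length Z * f z) ⊎ length Z * sumˡ Z′ f ≤ length Z′ * k
          go [] = inj₂ (≤-reflexive (*-zeroʳ (length Z)))
          go (z ∷ Z′) with suc k ≤? length Z * f z | go Z′
          ... | yes le | _ = inj₁ (z , le)
          ... | no _ | inj₁ le = inj₁ le
          ... | no gt | inj₂ le = inj₂ (≤-trans (≤-reflexive (*-distribˡ-+ (length Z) (f z) _)) (+-mono-≤ (≤-pred (≰⇒> gt)) le))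
        ... | inj₁ le = le
        ... | inj₂ le with Z
        ... | [] = contradiction h λ ()
        ... | z ∷ Z′ = contradiction (*-cancelˡ-≤ (suc (length Z′)) (≤-trans (*-monoʳ-≤ (suc (length Z′)) h) le)) (<-irrefl refl)

      2S : Subset
      2S x = does (Fin.any? λ t → (t ∈? S) ×-dec ((x ⊖ t) ∈? S))

      2S⁻ : ∀ {x} → x ∈ 2S → ∃ λ t → t ∈ S × (x ⊖ t) ∈ S
      2S⁻ = does⁻ (Fin.any? _)

    -- One of the at most `c ^ e` translates of `2S` contains `r s` for a proportion `c ^ (- e)` of
    -- the `s`; the difference of two such `r s` lies in `4S`, hence in `T`.
    good-energy : ∀ {e r} → Good e r →
      # S * # S ≤ c ^ e * c ^ e * ∑ (λ s → ∑ λ t → (𝟙 (S s) * 𝟙 (S t)) * 𝟙 (T (r ⊗ (s ⊖ t))))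
    good-energy {e} {r} (Z , Z≤ , h) with pigeonholeˡ Z (λ z → ∑ λ s → 𝟙 (S s) * 𝟙 (2S (r ⊗ s ⊖ z))) 1≤S total
      where
      total : # S ≤ sumˡ Z (λ z → ∑ λ s → 𝟙 (S s) * 𝟙 (2S (r ⊗ s ⊖ z)))
      total = ≤-trans (∑-mono pointwise) (≤-reflexive (∑-sumˡ Z (λ s z → 𝟙 (S s) * 𝟙 (2S (r ⊗ s ⊖ z)))))
        where
        pointwise : ∀ s → 𝟙 (S s) ≤ sumˡ Z (λ z → 𝟙 (S s) * 𝟙 (2S (r ⊗ s ⊖ z)))
        pointwise s with S s in s∈
        ... | false = z≤n
        ... | true with h s∈
        ... | t , u , t∈ , u∈ , z , z∈ , eq = ≤-trans (≤-reflexive (sym (trans (*-identityˡ _) (𝟙-true (does⁺ (Fin.any? _)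
                  (t , t∈ , subst (_∈ S) (trans (solve 3 (λ t u z → u := (((t :+ u) :+ z) :- z) :- t) refl t u z) (cong (λ x → (x ⊖ z) ⊖ t) (sym eq))) u∈))))))
                (∈⇒≤sumˡ (λ z → 1 * 𝟙 (2S (r ⊗ s ⊖ z))) z∈)
    ... | z , S≤ = begin
      # S * # S ≤⟨ *-mono-≤ S≤′ S≤′ ⟩
      (c ^ e * ∑ V) * (c ^ e * ∑ V) ≡⟨ regroup (c ^ e) (∑ V) ⟩
      c ^ e * c ^ e * (∑ V * ∑ V) ≡⟨ cong (c ^ e * c ^ e *_) (∑-× V V) ⟨
      c ^ e * c ^ e * ∑ (λ s → ∑ λ t → V s * V t) ≤⟨ *-monoʳ-≤ (c ^ e * c ^ e) (∑-mono λ s → ∑-mono λ t → pointwise s t) ⟩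
      c ^ e * c ^ e * ∑ (λ s → ∑ λ t → (𝟙 (S s) * 𝟙 (S t)) * 𝟙 (T (r ⊗ (s ⊖ t)))) ∎
      where
      open ≤-Reasoning
      V : F → ℕ
      V s = 𝟙 (S s) * 𝟙 (2S (r ⊗ s ⊖ z))
      S≤′ : # S ≤ c ^ e * ∑ V
      S≤′ = ≤-trans S≤ (*-monoˡ-≤ (∑ V) Z≤)
      regroup : ∀ a b → (a * b) * (a * b) ≡ a * a * (b * b)
      regroup = solve-∀
      boolean : ∀ a b a′ b′ d → (b ≡ true → b′ ≡ true → d ≡ true) → (𝟙 a * 𝟙 b) * (𝟙 a′ * 𝟙 b′) ≤ (𝟙 a * 𝟙 a′) * 𝟙 d
      boolean false _ _ _ _ _ = z≤n
      boolean true false _ _ _ _ = z≤n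
      boolean true true false _ _ _ = z≤n
      boolean true true true false _ _ = z≤n
      boolean true true true true d h rewrite h refl refl = ≤-refl
      pointwise : ∀ s t → V s * V t ≤ (𝟙 (S s) * 𝟙 (S t)) * 𝟙 (T (r ⊗ (s ⊖ t)))
      pointwise s t = boolean (S s) (2S (r ⊗ s ⊖ z)) (S t) (2S (r ⊗ t ⊖ z)) (T (r ⊗ (s ⊖ t))) λ s∈ t∈ → difference (2S⁻ s∈) (2S⁻ t∈)
        where
        difference : (∃ λ a → a ∈ S × (r ⊗ s ⊖ z) ⊖ a ∈ S) → (∃ λ b → b ∈ S × (r ⊗ t ⊖ z) ⊖ b ∈ S) → r ⊗ (s ⊖ t) ∈ T
        difference (a , a∈ , a′∈) (b , b∈ , b′∈) = subst (_∈ T)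
          (solve 6 (λ r s t z a b → ((a :+ ((r :* s :- z) :- a)) :+ (:- b)) :+ (:- ((r :* t :- z) :- b)) := r :* (s :- t)) refl r s t z a b)
          (4S⊆T a∈ a′∈ (⊝-closed b∈) (⊝-closed b′∈))

    private
      dilates-hit : ∀ x → ∑ (λ r → 𝟙 (T (r ⊗ x))) ≤ p * 𝟙 (does (x Fin.≟ 0#)) + # T
      dilates-hit x with x Fin.≟ 0#
      ... | yes _ = ≤-trans (∑-mono λ r → 𝟙≤1 (T (r ⊗ x))) (≤-trans (≤-reflexive (∑-const p 1)) (m≤m+n _ _))
      ... | no x≢0 with inverse x x≢0
      ... | u , xu = ≤-trans (≤-reflexive (∑-dilate xu (λ w → 𝟙 (T w)))) (m≤n+m _ (p * 0))

      diagonal : ∀ s → ∑ (λ t → 𝟙 (S t) * 𝟙 (does (s ⊖ t Fin.≟ 0#))) ≤ 1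
      diagonal s = ∑-subsingleton _ (λ t → *-mono-≤ (𝟙≤1 (S t)) (𝟙≤1 (does (s ⊖ t Fin.≟ 0#)))) λ t u t≡ u≡ → trans (sym (on-diagonal t t≡)) (on-diagonal u u≡)
        where
        on-diagonal : ∀ t → 1 ≤ 𝟙 (S t) * 𝟙 (does (s ⊖ t Fin.≟ 0#)) → s ≡ t
        on-diagonal t h = ⊖≡0⇒≡ (does⁻ (s ⊖ t Fin.≟ 0#) (proj₂ (𝟙*𝟙⁻ (S t) _ h)))

    -- In the sum of `good-energy` over all `r`, the diagonal pairs contribute at most `p + # T`
    -- each and the others `# T`, because `r ↦ r x` is a bijection for `x ≢ 0#`. So `# S` is at most
    -- about `c ^ (2 e)` or at least about `p / c ^ (2 e + 1)`.
    all-good⇒large : ∀ {e} → (∀ r → Good e r) → p * # S ≤ c ^ e * c ^ e * (p + c * (# S * # S))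
    all-good⇒large {e} good = cancel-S (begin
      p * # S * # S ≡⟨ *-assoc p (# S) (# S) ⟩
      p * (# S * # S) ≡⟨ ∑-const p (# S * # S) ⟨
      ∑ {p} (λ _ → # S * # S) ≤⟨ ∑-mono (λ r → good-energy {e} {r} (good r)) ⟩
      ∑ (λ r → Q * ∑ λ s → ∑ λ t → (𝟙 (S s) * 𝟙 (S t)) * 𝟙 (T (r ⊗ (s ⊖ t))))
        ≡⟨ trans (∑-*ˡ Q _) (cong (Q *_) (trans (∑-swap _) (∑-cong λ s → trans (∑-swap _) (∑-cong λ t → ∑-*ˡ (𝟙 (S s) * 𝟙 (S t)) _)))) ⟩
      Q * ∑ (λ s → ∑ λ t → (𝟙 (S s) * 𝟙 (S t)) * ∑ λ r → 𝟙 (T (r ⊗ (s ⊖ t))))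
        ≤⟨ *-monoʳ-≤ Q (∑-mono λ s → ≤-trans (∑-mono λ t → *-monoʳ-≤ (𝟙 (S s) * 𝟙 (S t)) (dilates-hit (s ⊖ t))) (inner s)) ⟩
      Q * ∑ (λ s → 𝟙 (S s) * (p + # S * # T))
        ≡⟨ cong (Q *_) (∑-*ʳ (p + # S * # T) _) ⟩
      Q * (# S * (p + # S * # T))
        ≤⟨ *-monoʳ-≤ Q (*-monoʳ-≤ (# S) (+-monoʳ-≤ p (*-monoʳ-≤ (# S) T≤))) ⟩
      Q * (# S * (p + # S * (c * # S)))
        ≡⟨ rearrange Q (# S) p c ⟩
      Q * (p + c * (# S * # S)) * # S ∎)
      where
      open ≤-Reasoning
      Q = c ^ e * c ^ e
      rearrange : ∀ Q s p c → Q * (s * (p + s * (c * s))) ≡ Q * (p + c * (s * s)) * s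
      rearrange = solve-∀
      expand : ∀ a b p d τ → (a * b) * (p * d + τ) ≡ a * (p * (b * d)) + a * (b * τ)
      expand = solve-∀
      inner : ∀ s → ∑ (λ t → (𝟙 (S s) * 𝟙 (S t)) * (p * 𝟙 (does (s ⊖ t Fin.≟ 0#)) + # T)) ≤ 𝟙 (S s) * (p + # S * # T)
      inner s = begin
        ∑ (λ t → (𝟙 (S s) * 𝟙 (S t)) * (p * 𝟙 (does (s ⊖ t Fin.≟ 0#)) + # T))
          ≡⟨ ∑-cong (λ t → expand (𝟙 (S s)) (𝟙 (S t)) p (𝟙 (does (s ⊖ t Fin.≟ 0#))) (# T)) ⟩
        ∑ (λ t → 𝟙 (S s) * (p * (𝟙 (S t) * 𝟙 (does (s ⊖ t Fin.≟ 0#)))) + 𝟙 (S s) * (𝟙 (S t) * # T))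
          ≡⟨ trans (∑-+ _ _) (cong₂ _+_ (trans (∑-*ˡ (𝟙 (S s)) _) (cong (𝟙 (S s) *_) (∑-*ˡ p _)))
                                        (trans (∑-*ˡ (𝟙 (S s)) _) (cong (𝟙 (S s) *_) (∑-*ʳ (# T) _)))) ⟩
        𝟙 (S s) * (p * ∑ (λ t → 𝟙 (S t) * 𝟙 (does (s ⊖ t Fin.≟ 0#)))) + 𝟙 (S s) * (# S * # T)
          ≤⟨ +-monoˡ-≤ _ (*-monoʳ-≤ (𝟙 (S s)) (≤-trans (*-monoʳ-≤ p (diagonal s)) (≤-reflexive (*-identityʳ p)))) ⟩
        𝟙 (S s) * p + 𝟙 (S s) * (# S * # T)
          ≡⟨ *-distribˡ-+ (𝟙 (S s)) p (# S * # T) ⟨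
        𝟙 (S s) * (p + # S * # T) ∎

-- Popular differences and their repeated sums.

module PopularDifferences (p : ℕ) .{{_ : NonZero p}} (p-prime : Prime p) where

  open import Data.Nat.Properties
  open FiniteSums
  open ParameterSelection
  open PrimeField p p-prime
  open Subsets p p-prime
  open BalogSzemerédiGowers p p-prime

  differences : Subset → Subset
  differences A d = does (Fin.any? λ x → (x ∈? A) ×-dec (x ⊖ d ∈? A))

  differences⁺ : ∀ {A x y} → x ∈ A → y ∈ A → x ⊖ y ∈ differences A
  differences⁺ {A} {x} {y} x∈ y∈ = does⁺ (Fin.any? _) (x , x∈ , subst (_∈ A) (sym (⊖-⊖ x y)) y∈)

  differences⁻ : ∀ {A d} → d ∈ differences A → ∃₂ λ x y → x ∈ A × y ∈ A × d ≡ x ⊖ y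
  differences⁻ {A} {d} d∈ = witness (does⁻ (Fin.any? _) d∈)
    where
    witness : (∃ λ x → x ∈ A × x ⊖ d ∈ A) → ∃₂ λ x y → x ∈ A × y ∈ A × d ≡ x ⊖ y
    witness (x , x∈ , y∈) = x , x ⊖ d , x∈ , y∈ , sym (⊖-⊖ x d)

  module Popular (A : Subset) (1≤A : 1 ≤ # A) (Q : ℕ) .{{_ : NonZero Q}} (D≤ : # (differences A) ≤ Q * # A) where
    private
      n = # A
      D = differences A
      instance
        n-nonZero : NonZero n
        n-nonZero = >-nonZero 1≤A

    -- The `n²` pairs are spread over at most `Q n` differences; popular means at least half of the
    -- resulting average multiplicity `n / Q`.
    S : Subset
    S s = does (n ≤? 2 * Q * corr A s)

    private
      S⁻ : ∀ {s} → s ∈ S → n ≤ 2 * Q * corr A s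
      S⁻ {s} = does⁻ (n ≤? 2 * Q * corr A s)

    0∈S : 0# ∈ S
    0∈S = does⁺ (n ≤? _) (≤-trans (m≤n*m n (2 * Q) {{m*n≢0 2 Q}}) (≤-reflexive (cong (2 * Q *_) (∑-cong λ y →
      sym (trans (cong (λ z → 𝟙 (A y) * 𝟙 (A z)) (solve 1 (λ y → y :+ con ℤ.0ℤ := y) refl y)) (𝟙² (A y)))))))

    corr-even : ∀ s → corr A (⊝ s) ≡ corr A s
    corr-even s = begin
      ∑ (λ y → 𝟙 (A y) * 𝟙 (A (y ⊖ s))) ≡⟨ ∑-shift s (λ y → 𝟙 (A y) * 𝟙 (A (y ⊖ s))) ⟨
      ∑ (λ y → 𝟙 (A (y ⊕ s)) * 𝟙 (A ((y ⊕ s) ⊖ s))) ≡⟨ ∑-cong (λ y → trans (cong (λ z → 𝟙 (A (y ⊕ s)) * 𝟙 (A z)) (⊖-⊕ y s)) (*-comm (𝟙 (A (y ⊕ s))) (𝟙 (A y)))) ⟩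
      ∑ (λ y → 𝟙 (A y) * 𝟙 (A (y ⊕ s))) ∎
      where open ≡-Reasoning

    ⊝-closed : ∀ {s} → s ∈ S → ⊝ s ∈ S
    ⊝-closed {s} s∈ = does⁺ (n ≤? _) (subst (λ k → n ≤ 2 * Q * k) (sym (corr-even s)) (S⁻ s∈))

    corr⇒difference : ∀ {s} → 1 ≤ corr A s → s ∈ D
    corr⇒difference {s} h = conclude (∑-average (λ y → 𝟙 (A y) * 𝟙 (A (y ⊕ s))) (λ _ → 0) (λ _ → 0) ≤-refl h)
      where
      conclude : (∃ λ y → 1 ≤ 𝟙 (A y) * 𝟙 (A (y ⊕ s)) × 0 ≤ 0) → s ∈ D
      conclude (y , h , _) = let y∈ , ys∈ = 𝟙*𝟙⁻ (A y) (A (y ⊕ s)) h in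
        subst (_∈ D) (solve 2 (λ y s → (y :+ s) :- y := s) refl y s) (differences⁺ ys∈ y∈)

    S⊆D : S ⊆ D
    S⊆D {s} s∈ = corr⇒difference (n≢0⇒n>0 λ eq → contradiction (≤-trans 1≤A (≤-trans (S⁻ s∈) (≤-reflexive (trans (cong (2 * Q *_) eq) (*-zeroʳ (2 * Q)))))) λ ())

    -- Unpopular differences account for at most half of the `n²` pairs, and each popular one for at
    -- most `n`.
    n≤2S : n ≤ 2 * # S
    n≤2S = *-cancelʳ-≤ n (2 * # S) (Q * n) {{m*n≢0 Q n}} (+-cancelʳ-≤ (n * (Q * n)) _ _ (begin
      n * (Q * n) + n * (Q * n) ≡⟨ e₁ Q n ⟩
      2 * Q * (n * n) ≡⟨ cong (2 * Q *_) (∑-corr A) ⟨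
      2 * Q * ∑ (corr A) ≡⟨ ∑-*ˡ (2 * Q) (corr A) ⟨
      ∑ (λ s → 2 * Q * corr A s) ≤⟨ ∑-mono pointwise ⟩
      ∑ (λ s → 𝟙 (S s) * (2 * Q * n) + 𝟙 (D s) * n) ≡⟨ trans (∑-+ _ _) (cong₂ _+_ (∑-*ʳ (2 * Q * n) _) (∑-*ʳ n _)) ⟩
      # S * (2 * Q * n) + # D * n ≤⟨ +-monoʳ-≤ (# S * (2 * Q * n)) (*-monoˡ-≤ n D≤) ⟩
      # S * (2 * Q * n) + Q * n * n ≡⟨ e₂ (# S) Q n ⟩
      2 * # S * (Q * n) + n * (Q * n) ∎))
      where
      open ≤-Reasoning
      e₁ : ∀ Q n → n * (Q * n) + n * (Q * n) ≡ 2 * Q * (n * n)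
      e₁ = solve-∀
      e₂ : ∀ s Q n → s * (2 * Q * n) + Q * n * n ≡ 2 * s * (Q * n) + n * (Q * n)
      e₂ = solve-∀
      corr≤n : ∀ s → corr A s ≤ n
      corr≤n s = ∑-mono λ y → ≤-trans (*-monoʳ-≤ (𝟙 (A y)) (𝟙≤1 (A (y ⊕ s)))) (≤-reflexive (*-identityʳ _))
      pointwise : ∀ s → 2 * Q * corr A s ≤ 𝟙 (S s) * (2 * Q * n) + 𝟙 (D s) * n
      pointwise s = by-cases (corr A s) (D s) (n ≤? 2 * Q * corr A s) (corr≤n s) corr⇒difference
        where
        by-cases : ∀ r d (m : Dec (n ≤ 2 * Q * r)) → r ≤ n → (1 ≤ r → d ≡ true) → 2 * Q * r ≤ 𝟙 (does m) * (2 * Q * n) + 𝟙 d * n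
        by-cases r d (yes _) r≤n _ = ≤-trans (*-monoʳ-≤ (2 * Q) r≤n) (≤-trans (≤-reflexive (sym (*-identityˡ _))) (m≤m+n _ _))
        by-cases zero d (no _) _ _ = ≤-trans (≤-reflexive (*-zeroʳ (2 * Q))) z≤n
        by-cases (suc r) d (no h) _ d∈ rewrite d∈ (s≤s z≤n) = ≤-trans (<⇒≤ (≰⇒> h)) (≤-reflexive (sym (*-identityˡ n)))

    -- `M k w` counts the ways to write `w` as a sum of `k` elements of `D` and one of `A`.
    M : ℕ → F → ℕ
    M zero = λ w → 𝟙 (A w)
    M (suc k) = (λ d → 𝟙 (D d)) ⋆ M k

    ∑-M : ∀ k → ∑ (M k) ≡ # D ^ k * n
    ∑-M zero = sym (*-identityˡ n)
    ∑-M (suc k) = trans (∑-⋆ _ (M k)) (trans (cong (# D *_) (∑-M k)) (sym (*-assoc (# D) (# D ^ k) n)))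

    -- The quantifier over all `x` in `A` lets the induction move the base point: adding a popular
    -- difference `s` replaces `x` by the many points `c + s` of `A`.
    Rich : ℕ → F → Set
    Rich k w = ∀ {x} → x ∈ A → n ^ k ≤ (2 * Q) ^ k * M k (x ⊕ w)

    rich-zero : Rich 0 0#
    rich-zero {x} x∈ = ≤-reflexive (sym (trans (*-identityˡ _) (𝟙-true (subst (_∈ A) (solve 1 (λ x → x := x :+ con ℤ.0ℤ) refl x) x∈))))

    -- x + s + w = (x − c) + (c + s) + w for each of the many c with c, c + s ∈ A.
    rich-suc : ∀ {k w s} → Rich k w → s ∈ S → Rich (suc k) (w ⊕ s)
    rich-suc {k} {w} {s} rich s∈ {x} x∈ = begin
      n * n ^ k ≤⟨ *-monoˡ-≤ (n ^ k) (S⁻ s∈) ⟩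
      2 * Q * corr A s * n ^ k ≡⟨ trans (*-assoc (2 * Q) _ _) (cong (2 * Q *_) (sym (∑-*ʳ (n ^ k) _))) ⟩
      2 * Q * ∑ (λ c → 𝟙 (A c) * 𝟙 (A (c ⊕ s)) * n ^ k) ≤⟨ *-monoʳ-≤ (2 * Q) (∑-mono pointwise) ⟩
      2 * Q * ∑ (λ c → (2 * Q) ^ k * (𝟙 (D (x ⊖ c)) * M k ((x ⊕ (w ⊕ s)) ⊖ (x ⊖ c))))
        ≡⟨ cong (2 * Q *_) (trans (∑-*ˡ ((2 * Q) ^ k) _) (cong ((2 * Q) ^ k *_) (∑-reflect x (λ e → 𝟙 (D e) * M k ((x ⊕ (w ⊕ s)) ⊖ e))))) ⟩
      2 * Q * ((2 * Q) ^ k * M (suc k) (x ⊕ (w ⊕ s))) ≡⟨ *-assoc (2 * Q) _ _ ⟨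
      2 * Q * (2 * Q) ^ k * M (suc k) (x ⊕ (w ⊕ s)) ∎
      where
      open ≤-Reasoning
      pointwise : ∀ c → 𝟙 (A c) * 𝟙 (A (c ⊕ s)) * n ^ k ≤ (2 * Q) ^ k * (𝟙 (D (x ⊖ c)) * M k ((x ⊕ (w ⊕ s)) ⊖ (x ⊖ c)))
      pointwise c with A c in c∈ | A (c ⊕ s) in cs∈
      ... | false | _ = z≤n
      ... | true | false = z≤n
      ... | true | true = begin
        1 * 1 * n ^ k ≡⟨ *-identityˡ _ ⟩
        n ^ k ≤⟨ rich cs∈ ⟩
        (2 * Q) ^ k * M k ((c ⊕ s) ⊕ w) ≡⟨ cong (λ z → (2 * Q) ^ k * M k z) (solve 4 (λ c s w x → (c :+ s) :+ w := (x :+ (w :+ s)) :- (x :- c)) refl c s w x) ⟩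
        (2 * Q) ^ k * M k ((x ⊕ (w ⊕ s)) ⊖ (x ⊖ c)) ≡⟨ cong ((2 * Q) ^ k *_) (sym (trans (cong (_* M k ((x ⊕ (w ⊕ s)) ⊖ (x ⊖ c))) (𝟙-true (differences⁺ x∈ c∈))) (*-identityˡ _))) ⟩
        (2 * Q) ^ k * (𝟙 (D (x ⊖ c)) * M k ((x ⊕ (w ⊕ s)) ⊖ (x ⊖ c))) ∎

    private
      x₀ = proj₁ (1≤#⇒∈ 1≤A)
      x₀∈ = proj₂ (1≤#⇒∈ 1≤A)

    rich-set : ℕ → F → Subset
    rich-set k x w = does (n ^ k ≤? (2 * Q) ^ k * M k (x ⊕ w))

    -- Markov's inequality against the total mass of `M k`. For `x` in `A` the set contains the
    -- `k`-fold sums of `S`; for `x = 0#` it contains `A` plus these sums.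
    rich-set-size : ∀ k x → # (rich-set k x) ≤ 2 * (2 * Q * Q) ^ k * # S
    rich-set-size k x = *-cancelʳ-≤ _ _ (n ^ k) {{m^n≢0 n k}} (begin
      # (rich-set k x) * n ^ k
        ≤⟨ #-bound {rich-set k x} (λ w → (2 * Q) ^ k * M k (x ⊕ w)) (λ {w} → does⁻ (n ^ k ≤? (2 * Q) ^ k * M k (x ⊕ w))) ⟩
      ∑ (λ w → (2 * Q) ^ k * M k (x ⊕ w))
        ≡⟨ trans (∑-*ˡ ((2 * Q) ^ k) _) (cong ((2 * Q) ^ k *_) (trans (∑-cong λ w → cong (M k) (solve 2 (λ x w → x :+ w := w :+ x) refl x w)) (trans (∑-shift x (M k)) (∑-M k)))) ⟩
      (2 * Q) ^ k * (# D ^ k * n)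
        ≤⟨ *-monoʳ-≤ ((2 * Q) ^ k) (*-mono-≤ (^-monoˡ-≤ k D≤) n≤2S) ⟩
      (2 * Q) ^ k * ((Q * n) ^ k * (2 * # S))
        ≡⟨ cong (λ z → (2 * Q) ^ k * (z * (2 * # S))) (*-^ k Q n) ⟩
      (2 * Q) ^ k * (Q ^ k * n ^ k * (2 * # S))
        ≡⟨ regroup ((2 * Q) ^ k) (Q ^ k) (n ^ k) (# S) ⟩
      2 * ((2 * Q) ^ k * Q ^ k) * # S * n ^ k
        ≡⟨ cong (λ z → 2 * z * # S * n ^ k) (*-^ k (2 * Q) Q) ⟨
      2 * (2 * Q * Q) ^ k * # S * n ^ k ∎)
      where
      open ≤-Reasoning
      regroup : ∀ a b c s → a * (b * c * (2 * s)) ≡ 2 * (a * b) * s * c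
      regroup = solve-∀

    T : Subset
    T = rich-set 5 x₀

    5S⊆T : ∀ {a b c d e} → a ∈ S → b ∈ S → c ∈ S → d ∈ S → e ∈ S → (((a ⊕ b) ⊕ c) ⊕ d) ⊕ e ∈ T
    5S⊆T {a} {b} {c} {d} {e} a∈ b∈ c∈ d∈ e∈ = subst (_∈ T)
      (solve 5 (λ a b c d e → ((((con ℤ.0ℤ :+ a) :+ b) :+ c) :+ d) :+ e := (((a :+ b) :+ c) :+ d) :+ e) refl a b c d e)
      (does⁺ (n ^ 5 ≤? _) (rich-suc {4} (rich-suc {3} (rich-suc {2} (rich-suc {1} (rich-suc {0} rich-zero a∈) b∈) c∈) d∈) e∈ x₀∈))

    W : Subset
    W = rich-set 1 0#

    A⊕S⊆W : ∀ {x s} → x ∈ A → s ∈ S → x ⊕ s ∈ W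
    A⊕S⊆W {x} {s} x∈ s∈ = does⁺ (n ^ 1 ≤? _) (subst (λ z → n ^ 1 ≤ (2 * Q) ^ 1 * M 1 z)
      (solve 2 (λ x s → x :+ (con ℤ.0ℤ :+ s) := con ℤ.0ℤ :+ (x :+ s)) refl x s) (rich-suc {0} rich-zero s∈ x∈))

-- Multipliers from large overlaps, and the contradiction with the size of `S`.

module ApproximateSubrings (p : ℕ) .{{_ : NonZero p}} (p-prime : Prime p) where

  open import Data.Nat.Properties
  open FiniteSums
  open ParameterSelection
  open PrimeField p p-prime
  open Subsets p p-prime
  open BalogSzemerédiGowers p p-prime
  open Covering p p-prime
  open PopularDifferences p p-prime

  module StableSet (A : Subset) (1≤A : 1 ≤ # A) (Q c : ℕ) .{{_ : NonZero Q}} (D≤ : # (differences A) ≤ Q * # A)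
    (Q≤c : Q ≤ c) (W-bound : 2 * (2 * Q * Q) ^ 1 ≤ c) (T-bound : 2 * (2 * Q * Q) ^ 5 ≤ c) where

    open Popular A 1≤A Q D≤ public
    open Multipliers S T c 0∈S ⊝-closed 5S⊆T (≤-trans (rich-set-size 5 _) (*-monoˡ-≤ (# S) T-bound)) public

    private
      W≤ : # W ≤ c * # S
      W≤ = ≤-trans (rich-set-size 1 0#) (*-monoˡ-≤ (# S) W-bound)

      A-cover = covering A S W (∈⇒1≤# 0∈S) A⊕S⊆W

      Z₁ : List F
      Z₁ = proj₁ A-cover

      Z₁≤c : length Z₁ ≤ c
      Z₁≤c = *-cancelʳ-≤ _ _ (# S) {{>-nonZero (∈⇒1≤# 0∈S)}} (≤-trans (proj₁ (proj₂ A-cover)) W≤)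

      near-A : ∀ {x} → x ∈ A → Near Z₁ x
      near-A {x} x∈ = conclude (proj₂ (proj₂ A-cover) x∈)
        where
        conclude : Covered S Z₁ x → Near Z₁ x
        conclude (z , z∈ , b , b′ , b∈ , b′∈ , refl) = b , ⊝ b′ , b∈ , ⊝-closed b′∈ , z , z∈ ,
            solve 3 (λ z b b′ → z :+ (b :- b′) := (b :+ (:- b′)) :+ z) refl z b b′

    -- As `S + U ⊆ W`, few translates of `U - U` cover `S`. The shift `y` cancels in `r (U - U)`,
    -- which lies in `A - A`, and `A` is covered by translates of `S - S`. The exponent 6 comes from
    -- `Z₀`, two copies of `Z₁` and a cover of size `c³`.
    overlap⇒good : ∀ {r y} U → U ⊆ A → (∀ {x} → x ∈ U → r ⊗ x ⊖ y ∈ A) → # A ≤ c * # U → Good 6 r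
    overlap⇒good {r} {y} U U⊆A rU⊆A A≤U = Z , (begin
        length Z ≡⟨ trans (length-⊕ˡ ((Z₀ ⊕ˡ Z₁) ⊕ˡ map ⊝_ Z₁) (map (r ⊗_) Z′))
                                                           (cong₂ _*_ (trans (length-⊕ˡ (Z₀ ⊕ˡ Z₁) (map ⊝_ Z₁)) (cong₂ _*_ (length-⊕ˡ Z₀ Z₁) (length-map ⊝_ Z₁))) (length-map (r ⊗_) Z′)) ⟩
        length Z₀ * length Z₁ * length Z₁ * length Z′ ≤⟨ *-mono-≤ (*-mono-≤ (*-mono-≤ Z₀≤c Z₁≤c) Z₁≤c) Z′≤c³ ⟩
        c * c * c * (c * (c * c)) ≡⟨ power c ⟩
        c ^ 6 ∎) , near
      where
      open ≤-Reasoning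
      power : ∀ c → c * c * c * (c * (c * c)) ≡ c * (c * (c * (c * (c * (c * 1)))))
      power = solve-∀
      1≤U : 1 ≤ # U
      1≤U = n≢0⇒n>0 λ eq → contradiction (≤-trans 1≤A (≤-trans A≤U (≤-reflexive (trans (cong (c *_) eq) (*-zeroʳ c))))) λ ()
      U-cover = covering S U W 1≤U λ {s} {u} s∈ u∈ → subst (_∈ W) (solve 2 (λ u s → u :+ s := s :+ u) refl u s) (A⊕S⊆W (U⊆A u∈) s∈)
      Z′ = proj₁ U-cover
      Z = ((Z₀ ⊕ˡ Z₁) ⊕ˡ map ⊝_ Z₁) ⊕ˡ map (r ⊗_) Z′
      Z′≤c³ : length Z′ ≤ c * (c * c)
      Z′≤c³ = *-cancelʳ-≤ _ _ (# U) {{>-nonZero 1≤U}} (begin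
        length Z′ * # U ≤⟨ proj₁ (proj₂ U-cover) ⟩
        # W ≤⟨ W≤ ⟩
        c * # S ≤⟨ *-monoʳ-≤ c (≤-trans (#-mono S⊆D) D≤) ⟩
        c * (Q * # A) ≤⟨ *-monoʳ-≤ c (*-mono-≤ Q≤c A≤U) ⟩
        c * (c * (c * # U)) ≡⟨ trans (cong (c *_) (sym (*-assoc c c (# U)))) (sym (*-assoc c (c * c) (# U))) ⟩
        c * (c * c) * # U ∎)
      near : ∀ {s} → s ∈ S → Near Z (r ⊗ s)
      near {s} s∈ = conclude (proj₂ (proj₂ U-cover) s∈)
        where
        conclude : Covered U Z′ s → Near Z (r ⊗ s)
        conclude (z , z∈ , u , u′ , u∈ , u′∈ , refl) = subst (Near Z)
            (solve 5 (λ r z u u′ y → ((r :* u :- y) :+ (:- (r :* u′ :- y))) :+ r :* z := r :* (z :+ (u :- u′))) refl r z u u′ y)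
            (near-shift (near-⊕ (near-A (rU⊆A u∈)) (near-⊝ (near-A (rU⊆A u′∈)))) (∈-map⁺ (r ⊗_) z∈))

  ∑-weighted : ∀ (X : Subset) c (h : F → ℕ) → ∑ (λ y → 𝟙 (X y) * (c * h y)) ≡ c * ∑ (λ y → 𝟙 (X y) * h y)
  ∑-weighted X c h = trans (∑-cong λ y → *-swap (𝟙 (X y)) c (h y)) (∑-*ˡ c _)

  energy : Subset → Subset → F → F → ℕ
  energy X Y a b = ∑ λ y → 𝟙 (X y) * ∑ λ x → 𝟙 (X x) * 𝟙 (Y (x ⊗ a ⊖ y ⊗ b))

  energy≤ : ∀ X Y a b → energy X Y a b ≤ # X * # X
  energy≤ X Y a b = ≤-trans (∑-mono λ y → *-monoʳ-≤ (𝟙 (X y)) (∑-mono λ x →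
      ≤-trans (*-monoʳ-≤ (𝟙 (X x)) (𝟙≤1 (Y (x ⊗ a ⊖ y ⊗ b)))) (≤-reflexive (*-identityʳ _))))
    (≤-reflexive (∑-*ʳ (# X) _))

  -- Pairs are sorted by `w = x a - y b`: a popular value `w` means that `X` overlaps its image
  -- under `x ↦ (x a - w) / b`.
  energy-by-value : ∀ X Y a {b b⁻¹} → b ⊗ b⁻¹ ≡ 1# →
    energy X Y a b ≡ ∑ λ w → 𝟙 (Y w) * ∑ λ x → 𝟙 (X x) * 𝟙 (X ((x ⊗ a ⊖ w) ⊗ b⁻¹))
  energy-by-value X Y a {b} {b⁻¹} bb⁻¹ = begin
    ∑ (λ y → 𝟙 (X y) * ∑ λ x → 𝟙 (X x) * 𝟙 (Y (x ⊗ a ⊖ y ⊗ b)))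
      ≡⟨ trans (∑-cong λ y → sym (∑-*ˡ (𝟙 (X y)) _)) (∑-swap _) ⟩
    ∑ (λ x → ∑ λ y → 𝟙 (X y) * (𝟙 (X x) * 𝟙 (Y (x ⊗ a ⊖ y ⊗ b))))
      ≡⟨ ∑-cong (λ x → trans (∑-cong λ y → cong₂ (λ s t → 𝟙 (X s) * (𝟙 (X x) * 𝟙 (Y (x ⊗ a ⊖ t)))) (sym (⊗-cancel bb⁻¹ y)) refl)
          (trans (∑-dilate bb⁻¹ (λ t → 𝟙 (X (t ⊗ b⁻¹)) * (𝟙 (X x) * 𝟙 (Y (x ⊗ a ⊖ t)))))
          (trans (sym (∑-reflect (x ⊗ a) (λ t → 𝟙 (X (t ⊗ b⁻¹)) * (𝟙 (X x) * 𝟙 (Y (x ⊗ a ⊖ t))))))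
                 (∑-cong λ w → cong (λ z → 𝟙 (X ((x ⊗ a ⊖ w) ⊗ b⁻¹)) * (𝟙 (X x) * 𝟙 (Y z))) (⊖-⊖ (x ⊗ a) w))))) ⟩
    ∑ (λ x → ∑ λ w → 𝟙 (X ((x ⊗ a ⊖ w) ⊗ b⁻¹)) * (𝟙 (X x) * 𝟙 (Y w)))
      ≡⟨ ∑-swap _ ⟩
    ∑ (λ w → ∑ λ x → 𝟙 (X ((x ⊗ a ⊖ w) ⊗ b⁻¹)) * (𝟙 (X x) * 𝟙 (Y w)))
      ≡⟨ ∑-cong (λ w → trans (∑-cong λ x → regroup (𝟙 (X ((x ⊗ a ⊖ w) ⊗ b⁻¹))) (𝟙 (X x)) (𝟙 (Y w))) (∑-*ˡ (𝟙 (Y w)) _)) ⟩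
    ∑ (λ w → 𝟙 (Y w) * ∑ λ x → 𝟙 (X x) * 𝟙 (X ((x ⊗ a ⊖ w) ⊗ b⁻¹))) ∎
    where
    open ≡-Reasoning
    regroup : ∀ a b c → a * (b * c) ≡ c * (b * a)
    regroup = solve-∀

  -- The sets X and Y will be level sets of positive definite functions, so that the differences x a - x′ a′
  -- of any subset X′ of X fall into Y with probability at least 1 / q.
  module _ (X Y B : Subset) (q N : ℕ) .{{_ : NonZero q}} (32≤q : 32 ≤ q) (B-units : ∀ {a} → a ∈ B → ∃ λ u → a ⊗ u ≡ 1#)
    (Y≤ : # Y ≤ q * # X) (1≤N : 1 ≤ N) (N≤X : N ≤ # X) (N≤B : N ≤ # B) (NX≤ : N * # X ≤ q * p)
    (hereditary : ∀ X′ → X′ ⊆ X → # B * # B * (# X′ * # X′) ≤ q * ∑ λ b → 𝟙 (B b) * ∑ λ a → 𝟙 (B a) * energy X′ Y a b)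
    (Q c : ℕ) .{{_ : NonZero Q}} (Q-def : Q ≡ 8 * ((q * q) * (q * q) * (q * q) * (q * q) * (q * q) * (q * q)))
    (Q≤c : Q ≤ c) (q-bound : 8 * (q * q * q) ≤ c) (W-bound : 2 * (2 * Q * Q) ^ 1 ≤ c) (T-bound : 2 * (2 * Q * Q) ^ 5 ≤ c)
    (k : ℕ) (p<N : p < N ^ suc k) where

    private
      1≤X = ≤-trans 1≤N N≤X
      1≤B = ≤-trans 1≤N N≤B

      PopularElement : Subset → Set
      PopularElement X′ = ∃ λ b → b ∈ B × # B * (# X′ * # X′) ≤ q * ∑ λ a → 𝟙 (B a) * energy X′ Y a b

      PopularPair : Set
      PopularPair = ∃₂ λ a b → a ∈ B × b ∈ B × # X * # X ≤ q * energy X Y a b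

      -- Applied to `X`, it leads to the pair `a, b` for Balog-Szemerédi-Gowers; applied to the
      -- resulting `A`, to a denominator `b` common to many ratios.
      popular-b : ∀ X′ → X′ ⊆ X → PopularElement X′
      popular-b X′ X′⊆ = conclude (∑-average (λ b → 𝟙 (B b)) (λ _ → # B * (# X′ * # X′)) (λ b → q * ∑ λ a → 𝟙 (B a) * energy X′ Y a b) total 1≤B)
        where
        total : ∑ (λ b → 𝟙 (B b) * (# B * (# X′ * # X′))) ≤ ∑ (λ b → 𝟙 (B b) * (q * ∑ λ a → 𝟙 (B a) * energy X′ Y a b))
        total = ≤-trans (≤-reflexive (trans (∑-*ʳ (# B * (# X′ * # X′)) _) (sym (*-assoc (# B) (# B) (# X′ * # X′)))))
          (≤-trans (hereditary X′ X′⊆) (≤-reflexive (sym (∑-weighted B q (λ b → ∑ λ a → 𝟙 (B a) * energy X′ Y a b)))))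
        conclude : (∃ λ b → 1 ≤ 𝟙 (B b) × # B * (# X′ * # X′) ≤ q * ∑ λ a → 𝟙 (B a) * energy X′ Y a b) →
          PopularElement X′
        conclude (b , 1≤ , h) = b , 𝟙⁻ 1≤ , h

      popular-pair : PopularPair
      popular-pair = conclude (popular-b X (λ x∈ → x∈))
        where
        conclude : PopularElement X → PopularPair
        conclude (b , b∈ , h) = conclude′ (∑-average (λ a → 𝟙 (B a)) (λ _ → # X * # X) (λ a → q * energy X Y a b) total 1≤B)
          where
          total : ∑ (λ a → 𝟙 (B a) * (# X * # X)) ≤ ∑ (λ a → 𝟙 (B a) * (q * energy X Y a b))
          total = ≤-trans (≤-reflexive (∑-*ʳ (# X * # X) _))
            (≤-trans h (≤-reflexive (sym (∑-weighted B q (λ a → energy X Y a b)))))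
          conclude′ : (∃ λ a → 1 ≤ 𝟙 (B a) × # X * # X ≤ q * energy X Y a b) → PopularPair
          conclude′ (a , 1≤ , h′) = a , b , 𝟙⁻ 1≤ , b∈ , h′

    module Structured (A : Subset) (A⊆X : A ⊆ X) (X≤A : # X ≤ 4 * q * # A) (D≤ : # (differences A) ≤ Q * # A) where
      1≤A : 1 ≤ # A
      1≤A = n≢0⇒n>0 λ eq → contradiction (≤-trans 1≤X (≤-trans X≤A (≤-reflexive (trans (cong (4 * q *_) eq) (*-zeroʳ (4 * q)))))) λ ()

      open StableSet A 1≤A Q c D≤ Q≤c W-bound T-bound

      module _ {b b⁻¹ : F} (bb⁻¹ : b ⊗ b⁻¹ ≡ 1#) (h : # B * (# A * # A) ≤ q * ∑ λ a → 𝟙 (B a) * energy A Y a b) where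

        -- The ratios `a / b` with `a` in `B`, for the fixed denominator `b`, whose energy on `A` is
        -- at least half of the guaranteed average.
        R : Subset
        R r = B (r ⊗ b) ∧ does (# A * # A ≤? 2 * q * energy A Y (r ⊗ b) b)

        R-large : # B ≤ 2 * q * # R
        R-large = *-cancelʳ-≤ _ _ (# A * # A) {{m*n≢0 (# A) (# A) {{>-nonZero 1≤A}} {{>-nonZero 1≤A}}}}
          (+-cancelʳ-≤ (# B * (# A * # A)) _ _ (begin
          # B * (# A * # A) + # B * (# A * # A) ≤⟨ +-mono-≤ h h ⟩
          q * weight + q * weight ≡⟨ e₁ q weight ⟩
          2 * q * weight ≡⟨ ∑-*ˡ (2 * q) _ ⟨
          ∑ (λ a → 2 * q * (𝟙 (B a) * energy A Y a b)) ≤⟨ ∑-mono (λ a → pointwise (B a) (energy A Y a b) (energy≤ A Y a b) (# A * # A ≤? 2 * q * energy A Y a b)) ⟩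
          ∑ (λ a → 𝟙 (R′ a) * (2 * q * (# A * # A)) + 𝟙 (B a) * (# A * # A))
            ≡⟨ trans (∑-+ _ _) (cong₂ _+_ (∑-*ʳ (2 * q * (# A * # A)) _) (∑-*ʳ (# A * # A) _)) ⟩
          # R′ * (2 * q * (# A * # A)) + # B * (# A * # A)
            ≡⟨ cong (λ z → z * (2 * q * (# A * # A)) + # B * (# A * # A)) (∑-dilate bb⁻¹ (λ a → 𝟙 (R′ a))) ⟨
          # R * (2 * q * (# A * # A)) + # B * (# A * # A)
            ≡⟨ cong (_+ # B * (# A * # A)) (e₂ (# R) q (# A * # A)) ⟩
          2 * q * # R * (# A * # A) + # B * (# A * # A) ∎))
          where
          open ≤-Reasoning
          weight = ∑ λ a → 𝟙 (B a) * energy A Y a b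
          R′ : Subset
          R′ a = B a ∧ does (# A * # A ≤? 2 * q * energy A Y a b)
          e₁ : ∀ q s → q * s + q * s ≡ 2 * q * s
          e₁ = solve-∀
          e₂ : ∀ r q n → r * (2 * q * n) ≡ 2 * q * r * n
          e₂ = solve-∀
          pointwise : ∀ t e → e ≤ # A * # A → (d : Dec (# A * # A ≤ 2 * q * e)) →
            2 * q * (𝟙 t * e) ≤ 𝟙 (t ∧ does d) * (2 * q * (# A * # A)) + 𝟙 t * (# A * # A)
          pointwise true e e≤ (yes _) = ≤-trans (*-monoʳ-≤ (2 * q) (≤-trans (≤-reflexive (*-identityˡ e)) e≤))
                                           (≤-trans (≤-reflexive (sym (*-identityˡ _))) (m≤m+n _ _))
          pointwise true e e≤ (no h) = ≤-trans (≤-reflexive (cong (2 * q *_) (*-identityˡ e))) (≤-trans (<⇒≤ (≰⇒> h)) (≤-reflexive (sym (*-identityˡ _))))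
          pointwise false e e≤ _ = ≤-trans (≤-reflexive (*-zeroʳ (2 * q))) z≤n

        -- The average over `w` in `Y`, with `# Y ≤ q * # X ≤ 4 q² * # A`, finds a `w` whose overlap
        -- has at least `# A / (8 q³)` elements.
        R-good : ∀ {r} → r ∈ R → Good 6 r
        R-good {r} r∈ = conclude (∑-average (λ w → 𝟙 (Y w)) (λ _ → # A * # A) (λ w → 2 * q * # Y * meeting w) total 1≤Y)
          where
          open ≤-Reasoning
          E = energy A Y (r ⊗ b) b
          popular : # A * # A ≤ 2 * q * E
          popular = does⁻ (# A * # A ≤? 2 * q * E) (∧⁻ʳ {B (r ⊗ b)} r∈)
          meeting : F → ℕ
          meeting w = ∑ λ x → 𝟙 (A x) * 𝟙 (A ((x ⊗ (r ⊗ b) ⊖ w) ⊗ b⁻¹))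
          E-def : E ≡ ∑ λ w → 𝟙 (Y w) * meeting w
          E-def = energy-by-value A Y (r ⊗ b) bb⁻¹
          1≤Y : 1 ≤ # Y
          1≤Y = n≢0⇒n>0 λ eq → contradiction (≤-trans (*-mono-≤ 1≤A 1≤A) (≤-trans popular (≤-reflexive
                  (trans (cong (2 * q *_) (trans E-def (E≡0 eq))) (*-zeroʳ (2 * q)))))) λ ()
            where
            E≡0 : # Y ≡ 0 → ∑ (λ w → 𝟙 (Y w) * meeting w) ≡ 0
            E≡0 eq = n≤0⇒n≡0 (≤-trans (∑-mono (λ w → *-monoˡ-≤ (meeting w) (≤-trans (≤∑ (λ w → 𝟙 (Y w)) w) (≤-reflexive eq))))
                       (≤-reflexive (∑-zero p)))
          swap : ∀ y q e → y * (2 * q * e) ≡ 2 * q * y * e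
          swap = solve-∀
          total : ∑ (λ w → 𝟙 (Y w) * (# A * # A)) ≤ ∑ (λ w → 𝟙 (Y w) * (2 * q * # Y * meeting w))
          total = begin
            ∑ (λ w → 𝟙 (Y w) * (# A * # A)) ≡⟨ ∑-*ʳ (# A * # A) _ ⟩
            # Y * (# A * # A) ≤⟨ *-monoʳ-≤ (# Y) popular ⟩
            # Y * (2 * q * E) ≡⟨ trans (swap (# Y) q E) (cong (2 * q * # Y *_) E-def) ⟩
            2 * q * # Y * ∑ (λ w → 𝟙 (Y w) * meeting w) ≡⟨ ∑-weighted Y (2 * q * # Y) meeting ⟨
            ∑ (λ w → 𝟙 (Y w) * (2 * q * # Y * meeting w)) ∎
          regroup : ∀ q a u → 2 * q * (q * (4 * q * a)) * u ≡ 8 * (q * q * q) * u * a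
          regroup = solve-∀
          conclude : (∃ λ w → 1 ≤ 𝟙 (Y w) × # A * # A ≤ 2 * q * # Y * meeting w) → Good 6 r
          conclude (w , _ , hw) = overlap⇒good {r} {w ⊗ b⁻¹} U (λ x∈ → ∧⁻ˡ x∈)
              (λ {x} x∈ → subst (_∈ A) (dilated x) (∧⁻ʳ {A x} x∈)) A≤U
            where
            U : Subset
            U x = A x ∧ A ((x ⊗ (r ⊗ b) ⊖ w) ⊗ b⁻¹)
            dilated : ∀ x → (x ⊗ (r ⊗ b) ⊖ w) ⊗ b⁻¹ ≡ r ⊗ x ⊖ w ⊗ b⁻¹
            dilated x = trans (solve 5 (λ x r b w b⁻¹ → (x :* (r :* b) :- w) :* b⁻¹ := (r :* x) :* b :* b⁻¹ :- w :* b⁻¹) refl x r b w b⁻¹)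
                  (cong (_⊖ w ⊗ b⁻¹) (⊗-cancel bb⁻¹ (r ⊗ x)))
            scaled : # A * # A ≤ 8 * (q * q * q) * # U * # A
            scaled = begin
              # A * # A ≤⟨ hw ⟩
              2 * q * # Y * meeting w ≡⟨ cong (2 * q * # Y *_) (∑-cong λ x → sym (𝟙-∧ (A x) (A ((x ⊗ (r ⊗ b) ⊖ w) ⊗ b⁻¹)))) ⟩
              2 * q * # Y * # U ≤⟨ *-monoˡ-≤ (# U) (*-monoʳ-≤ (2 * q) (≤-trans Y≤ (*-monoʳ-≤ q X≤A))) ⟩
              2 * q * (q * (4 * q * # A)) * # U ≡⟨ regroup q (# A) (# U) ⟩
              8 * (q * q * q) * # U * # A ∎
            A≤U : # A ≤ c * # U
            A≤U = ≤-trans (*-cancelʳ-≤ (# A) (8 * (q * q * q) * # U) (# A) {{>-nonZero 1≤A}} scaled) (*-monoˡ-≤ (# U) q-bound)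

        private
          e = exponent-after (suc k) 6
          K = c ^ e * c ^ e

        R² : 4 * (q * q) ≤ N → N ≤ # R * # R
        R² 4q²≤N = *-cancelˡ-≤ N {{>-nonZero 1≤N}} (begin
          N * N ≤⟨ *-mono-≤ N≤R N≤R ⟩
          2 * q * # R * (2 * q * # R) ≡⟨ e₃ q (# R) ⟩
          4 * (q * q) * (# R * # R) ≤⟨ *-monoˡ-≤ (# R * # R) 4q²≤N ⟩
          N * (# R * # R) ∎)
          where
          open ≤-Reasoning
          N≤R : N ≤ 2 * q * # R
          N≤R = ≤-trans N≤B R-large
          e₃ : ∀ q r → 2 * q * r * (2 * q * r) ≡ 4 * (q * q) * (r * r)
          e₃ = solve-∀

        -- From `N ≤ # R ^ 2` follows `p < # R ^ (2 (k + 1))`, and `k + 1 ≤ 2 ^ k` raises the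
        -- exponent to `2 ^ (k + 1)`: at most `k + 1` rounds of pivoting are enough.
        every-good : 4 * (q * q) ≤ N → ∀ r → Good e r
        every-good 4q²≤N = all-good (suc k) {R} {6} 2≤R R-good (begin-strict
          p <⟨ p<N ⟩
          N ^ suc k ≤⟨ ^-monoˡ-≤ (suc k) (R² 4q²≤N) ⟩
          (# R * # R) ^ suc k ≡⟨ cong (_^ suc k) (cong (# R *_) (*-identityʳ (# R))) ⟨
          (# R ^ 2) ^ suc k ≡⟨ ^-*-assoc (# R) 2 (suc k) ⟩
          # R ^ (2 * suc k) ≤⟨ ^-monoʳ-≤ (# R) {{>-nonZero (≤-trans (s≤s z≤n) 2≤R)}} (*-monoʳ-≤ 2 (n<2^n k)) ⟩
          # R ^ (2 ^ suc k) ∎)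
          where
          open ≤-Reasoning
          2≤R : 2 ≤ # R
          2≤R = square-cancel-≤ (≤-trans (≤-trans (*-monoʳ-≤ 4 (*-mono-≤ (>-nonZero⁻¹ q) (>-nonZero⁻¹ q))) 4q²≤N) (R² 4q²≤N))

        -- `N ≤ # X ≤ 8 q * # S` gives `2 K ≤ # S`, which removes the term `p` from `all-good⇒large`
        -- and leaves `p ≤ 2 K c * # S`. But `# S ≤ Q * # X`, and `N * # X ≤ q p` makes `X` too
        -- small for this.
        impossible : 4 * (q * q) ≤ N → 16 * q * K ≤ N → 2 * K * c * Q * q < N → ⊥
        impossible 4q²≤N K≤N N-large = contradiction N-large (≤⇒≯ (*-cancelʳ-≤ N _ (# X) {{>-nonZero 1≤X}} (begin
          N * # X ≤⟨ NX≤ ⟩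
          q * p ≤⟨ *-monoʳ-≤ q p≤S ⟩
          q * (2 * K * c * # S) ≤⟨ *-monoʳ-≤ q (*-monoʳ-≤ (2 * K * c) S≤X) ⟩
          q * (2 * K * c * (Q * # X)) ≡⟨ e₅ q (2 * K * c) Q (# X) ⟩
          2 * K * c * Q * q * # X ∎)))
          where
          open ≤-Reasoning
          e₅ : ∀ q a Q n → q * (a * (Q * n)) ≡ a * Q * q * n
          e₅ = solve-∀
          S≤X : # S ≤ Q * # X
          S≤X = ≤-trans (#-mono S⊆D) (≤-trans D≤ (*-monoʳ-≤ Q (#-mono A⊆X)))
          X≤S : # X ≤ 8 * q * # S
          X≤S = ≤-trans X≤A (≤-trans (*-monoʳ-≤ (4 * q) n≤2S) (≤-reflexive (e₄ q (# S))))
            where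
            e₄ : ∀ q s → 4 * q * (2 * s) ≡ 8 * q * s
            e₄ = solve-∀
          2K≤S : 2 * K ≤ # S
          2K≤S = *-cancelˡ-≤ (8 * q) {{m*n≢0 8 q}} (≤-trans (≤-reflexive (e₆ q K)) (≤-trans K≤N (≤-trans N≤X X≤S)))
            where
            e₆ : ∀ q K → 8 * q * (2 * K) ≡ 16 * q * K
            e₆ = solve-∀
          p≤S : p ≤ 2 * K * c * # S
          p≤S = *-cancelʳ-≤ p _ (# S) {{>-nonZero (∈⇒1≤# 0∈S)}} (+-cancelʳ-≤ (p * # S) _ _ (begin
            p * # S + p * # S ≤⟨ +-mono-≤ large large ⟩
            K * (p + c * (# S * # S)) + K * (p + c * (# S * # S)) ≡⟨ e₇ K p c (# S) ⟩
            2 * K * c * # S * # S + p * (2 * K) ≤⟨ +-monoʳ-≤ _ (*-monoʳ-≤ p 2K≤S) ⟩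
            2 * K * c * # S * # S + p * # S ∎))
            where
            large = all-good⇒large {e} (every-good 4q²≤N)
            e₇ : ∀ K p c s → K * (p + c * (s * s)) + K * (p + c * (s * s)) ≡ 2 * K * c * s * s + p * (2 * K)
            e₇ = solve-∀

    no-approximate-subring : let K = c ^ exponent-after (suc k) 6 * c ^ exponent-after (suc k) 6 in
      4 * (q * q) ≤ N → 16 * q * K ≤ N → 2 * K * c * Q * q < N → ⊥
    no-approximate-subring 4q²≤N K≤N N-large = from-pair popular-pair
      where
      from-structure : ∀ A → A ⊆ X → # X ≤ 4 * q * # A → # (differences A) ≤ Q * # A →
        PopularElement A → ⊥
      from-structure A A⊆X X≤A D≤ (b , b∈ , h) =
        Structured.impossible A A⊆X X≤A D≤ (proj₂ (B-units b∈)) h 4q²≤N K≤N N-large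
      from-pair : PopularPair → ⊥
      from-pair (a , b , a∈ , b∈ , dense) = from-bsg (balog-szemerédi-gowers X Y (proj₂ (B-units a∈)) (proj₂ (B-units b∈)) q 32≤q Y≤ 1≤X dense)
        where
        from-bsg : HasStableSubset X q → ⊥
        from-bsg (A , A⊆X , X≤A , D-bound) = from-structure A A⊆X X≤A
          (≤-trans (D-bound (differences A) differences⁻) (≤-reflexive (cong (_* # A) (sym Q-def)))) (popular-b A A⊆X)

-- Positive definite kernels on the additive group.

module PositiveDefiniteKernels (p : ℕ) .{{_ : NonZero p}} (p-prime : Prime p) where

  open import Data.Integer.Properties
  open FiniteSums
  open PrimeField p p-prime
  open Subsets p p-prime

  private
    interchange : ∀ a b c → a ℤ.* (b ℤ.* c) ≡ b ℤ.* (a ℤ.* c)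
    interchange = ℤ-Solver.solve-∀

  -- The Gram matrices (κ (gᵢ - gⱼ)) behave like inner products, and this is their Cauchy–Schwarz inequality.
  PositiveDefinite : (F → ℤ) → Set
  PositiveDefinite κ = ∀ n (g : Fin n → F) (w : Fin n → ℤ) →
    ∑ᶻ (λ i → w i ℤ.* κ (g i)) ℤ.* ∑ᶻ (λ i → w i ℤ.* κ (g i)) ℤ.≤
    κ 0# ℤ.* ∑ᶻ (λ i → ∑ᶻ λ j → (w i ℤ.* w j) ℤ.* κ (g i ⊖ g j))

  pd-cong : ∀ {κ κ′} → (∀ x → κ x ≡ κ′ x) → PositiveDefinite κ → PositiveDefinite κ′
  pd-cong {κ} {κ′} eq pd n g w = subst₂ ℤ._≤_ (cong₂ ℤ._*_ S S) (cong₂ ℤ._*_ (eq 0#)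
      (∑ᶻ-cong λ i → ∑ᶻ-cong λ j → cong (w i ℤ.* w j ℤ.*_) (eq (g i ⊖ g j)))) (pd n g w)
    where
    S = ∑ᶻ-cong λ i → cong (w i ℤ.*_) (eq (g i))

  pd-dilate : ∀ {κ} u → PositiveDefinite κ → PositiveDefinite (λ x → κ (x ⊗ u))
  pd-dilate {κ} u pd n g w = subst (∑ᶻ (λ i → w i ℤ.* κ (g i ⊗ u)) ℤ.* ∑ᶻ (λ i → w i ℤ.* κ (g i ⊗ u)) ℤ.≤_)
    (cong₂ ℤ._*_ (cong κ (solve 1 (λ u → con 0ℤ := con 0ℤ :* u) refl u))
      (∑ᶻ-cong λ i → ∑ᶻ-cong λ j → cong (λ z → (w i ℤ.* w j) ℤ.* κ z)
        (solve 3 (λ x y u → x :* u :- y :* u := (x :- y) :* u) refl (g i) (g j) u)))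
    (pd n (λ i → g i ⊗ u) w)

  𝟙ᶻ : Bool → ℤ
  𝟙ᶻ b = pos (𝟙 b)

  0≤𝟙ᶻ : ∀ b → 0ℤ ℤ.≤ 𝟙ᶻ b
  0≤𝟙ᶻ b = +≤+ z≤n

  𝟙ᶻ² : ∀ b → 𝟙ᶻ b ℤ.* 𝟙ᶻ b ≡ 𝟙ᶻ b
  𝟙ᶻ² true = refl
  𝟙ᶻ² false = refl

  ∑ᶻ-0≤ : ∀ {n} {f : Fin n → ℤ} → (∀ i → 0ℤ ℤ.≤ f i) → 0ℤ ℤ.≤ ∑ᶻ f
  ∑ᶻ-0≤ {n} {f} h = subst (ℤ._≤ ∑ᶻ f) zero-sum (∑ᶻ-mono h)
    where
    zero-sum : ∑ᶻ {n} (λ _ → 0ℤ) ≡ 0ℤ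
    zero-sum = ∑ᶻ-*ˡ 0ℤ (λ _ → 0ℤ)

  0≤-* : ∀ {i j} → 0ℤ ℤ.≤ i → 0ℤ ℤ.≤ j → 0ℤ ℤ.≤ i ℤ.* j
  0≤-* {pos m} {pos n} _ _ = subst (0ℤ ℤ.≤_) (pos-* m n) (+≤+ z≤n)

  *-monoˡ : ∀ {i j k} → 0ℤ ℤ.≤ i → j ℤ.≤ k → i ℤ.* j ℤ.≤ i ℤ.* k
  *-monoˡ {i} 0≤i = *-monoˡ-≤-nonNeg i {{nonNegative 0≤i}}

  -- Cauchy-Schwarz in `a` combines the inequalities of the single kernels, and their common value
  -- `c` at `0#` can be taken out of the sum. Indicators are their own squares, so that a weight
  -- remains in both factors.
  pd-sum : ∀ (B : Subset) (κ : F → F → ℤ) c → (∀ a → PositiveDefinite (κ a)) → (∀ a → κ a 0# ≡ c) →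
           PositiveDefinite (λ x → ∑ᶻ λ a → 𝟙ᶻ (B a) ℤ.* κ a x)
  pd-sum B κ c pd κ0 n g w = begin
    S ℤ.* S ≡⟨ cong₂ ℤ._*_ S-def S-def ⟩
    ∑ᶻ (λ a → b a ℤ.* (b a ℤ.* T a)) ℤ.* ∑ᶻ (λ a → b a ℤ.* (b a ℤ.* T a))
      ≤⟨ cauchy-schwarzᶻ b (λ a → b a ℤ.* T a) ⟩
    ∑ᶻ (λ a → b a ℤ.* b a) ℤ.* ∑ᶻ (λ a → (b a ℤ.* T a) ℤ.* (b a ℤ.* T a))
      ≡⟨ cong₂ ℤ._*_ (∑ᶻ-cong λ a → 𝟙ᶻ² (B a)) (∑ᶻ-cong λ a → trans (square (b a) (T a)) (cong (ℤ._* (T a ℤ.* T a)) (𝟙ᶻ² (B a)))) ⟩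
    ∑ᶻ b ℤ.* ∑ᶻ (λ a → b a ℤ.* (T a ℤ.* T a))
      ≤⟨ *-monoˡ (∑ᶻ-0≤ λ a → 0≤𝟙ᶻ (B a)) (∑ᶻ-mono λ a → *-monoˡ (0≤𝟙ᶻ (B a)) (bound a)) ⟩
    ∑ᶻ b ℤ.* ∑ᶻ (λ a → b a ℤ.* (c ℤ.* U a))
      ≡⟨ cong (∑ᶻ b ℤ.*_) (trans (∑ᶻ-cong λ a → interchange (b a) c (U a)) (∑ᶻ-*ˡ c _)) ⟩
    ∑ᶻ b ℤ.* (c ℤ.* ∑ᶻ (λ a → b a ℤ.* U a))
      ≡⟨ *-assoc (∑ᶻ b) c _ ⟨
    ∑ᶻ b ℤ.* c ℤ.* ∑ᶻ (λ a → b a ℤ.* U a)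
      ≡⟨ cong₂ ℤ._*_ (trans (sym (∑ᶻ-*ʳ c b)) (∑ᶻ-cong λ a → cong (b a ℤ.*_) (sym (κ0 a)))) U-sum ⟩
    ∑ᶻ (λ a → b a ℤ.* κ a 0#) ℤ.* ∑ᶻ (λ i → ∑ᶻ λ j → (w i ℤ.* w j) ℤ.* ∑ᶻ λ a → b a ℤ.* κ a (g i ⊖ g j)) ∎
    where
    open ≤-Reasoning
    b : F → ℤ
    b a = 𝟙ᶻ (B a)
    T U : F → ℤ
    T a = ∑ᶻ λ i → w i ℤ.* κ a (g i)
    U a = ∑ᶻ λ i → ∑ᶻ λ j → (w i ℤ.* w j) ℤ.* κ a (g i ⊖ g j)
    S = ∑ᶻ λ i → w i ℤ.* ∑ᶻ λ a → b a ℤ.* κ a (g i)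
    square : ∀ x y → (x ℤ.* y) ℤ.* (x ℤ.* y) ≡ (x ℤ.* x) ℤ.* (y ℤ.* y)
    square = ℤ-Solver.solve-∀
    bound : ∀ a → T a ℤ.* T a ℤ.≤ c ℤ.* U a
    bound a = subst (λ k → T a ℤ.* T a ℤ.≤ k ℤ.* U a) (κ0 a) (pd a n g w)
    S-def : S ≡ ∑ᶻ λ a → b a ℤ.* (b a ℤ.* T a)
    S-def = begin-equality
      ∑ᶻ (λ i → w i ℤ.* ∑ᶻ λ a → b a ℤ.* κ a (g i)) ≡⟨ ∑ᶻ-cong (λ i → sym (∑ᶻ-*ˡ (w i) _)) ⟩
      ∑ᶻ (λ i → ∑ᶻ λ a → w i ℤ.* (b a ℤ.* κ a (g i))) ≡⟨ ∑ᶻ-swap _ ⟩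
      ∑ᶻ (λ a → ∑ᶻ λ i → w i ℤ.* (b a ℤ.* κ a (g i))) ≡⟨ ∑ᶻ-cong (λ a → trans (∑ᶻ-cong λ i → interchange (w i) (b a) (κ a (g i))) (∑ᶻ-*ˡ (b a) _)) ⟩
      ∑ᶻ (λ a → b a ℤ.* T a) ≡⟨ ∑ᶻ-cong (λ a → trans (cong (ℤ._* T a) (sym (𝟙ᶻ² (B a)))) (*-assoc (b a) (b a) (T a))) ⟩
      ∑ᶻ (λ a → b a ℤ.* (b a ℤ.* T a)) ∎
    U-sum : ∑ᶻ (λ a → b a ℤ.* U a) ≡ ∑ᶻ (λ i → ∑ᶻ λ j → (w i ℤ.* w j) ℤ.* ∑ᶻ λ a → b a ℤ.* κ a (g i ⊖ g j))
    U-sum = begin-equality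
      ∑ᶻ (λ a → b a ℤ.* U a)
        ≡⟨ ∑ᶻ-cong (λ a → trans (sym (∑ᶻ-*ˡ (b a) _))
                                (∑ᶻ-cong λ i → sym (∑ᶻ-*ˡ (b a) _))) ⟩
      ∑ᶻ (λ a → ∑ᶻ λ i → ∑ᶻ λ j → b a ℤ.* ((w i ℤ.* w j) ℤ.* κ a (g i ⊖ g j)))
        ≡⟨ trans (∑ᶻ-swap _)
                 (∑ᶻ-cong λ i → ∑ᶻ-swap _) ⟩
      ∑ᶻ (λ i → ∑ᶻ λ j → ∑ᶻ λ a → b a ℤ.* ((w i ℤ.* w j) ℤ.* κ a (g i ⊖ g j)))
        ≡⟨ ∑ᶻ-cong (λ i → ∑ᶻ-cong λ j → trans (∑ᶻ-cong λ a → interchange (b a) (w i ℤ.* w j) (κ a (g i ⊖ g j)))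
                                              (∑ᶻ-*ˡ (w i ℤ.* w j) _)) ⟩
      ∑ᶻ (λ i → ∑ᶻ λ j → (w i ℤ.* w j) ℤ.* ∑ᶻ λ a → b a ℤ.* κ a (g i ⊖ g j)) ∎

  ∑ᶻ-shift : ∀ c (f : F → ℤ) → ∑ᶻ (λ x → f (x ⊕ c)) ≡ ∑ᶻ f
  ∑ᶻ-shift c = ∑ᶻ-reindex (_⊕ c) (_⊖ c) (λ x → ⊕-⊖ x c) (λ x → ⊖-⊕ x c)

  module Autocorrelation (φ : F → ℤ) where

    K : F → ℤ
    K v = ∑ᶻ λ z → φ z ℤ.* φ (z ⊕ v)

    -- `K (x)` is the inner product of `φ` with its translate by `x`, and `K (x - y)` that of two
    -- translates, so this is Cauchy-Schwarz for `φ` and a combination of its translates.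
    pd-K : PositiveDefinite K
    pd-K n g w = begin
      ∑ᶻ (λ i → w i ℤ.* K (g i)) ℤ.* ∑ᶻ (λ i → w i ℤ.* K (g i)) ≡⟨ cong₂ ℤ._*_ S-def S-def ⟩
      ∑ᶻ (λ z → φ z ℤ.* G z) ℤ.* ∑ᶻ (λ z → φ z ℤ.* G z) ≤⟨ cauchy-schwarzᶻ φ G ⟩
      ∑ᶻ (λ z → φ z ℤ.* φ z) ℤ.* ∑ᶻ (λ z → G z ℤ.* G z) ≡⟨ cong₂ ℤ._*_ K0 GG ⟩
      K 0# ℤ.* ∑ᶻ (λ i → ∑ᶻ λ j → (w i ℤ.* w j) ℤ.* K (g i ⊖ g j)) ∎
      where
      open ≤-Reasoning
      G : F → ℤ
      G z = ∑ᶻ λ i → w i ℤ.* φ (z ⊕ g i)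
      S-def : ∑ᶻ (λ i → w i ℤ.* K (g i)) ≡ ∑ᶻ (λ z → φ z ℤ.* G z)
      S-def = begin-equality
        ∑ᶻ (λ i → w i ℤ.* K (g i)) ≡⟨ ∑ᶻ-cong (λ i → sym (∑ᶻ-*ˡ (w i) _)) ⟩
        ∑ᶻ (λ i → ∑ᶻ λ z → w i ℤ.* (φ z ℤ.* φ (z ⊕ g i))) ≡⟨ ∑ᶻ-swap _ ⟩
        ∑ᶻ (λ z → ∑ᶻ λ i → w i ℤ.* (φ z ℤ.* φ (z ⊕ g i))) ≡⟨ ∑ᶻ-cong (λ z → trans (∑ᶻ-cong λ i → interchange (w i) (φ z) (φ (z ⊕ g i))) (∑ᶻ-*ˡ (φ z) _)) ⟩
        ∑ᶻ (λ z → φ z ℤ.* G z) ∎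
      K0 : ∑ᶻ (λ z → φ z ℤ.* φ z) ≡ K 0#
      K0 = ∑ᶻ-cong λ z → cong (λ v → φ z ℤ.* φ v) (solve 1 (λ z → z := z :+ con 0ℤ) refl z)
      regroup : ∀ a b c d → (a ℤ.* b) ℤ.* (c ℤ.* d) ≡ (a ℤ.* c) ℤ.* (d ℤ.* b)
      regroup = ℤ-Solver.solve-∀
      correlate : ∀ i j → ∑ᶻ (λ z → φ (z ⊕ g j) ℤ.* φ (z ⊕ g i)) ≡ K (g i ⊖ g j)
      correlate i j = trans (sym (∑ᶻ-shift (⊝ g j) (λ z → φ (z ⊕ g j) ℤ.* φ (z ⊕ g i))))
        (∑ᶻ-cong λ z → cong₂ (λ u v → φ u ℤ.* φ v) (⊕-⊖ z (g j))
          (solve 3 (λ z x y → (z :- y) :+ x := z :+ (x :- y)) refl z (g i) (g j)))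
      GG : ∑ᶻ (λ z → G z ℤ.* G z) ≡ ∑ᶻ (λ i → ∑ᶻ λ j → (w i ℤ.* w j) ℤ.* K (g i ⊖ g j))
      GG = begin-equality
        ∑ᶻ (λ z → G z ℤ.* G z)
          ≡⟨ ∑ᶻ-cong (λ z → trans (sym (∑ᶻ-× _ _))
               (∑ᶻ-cong λ i → ∑ᶻ-cong λ j → regroup (w i) (φ (z ⊕ g i)) (w j) (φ (z ⊕ g j)))) ⟩
        ∑ᶻ (λ z → ∑ᶻ λ i → ∑ᶻ λ j → (w i ℤ.* w j) ℤ.* (φ (z ⊕ g j) ℤ.* φ (z ⊕ g i)))
          ≡⟨ trans (∑ᶻ-swap _)
                   (∑ᶻ-cong λ i → ∑ᶻ-swap _) ⟩
        ∑ᶻ (λ i → ∑ᶻ λ j → ∑ᶻ λ z → (w i ℤ.* w j) ℤ.* (φ (z ⊕ g j) ℤ.* φ (z ⊕ g i)))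
          ≡⟨ ∑ᶻ-cong (λ i → ∑ᶻ-cong λ j → trans (∑ᶻ-*ˡ (w i ℤ.* w j) _) (cong (w i ℤ.* w j ℤ.*_) (correlate i j))) ⟩
        ∑ᶻ (λ i → ∑ᶻ λ j → (w i ℤ.* w j) ℤ.* K (g i ⊖ g j)) ∎

    module _ (B : Subset) where

      -- Dilation by the differences `s - t` of a block makes each value a sum of squares and, once
      -- `φ` has mean zero, confines the mass to the diagonal `s = t`.
      κ₀ : F → ℤ
      κ₀ y = ∑ᶻ λ t → 𝟙ᶻ (B t) ℤ.* ∑ᶻ λ s → 𝟙ᶻ (B s) ℤ.* K (y ⊗ (s ⊖ t))

      private
        b : F → ℤ
        b t = 𝟙ᶻ (B t)

        zero-⊗ : ∀ u → 0# ⊗ u ≡ 0#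
        zero-⊗ u = solve 1 (λ u → con 0ℤ :* u := con 0ℤ) refl u

      pd-κ₀ : PositiveDefinite κ₀
      pd-κ₀ = pd-sum B (λ t y → ∑ᶻ λ s → b s ℤ.* K (y ⊗ (s ⊖ t))) (∑ᶻ λ s → b s ℤ.* K 0#)
        (λ t → pd-sum B (λ s y → K (y ⊗ (s ⊖ t))) (K 0#) (λ s → pd-dilate {K} (s ⊖ t) pd-K) (λ s → cong K (zero-⊗ (s ⊖ t))))
        (λ t → ∑ᶻ-cong λ s → cong (λ v → b s ℤ.* K v) (zero-⊗ (s ⊖ t)))

      κ₀-zero : κ₀ 0# ≡ ∑ᶻ b ℤ.* (∑ᶻ b ℤ.* K 0#)
      κ₀-zero = begin
        κ₀ 0# ≡⟨ ∑ᶻ-cong (λ t → cong (b t ℤ.*_) (∑ᶻ-cong λ s → cong (λ v → b s ℤ.* K v) (zero-⊗ (s ⊖ t)))) ⟩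
        ∑ᶻ (λ t → b t ℤ.* ∑ᶻ λ s → b s ℤ.* K 0#) ≡⟨ ∑ᶻ-*ʳ (∑ᶻ λ s → b s ℤ.* K 0#) b ⟩
        ∑ᶻ b ℤ.* ∑ᶻ (λ s → b s ℤ.* K 0#) ≡⟨ cong (∑ᶻ b ℤ.*_) (∑ᶻ-*ʳ (K 0#) b) ⟩
        ∑ᶻ b ℤ.* (∑ᶻ b ℤ.* K 0#) ∎
        where open ≡-Reasoning

      κ₀-squares : ∀ y → κ₀ y ≡ ∑ᶻ λ z → ∑ᶻ (λ t → b t ℤ.* φ (z ⊕ y ⊗ t)) ℤ.* ∑ᶻ (λ t → b t ℤ.* φ (z ⊕ y ⊗ t))
      κ₀-squares y = begin
        ∑ᶻ (λ t → b t ℤ.* ∑ᶻ λ s → b s ℤ.* K (y ⊗ (s ⊖ t)))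
          ≡⟨ ∑ᶻ-cong (λ t → trans (sym (∑ᶻ-*ˡ (b t) _)) (∑ᶻ-cong λ s →
               trans (sym (*-assoc (b t) (b s) _)) (trans (cong (b t ℤ.* b s ℤ.*_) (correlate t s))
                 (sym (∑ᶻ-*ˡ (b t ℤ.* b s) _))))) ⟩
        ∑ᶻ (λ t → ∑ᶻ λ s → ∑ᶻ λ z → (b t ℤ.* b s) ℤ.* (φ (z ⊕ y ⊗ t) ℤ.* φ (z ⊕ y ⊗ s)))
          ≡⟨ trans (∑ᶻ-cong λ t → ∑ᶻ-swap _)
                   (∑ᶻ-swap _) ⟩
        ∑ᶻ (λ z → ∑ᶻ λ t → ∑ᶻ λ s → (b t ℤ.* b s) ℤ.* (φ (z ⊕ y ⊗ t) ℤ.* φ (z ⊕ y ⊗ s)))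
          ≡⟨ ∑ᶻ-cong (λ z → trans (∑ᶻ-cong λ t → ∑ᶻ-cong λ s → regroup (b t) (b s) (φ (z ⊕ y ⊗ t)) (φ (z ⊕ y ⊗ s)))
                                  (∑ᶻ-× _ _)) ⟩
        ∑ᶻ (λ z → ∑ᶻ (λ t → b t ℤ.* φ (z ⊕ y ⊗ t)) ℤ.* ∑ᶻ (λ t → b t ℤ.* φ (z ⊕ y ⊗ t))) ∎
        where
        open ≡-Reasoning
        regroup : ∀ a b c d → (a ℤ.* b) ℤ.* (c ℤ.* d) ≡ (a ℤ.* c) ℤ.* (b ℤ.* d)
        regroup = ℤ-Solver.solve-∀
        correlate : ∀ t s → K (y ⊗ (s ⊖ t)) ≡ ∑ᶻ λ z → φ (z ⊕ y ⊗ t) ℤ.* φ (z ⊕ y ⊗ s)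
        correlate t s = trans (sym (∑ᶻ-shift (y ⊗ t) (λ z → φ z ℤ.* φ (z ⊕ y ⊗ (s ⊖ t)))))
          (∑ᶻ-cong λ z → cong (λ v → φ (z ⊕ y ⊗ t) ℤ.* φ v)
            (solve 4 (λ z y t s → (z :+ y :* t) :+ y :* (s :- t) := z :+ y :* s) refl z y t s))

      0≤κ₀ : ∀ y → 0ℤ ℤ.≤ κ₀ y
      0≤κ₀ y = subst (0ℤ ℤ.≤_) (sym (κ₀-squares y)) (∑ᶻ-0≤ λ z → square-nonneg (∑ᶻ λ t → b t ℤ.* φ (z ⊕ y ⊗ t)))

      module _ (mean-zero : ∑ᶻ φ ≡ 0ℤ) where

        ∑-K : ∑ᶻ K ≡ 0ℤ
        ∑-K = begin
          ∑ᶻ (λ v → ∑ᶻ λ z → φ z ℤ.* φ (z ⊕ v)) ≡⟨ ∑ᶻ-swap _ ⟩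
          ∑ᶻ (λ z → ∑ᶻ λ v → φ z ℤ.* φ (z ⊕ v)) ≡⟨ ∑ᶻ-cong (λ z → trans (∑ᶻ-*ˡ (φ z) _) (cong (φ z ℤ.*_) (trans
              (∑ᶻ-reindex (z ⊕_) (_⊖ z) (λ x → solve 2 (λ x z → z :+ (x :- z) := x) refl x z)
                                         (λ x → solve 2 (λ x z → (z :+ x) :- z := x) refl x z) φ) mean-zero))) ⟩
          ∑ᶻ (λ z → φ z ℤ.* 0ℤ) ≡⟨ ∑ᶻ-*ʳ 0ℤ φ ⟩
          ∑ᶻ φ ℤ.* 0ℤ ≡⟨ *-zeroʳ (∑ᶻ φ) ⟩
          0ℤ ∎
          where open ≡-Reasoning

        0≤K0 : 0ℤ ℤ.≤ K 0#
        0≤K0 = ∑ᶻ-0≤ λ z → subst (λ v → 0ℤ ℤ.≤ φ z ℤ.* φ v) (solve 1 (λ z → z := z :+ con 0ℤ) refl z) (square-nonneg (φ z))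

        -- For a unit `u` the sum equals that of `K`, which is `(∑ φ)² = 0`; for `u = 0#` every term
        -- is `K 0#`.
        ∑-dilated-K : ∀ u → ∑ᶻ (λ y → K (y ⊗ u)) ≡ pos p ℤ.* K 0# ℤ.* 𝟙ᶻ (does (u Fin.≟ 0#))
        ∑-dilated-K u with u Fin.≟ 0#
        ... | yes refl = trans (∑ᶻ-cong λ y → trans (cong K (solve 1 (λ y → y :* con 0ℤ := con 0ℤ) refl y)) (sym (*-identityˡ (K 0#))))
                        (trans (∑ᶻ-*ʳ (K 0#) _) (trans (cong (ℤ._* K 0#) count) (sym (*-identityʳ (pos p ℤ.* K 0#)))))
          where
          count : ∑ᶻ {p} (λ _ → pos 1) ≡ pos p
          count = trans (sym (pos-∑ {p} (λ _ → 1))) (cong pos (trans (∑-const p 1) (ℕ.*-identityʳ p)))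
        ... | no u≢0 = trans (∑ᶻ-unit (inverse u u≢0)) (trans ∑-K (sym (*-zeroʳ (pos p ℤ.* K 0#))))
          where
          ∑ᶻ-unit : (∃ λ v → u ⊗ v ≡ 1#) → ∑ᶻ (λ y → K (y ⊗ u)) ≡ ∑ᶻ K
          ∑ᶻ-unit (v , uv) = ∑ᶻ-reindex (_⊗ u) (_⊗ v) (⊗-cancel (trans (⊗-comm v u) uv)) (⊗-cancel uv) K

        -- Only the diagonal `s = t` survives, which saves a factor `# B` against the trivial bound
        -- `p * κ₀ 0#`.
        ∑-κ₀ : ∑ᶻ κ₀ ℤ.≤ pos p ℤ.* K 0# ℤ.* ∑ᶻ b
        ∑-κ₀ = begin
          ∑ᶻ (λ y → ∑ᶻ λ t → b t ℤ.* ∑ᶻ λ s → b s ℤ.* K (y ⊗ (s ⊖ t)))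
            ≡⟨ trans (∑ᶻ-swap _)
                     (∑ᶻ-cong λ t → trans (∑ᶻ-*ˡ (b t) _) (cong (b t ℤ.*_)
                       (trans (∑ᶻ-swap _) (∑ᶻ-cong λ s → trans (∑ᶻ-*ˡ (b s) _)
                         (trans (cong (b s ℤ.*_) (∑-dilated-K (s ⊖ t))) (interchange (b s) C (δ s t))))))) ⟩
          ∑ᶻ (λ t → b t ℤ.* ∑ᶻ λ s → C ℤ.* (b s ℤ.* δ s t))
            ≡⟨ ∑ᶻ-cong (λ t → trans (cong (b t ℤ.*_) (∑ᶻ-*ˡ C _)) (interchange (b t) C (∑ᶻ λ s → b s ℤ.* δ s t))) ⟩
          ∑ᶻ (λ t → C ℤ.* (b t ℤ.* ∑ᶻ λ s → b s ℤ.* δ s t))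
            ≡⟨ ∑ᶻ-*ˡ C _ ⟩
          C ℤ.* ∑ᶻ (λ t → b t ℤ.* ∑ᶻ λ s → b s ℤ.* δ s t)
            ≤⟨ *-monoˡ {C} (0≤-* {pos p} {K 0#} (+≤+ z≤n) 0≤K0) (∑ᶻ-mono λ t → ≤-trans (*-monoˡ (0≤𝟙ᶻ (B t)) (diagonal t)) (≤-reflexive (*-identityʳ (b t)))) ⟩
          C ℤ.* ∑ᶻ b ∎
          where
          open ≤-Reasoning
          C = pos p ℤ.* K 0#
          δ : F → F → ℤ
          δ s t = 𝟙ᶻ (does (s ⊖ t Fin.≟ 0#))
          diagonal : ∀ t → ∑ᶻ (λ s → b s ℤ.* δ s t) ℤ.≤ pos 1
          diagonal t = subst (ℤ._≤ pos 1) (trans (pos-∑ (λ s → 𝟙 (B s) * 𝟙 (does (s ⊖ t Fin.≟ 0#)))) (∑ᶻ-cong λ s → pos-* (𝟙 (B s)) (𝟙 (does (s ⊖ t Fin.≟ 0#))))) (+≤+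
            (∑-subsingleton (λ s → 𝟙 (B s) * 𝟙 (does (s ⊖ t Fin.≟ 0#))) (λ s → ℕ.*-mono-≤ (𝟙≤1 (B s)) (𝟙≤1 (does (s ⊖ t Fin.≟ 0#))))
              λ s u hs hu → trans (on-diagonal s hs) (sym (on-diagonal u hu))))
            where
            on-diagonal : ∀ s → 1 ≤ 𝟙 (B s) * 𝟙 (does (s ⊖ t Fin.≟ 0#)) → s ≡ t
            on-diagonal s h = ⊖≡0⇒≡ (does⁻ (s ⊖ t Fin.≟ 0#) (proj₂ (𝟙*𝟙⁻ (B s) _ h)))

-- Admissible kernels and their level sets.

module LevelSets (p : ℕ) .{{_ : NonZero p}} (p-prime : Prime p) where

  open import Data.Fin using (_↑ˡ_; _↑ʳ_; combine; remQuot)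
  open import Data.Nat.Properties
  open FiniteSums
  open PrimeField p p-prime
  open Subsets p p-prime
  open BalogSzemerédiGowers p p-prime
  open ApproximateSubrings p p-prime
  open PositiveDefiniteKernels p p-prime

  -- The maximum at `0#` gives `∑ κ ≤ p * κ 0#`; `mass` improves this by the factor `N`, which keeps
  -- the level sets sparse.
  record Admissible (N : ℕ) (κ : F → ℕ) : Set where
    field
      pd : PositiveDefinite (λ x → pos (κ x))
      positive : 1 ≤ κ 0#
      mass : N * ∑ κ ≤ p * κ 0#

  step : Subset → (F → ℕ) → F → ℕ
  step B κ x = ∑ λ a → 𝟙 (B a) * κ (x ⊗ a)

  step-zero : ∀ B κ → step B κ 0# ≡ # B * κ 0#
  step-zero B κ = trans (∑-cong λ a → cong (λ z → 𝟙 (B a) * κ z) (solve 1 (λ a → con 0ℤ :* a := con 0ℤ) refl a)) (∑-*ʳ (κ 0#) _)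

  -- The summands are dilates of one kernel by units, with the same total and the same value at
  -- `0#`, so both sides of `mass` grow by the factor `# B`.
  admissible-step : ∀ {N κ} B → (∀ {a} → a ∈ B → ∃ λ u → a ⊗ u ≡ 1#) → 1 ≤ # B → Admissible N κ → Admissible N (step B κ)
  admissible-step {N} {κ} B units 1≤B adm = record
    { pd = pd-cong {λ x → ∑ᶻ λ a → 𝟙ᶻ (B a) ℤ.* pos (κ (x ⊗ a))}
        (λ x → sym (trans (pos-∑ (λ a → 𝟙 (B a) * κ (x ⊗ a))) (∑ᶻ-cong λ a → ℤ.pos-* (𝟙 (B a)) (κ (x ⊗ a)))))
        (pd-sum B (λ a x → pos (κ (x ⊗ a))) (pos (κ 0#)) (λ a → pd-dilate {λ x → pos (κ x)} a pd)
          (λ a → cong (pos ∘ κ) (solve 1 (λ a → con 0ℤ :* a := con 0ℤ) refl a)))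
    ; positive = ≤-trans (*-mono-≤ 1≤B positive) (≤-reflexive (sym (step-zero B κ)))
    ; mass = begin
        N * ∑ (step B κ) ≡⟨ cong (N *_) total ⟩
        N * (# B * ∑ κ) ≡⟨ *-swap N (# B) (∑ κ) ⟩
        # B * (N * ∑ κ) ≤⟨ *-monoʳ-≤ (# B) mass ⟩
        # B * (p * κ 0#) ≡⟨ *-swap (# B) p (κ 0#) ⟩
        p * (# B * κ 0#) ≡⟨ cong (p *_) (step-zero B κ) ⟨
        p * step B κ 0# ∎ }
    where
    open Admissible adm
    open ≤-Reasoning
    dilated : ∀ a → 𝟙 (B a) * ∑ (λ x → κ (x ⊗ a)) ≡ 𝟙 (B a) * ∑ κ
    dilated a with B a in a∈
    ... | false = refl
    ... | true = cong (1 *_) (∑-dilate (proj₂ (units a∈)) κ)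
    total : ∑ (step B κ) ≡ # B * ∑ κ
    total = trans (∑-swap _) (trans (∑-cong λ a → trans (∑-*ˡ (𝟙 (B a)) _) (dilated a)) (∑-*ʳ (∑ κ) _))

  ∑-++ : ∀ m {n} (f : Fin (m + n) → ℕ) → ∑ f ≡ ∑ (λ i → f (i ↑ˡ n)) + ∑ (λ j → f (m ↑ʳ j))
  ∑-++ zero f = cong (_+ ∑ f) (sym ∑-empty)
  ∑-++ (suc m) {n} f = trans (∑-suc f) (trans (cong (f zero +_) (∑-++ m (f ∘ suc)))
    (trans (sym (+-assoc (f zero) _ _)) (cong (_+ ∑ (λ j → f (suc (m ↑ʳ j)))) (sym (∑-suc (λ i → f (i ↑ˡ n)))))))

  ∑-combine : ∀ {m n} (f : Fin (m * n) → ℕ) → ∑ f ≡ ∑ λ i → ∑ λ j → f (combine {m} {n} i j)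
  ∑-combine {zero} f = trans ∑-empty (sym ∑-empty)
  ∑-combine {suc m} {n} f = trans (∑-++ n f) (trans (cong (∑ (λ j → f (j ↑ˡ m * n)) +_) (∑-combine {m} {n} (λ i → f (n ↑ʳ i))))
    (sym (∑-suc (λ i → ∑ λ j → f (combine {suc m} {n} i j)))))

  pd-ℕ : ∀ {κ : F → ℕ} → PositiveDefinite (λ x → pos (κ x)) → ∀ n (g : Fin n → F) (w : Fin n → ℕ) →
    ∑ (λ i → w i * κ (g i)) * ∑ (λ i → w i * κ (g i)) ≤ κ 0# * ∑ (λ i → ∑ λ j → (w i * w j) * κ (g i ⊖ g j))
  pd-ℕ {κ} pd n g w = ℤ.drop‿+≤+ (subst₂ ℤ._≤_
    (trans (cong₂ ℤ._*_ left left) (sym (ℤ.pos-* S S)))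
    (trans (cong (pos (κ 0#) ℤ.*_) right) (sym (ℤ.pos-* (κ 0#) _)))
    (pd n g (λ i → pos (w i))))
    where
    S = ∑ (λ i → w i * κ (g i))
    left : ∑ᶻ (λ i → pos (w i) ℤ.* pos (κ (g i))) ≡ pos S
    left = sym (trans (pos-∑ (λ i → w i * κ (g i))) (∑ᶻ-cong λ i → ℤ.pos-* (w i) (κ (g i))))
    right : ∑ᶻ (λ i → ∑ᶻ λ j → (pos (w i) ℤ.* pos (w j)) ℤ.* pos (κ (g i ⊖ g j))) ≡ pos (∑ (λ i → ∑ λ j → (w i * w j) * κ (g i ⊖ g j)))
    right = sym (trans (pos-∑ (λ i → ∑ λ j → (w i * w j) * κ (g i ⊖ g j))) (∑ᶻ-cong λ i →
      trans (pos-∑ (λ j → (w i * w j) * κ (g i ⊖ g j))) (∑ᶻ-cong λ j →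
      trans (ℤ.pos-* (w i * w j) (κ (g i ⊖ g j))) (cong (ℤ._* pos (κ (g i ⊖ g j))) (ℤ.pos-* (w i) (w j))))))

  -- `PositiveDefinite` speaks of families over `Fin n`; here the points are indexed by pairs, coded
  -- in `Fin (p * p)`.
  pd-pairs : ∀ {κ : F → ℕ} → PositiveDefinite (λ x → pos (κ x)) → (g : F → F → F) (w : F → F → ℕ) →
    ∑ (λ a → ∑ λ x → w a x * κ (g a x)) * ∑ (λ a → ∑ λ x → w a x * κ (g a x)) ≤
    κ 0# * ∑ (λ a → ∑ λ x → ∑ λ b → ∑ λ y → (w a x * w b y) * κ (g a x ⊖ g b y))
  pd-pairs {κ} pd g w = subst₂ (λ s t → s * s ≤ κ 0# * t) (pairs (λ a x → w a x * κ (g a x)))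
    (trans (pairs (λ a x → ∑ λ j → (w a x * w′ j) * κ (g a x ⊖ g′ j)))
      (∑-cong λ a → ∑-cong λ x → pairs (λ b y → (w a x * w b y) * κ (g a x ⊖ g b y))))
    (pd-ℕ {κ} pd (p * p) g′ w′)
    where
    g′ : Fin (p * p) → F
    g′ i = g (proj₁ (remQuot {p} p i)) (proj₂ (remQuot {p} p i))
    w′ : Fin (p * p) → ℕ
    w′ i = w (proj₁ (remQuot {p} p i)) (proj₂ (remQuot {p} p i))
    pairs : (f : F → F → ℕ) → ∑ (λ i → f (proj₁ (remQuot {p} p i)) (proj₂ (remQuot {p} p i))) ≡ ∑ λ a → ∑ λ x → f a x
    pairs f = trans (∑-combine {p} {p} (λ i → f (proj₁ (remQuot {p} p i)) (proj₂ (remQuot {p} p i))))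
      (∑-cong λ a → ∑-cong λ x → cong (λ q → f (proj₁ q) (proj₂ q)) (Fin.remQuot-combine a x))

  level : (F → ℕ) → ℕ → Subset
  level κ τ x = does (κ 0# ≤? τ * κ x)

  module _ {N : ℕ} {κ : F → ℕ} (adm : Admissible N κ) where
    open Admissible adm

    private
      instance
        κ0-nonZero : NonZero (κ 0#)
        κ0-nonZero = >-nonZero positive

    maximum-at-0 : ∀ v → κ v ≤ κ 0#
    maximum-at-0 v = square-cancel-≤ {κ v} {κ 0#} (subst₂ _≤_ (cong₂ _*_ left left) (cong (κ 0# *_) right)
      (pd-ℕ {κ} pd 1 (λ _ → v) (λ _ → 1)))
      where
      left : ∑ {1} (λ _ → 1 * κ v) ≡ κ v
      left = trans (∑-const 1 (1 * κ v)) (trans (*-identityˡ _) (*-identityˡ _))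
      right : ∑ {1} (λ _ → ∑ {1} λ _ → (1 * 1) * κ (v ⊖ v)) ≡ κ 0#
      right = trans (∑-const 1 _) (trans (*-identityˡ _) (trans (∑-const 1 _) (trans (*-identityˡ _) (trans (*-identityˡ _) (cong κ (⊖-self v))))))

    level-size : ∀ τ → N * # (level κ τ) ≤ τ * p
    level-size τ = *-cancelʳ-≤ _ _ (κ 0#) (begin
      N * # (level κ τ) * κ 0# ≡⟨ *-assoc N (# (level κ τ)) (κ 0#) ⟩
      N * (# (level κ τ) * κ 0#) ≤⟨ *-monoʳ-≤ N (#-bound {level κ τ} (λ x → τ * κ x) (λ {x} → does⁻ (κ 0# ≤? τ * κ x))) ⟩
      N * ∑ (λ x → τ * κ x) ≡⟨ cong (N *_) (∑-*ˡ τ κ) ⟩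
      N * (τ * ∑ κ) ≡⟨ *-swap N τ (∑ κ) ⟩
      τ * (N * ∑ κ) ≤⟨ *-monoʳ-≤ τ mass ⟩
      τ * (p * κ 0#) ≡⟨ *-assoc τ p (κ 0#) ⟨
      τ * p * κ 0# ∎)
      where
      open ≤-Reasoning

    -- For the points `x a` with `x` in `X′` and `a` in `B`, the mean of `κ` is at least `κ 0# / τ`,
    -- so by positive definiteness the mean of `κ (x a - y b)` is at least `κ 0# / τ²`. Values below
    -- half of this contribute at most half, and the others are at most `κ 0#`, so they make up a
    -- proportion of at least `1 / (2 τ²)`.
    level-hereditary : ∀ B τ X′ → X′ ⊆ level (step B κ) τ →
      # B * # B * (# X′ * # X′) ≤ 2 * (τ * τ) * ∑ λ b → 𝟙 (B b) * ∑ λ a → 𝟙 (B a) * energy X′ (level κ (2 * (τ * τ))) a b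
    level-hereditary B τ X′ X′⊆ = *-cancelʳ-≤ M (2 * τ² * E) (κ 0# * κ 0#) {{m*n≢0 (κ 0#) (κ 0#)}} (+-cancelʳ-≤ (M * (κ 0# * κ 0#)) _ _ (begin
      M * (κ 0# * κ 0#) + M * (κ 0# * κ 0#) ≡⟨ e₁ (# B) (# X′) (κ 0#) ⟩
      2 * ((# X′ * (# B * κ 0#)) * (# X′ * (# B * κ 0#))) ≤⟨ *-monoʳ-≤ 2 (*-mono-≤ first-moment first-moment) ⟩
      2 * ((τ * S₁) * (τ * S₁)) ≡⟨ e₂ τ S₁ ⟩
      2 * τ² * (S₁ * S₁) ≤⟨ *-monoʳ-≤ (2 * τ²) (pd-pairs {κ} pd (λ a x → x ⊗ a) w) ⟩
      2 * τ² * (κ 0# * S₂) ≡⟨ *-swap (2 * τ²) (κ 0#) S₂ ⟩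
      κ 0# * (2 * τ² * S₂) ≤⟨ *-monoʳ-≤ (κ 0#) second-moment ⟩
      κ 0# * (2 * τ² * κ 0# * E + M * κ 0#) ≡⟨ e₄ (κ 0#) (2 * τ²) E M ⟩
      2 * τ² * E * (κ 0# * κ 0#) + M * (κ 0# * κ 0#) ∎))
      where
      open ≤-Reasoning
      τ² = τ * τ
      Y = level κ (2 * τ²)
      M = # B * # B * (# X′ * # X′)
      E = ∑ λ b → 𝟙 (B b) * ∑ λ a → 𝟙 (B a) * energy X′ Y a b
      w : F → F → ℕ
      w a x = 𝟙 (B a) * 𝟙 (X′ x)
      S₁ = ∑ λ a → ∑ λ x → w a x * κ (x ⊗ a)
      S₂ = ∑ λ a → ∑ λ x → ∑ λ b → ∑ λ y → (w a x * w b y) * κ (x ⊗ a ⊖ y ⊗ b)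
      e₁ : ∀ b x k → b * b * (x * x) * (k * k) + b * b * (x * x) * (k * k) ≡ 2 * ((x * (b * k)) * (x * (b * k)))
      e₁ = solve-∀
      e₂ : ∀ t s → 2 * ((t * s) * (t * s)) ≡ 2 * (t * t) * (s * s)
      e₂ = solve-∀
      e₄ : ∀ k t E M → k * (t * k * E + M * k) ≡ t * E * (k * k) + M * (k * k)
      e₄ = solve-∀
      S₁-def : S₁ ≡ ∑ λ x → 𝟙 (X′ x) * step B κ x
      S₁-def = trans (∑-swap _) (∑-cong λ x →
        trans (∑-cong λ a → trans (cong (_* κ (x ⊗ a)) (*-comm (𝟙 (B a)) (𝟙 (X′ x)))) (*-assoc (𝟙 (X′ x)) (𝟙 (B a)) (κ (x ⊗ a))))
              (∑-*ˡ (𝟙 (X′ x)) _))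
      first-moment : # X′ * (# B * κ 0#) ≤ τ * S₁
      first-moment = begin
        # X′ * (# B * κ 0#) ≡⟨ cong (# X′ *_) (step-zero B κ) ⟨
        # X′ * step B κ 0# ≤⟨ #-bound {X′} (λ x → 𝟙 (X′ x) * (τ * step B κ x)) member ⟩
        ∑ (λ x → 𝟙 (X′ x) * (τ * step B κ x)) ≡⟨ ∑-weighted X′ τ (step B κ) ⟩
        τ * ∑ (λ x → 𝟙 (X′ x) * step B κ x) ≡⟨ cong (τ *_) S₁-def ⟨
        τ * S₁ ∎
        where
        member : ∀ {x} → x ∈ X′ → step B κ 0# ≤ 𝟙 (X′ x) * (τ * step B κ x)
        member {x} x∈ = ≤-trans (does⁻ (step B κ 0# ≤? τ * step B κ x) (X′⊆ x∈))
          (≤-reflexive (sym (trans (cong (_* (τ * step B κ x)) (𝟙-true x∈)) (*-identityˡ _))))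
      pointwise : ∀ v → 2 * τ² * κ v ≤ 2 * τ² * κ 0# * 𝟙 (Y v) + κ 0#
      pointwise v = by-cases (κ 0# ≤? 2 * τ² * κ v) (maximum-at-0 v)
        where
        by-cases : ∀ {k m} (d : Dec (m ≤ 2 * τ² * k)) → k ≤ m → 2 * τ² * k ≤ 2 * τ² * m * 𝟙 (does d) + m
        by-cases {k} {m} (yes _) k≤m = ≤-trans (*-monoʳ-≤ (2 * τ²) k≤m) (≤-trans (≤-reflexive (sym (*-identityʳ (2 * τ² * m)))) (m≤m+n _ m))
        by-cases {k} {m} (no h) _ = ≤-trans (<⇒≤ (≰⇒> h)) (m≤n+m m _)
      second-moment : 2 * τ² * S₂ ≤ 2 * τ² * κ 0# * E + M * κ 0#
      second-moment = begin
        2 * τ² * S₂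
          ≡⟨ trans (sym (∑-*ˡ (2 * τ²) _)) (∑-cong λ a → trans (sym (∑-*ˡ (2 * τ²) _)) (∑-cong λ x →
               trans (sym (∑-*ˡ (2 * τ²) _)) (∑-cong λ b → trans (sym (∑-*ˡ (2 * τ²) _)) (∑-cong λ y →
               *-swap (2 * τ²) (w a x * w b y) (κ (x ⊗ a ⊖ y ⊗ b)))))) ⟩
        ∑ (λ a → ∑ λ x → ∑ λ b → ∑ λ y → (w a x * w b y) * (2 * τ² * κ (x ⊗ a ⊖ y ⊗ b)))
          ≤⟨ ∑-mono (λ a → ∑-mono λ x → ∑-mono λ b → ∑-mono λ y → *-monoʳ-≤ (w a x * w b y) (pointwise (x ⊗ a ⊖ y ⊗ b))) ⟩
        ∑ (λ a → ∑ λ x → ∑ λ b → ∑ λ y → (w a x * w b y) * (2 * τ² * κ 0# * 𝟙 (Y (x ⊗ a ⊖ y ⊗ b)) + κ 0#))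
          ≡⟨ ∑-cong (λ a → trans (∑-cong λ x → trans (∑-cong λ b → trans (∑-cong λ y → split (w a x * w b y) (2 * τ² * κ 0#) (𝟙 (Y (x ⊗ a ⊖ y ⊗ b))) (κ 0#))
               (∑-+ _ _)) (∑-+ _ _)) (∑-+ _ _)) ⟩
        ∑ (λ a → ∑ (λ x → ∑ λ b → ∑ λ y → 2 * τ² * κ 0# * ((w a x * w b y) * 𝟙 (Y (x ⊗ a ⊖ y ⊗ b)))) + ∑ (λ x → ∑ λ b → ∑ λ y → (w a x * w b y) * κ 0#))
          ≡⟨ ∑-+ _ _ ⟩
        ∑ (λ a → ∑ λ x → ∑ λ b → ∑ λ y → 2 * τ² * κ 0# * ((w a x * w b y) * 𝟙 (Y (x ⊗ a ⊖ y ⊗ b)))) + ∑ (λ a → ∑ λ x → ∑ λ b → ∑ λ y → (w a x * w b y) * κ 0#)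
          ≡⟨ cong₂ _+_ main diagonal ⟩
        2 * τ² * κ 0# * E + M * κ 0# ∎
        where
        split : ∀ w c d k → w * (c * d + k) ≡ c * (w * d) + w * k
        split = solve-∀
        pull : ∀ c (f : F → F → F → F → ℕ) → ∑ (λ a → ∑ λ x → ∑ λ b → ∑ λ y → c * f a x b y) ≡ c * ∑ (λ a → ∑ λ x → ∑ λ b → ∑ λ y → f a x b y)
        pull c f = trans (∑-cong λ a → trans (∑-cong λ x → trans (∑-cong λ b → ∑-*ˡ c (f a x b)) (∑-*ˡ c _)) (∑-*ˡ c _)) (∑-*ˡ c _)
        main : ∑ (λ a → ∑ λ x → ∑ λ b → ∑ λ y → 2 * τ² * κ 0# * ((w a x * w b y) * 𝟙 (Y (x ⊗ a ⊖ y ⊗ b)))) ≡ 2 * τ² * κ 0# * E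
        main = trans (pull (2 * τ² * κ 0#) (λ a x b y → (w a x * w b y) * 𝟙 (Y (x ⊗ a ⊖ y ⊗ b)))) (cong (2 * τ² * κ 0# *_) (begin-equality
          ∑ (λ a → ∑ λ x → ∑ λ b → ∑ λ y → (w a x * w b y) * 𝟙 (Y (x ⊗ a ⊖ y ⊗ b)))
            ≡⟨ trans (∑-cong λ a → ∑-swap _)
                     (∑-swap _) ⟩
          ∑ (λ b → ∑ λ a → ∑ λ x → ∑ λ y → (w a x * w b y) * 𝟙 (Y (x ⊗ a ⊖ y ⊗ b)))
            ≡⟨ ∑-cong (λ b → trans (∑-cong λ a → inner a b) (∑-*ˡ (𝟙 (B b)) _)) ⟩
          E ∎))
          where
          regroup : ∀ a x b y e → ((a * x) * (b * y)) * e ≡ b * (a * (y * (x * e)))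
          regroup = solve-∀
          inner : ∀ a b → ∑ (λ x → ∑ λ y → (w a x * w b y) * 𝟙 (Y (x ⊗ a ⊖ y ⊗ b))) ≡ 𝟙 (B b) * (𝟙 (B a) * energy X′ Y a b)
          inner a b = begin-equality
            ∑ (λ x → ∑ λ y → (w a x * w b y) * 𝟙 (Y (x ⊗ a ⊖ y ⊗ b)))
              ≡⟨ ∑-swap _ ⟩
            ∑ (λ y → ∑ λ x → (w a x * w b y) * 𝟙 (Y (x ⊗ a ⊖ y ⊗ b)))
              ≡⟨ ∑-cong (λ y → trans (∑-cong λ x → regroup (𝟙 (B a)) (𝟙 (X′ x)) (𝟙 (B b)) (𝟙 (X′ y)) (𝟙 (Y (x ⊗ a ⊖ y ⊗ b))))
                   (trans (∑-*ˡ (𝟙 (B b)) _) (cong (𝟙 (B b) *_) (trans (∑-*ˡ (𝟙 (B a)) _) (cong (𝟙 (B a) *_) (∑-*ˡ (𝟙 (X′ y)) _)))))) ⟩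
            ∑ (λ y → 𝟙 (B b) * (𝟙 (B a) * (𝟙 (X′ y) * ∑ λ x → 𝟙 (X′ x) * 𝟙 (Y (x ⊗ a ⊖ y ⊗ b)))))
              ≡⟨ trans (∑-*ˡ (𝟙 (B b)) _) (cong (𝟙 (B b) *_) (∑-*ˡ (𝟙 (B a)) _)) ⟩
            𝟙 (B b) * (𝟙 (B a) * energy X′ Y a b) ∎
        total-w : ∑ (λ a → ∑ λ x → w a x) ≡ # B * # X′
        total-w = ∑-× _ _
        diagonal : ∑ (λ a → ∑ λ x → ∑ λ b → ∑ λ y → (w a x * w b y) * κ 0#) ≡ M * κ 0#
        diagonal = begin-equality
          ∑ (λ a → ∑ λ x → ∑ λ b → ∑ λ y → (w a x * w b y) * κ 0#)
            ≡⟨ ∑-cong (λ a → ∑-cong λ x → trans (∑-cong λ b → trans (∑-*ʳ (κ 0#) _) (cong (_* κ 0#) (∑-*ˡ (w a x) (w b))))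
                 (trans (∑-*ʳ (κ 0#) _) (cong (_* κ 0#) (trans (∑-*ˡ (w a x) _) (cong (w a x *_) total-w))))) ⟩
          ∑ (λ a → ∑ λ x → w a x * (# B * # X′) * κ 0#)
            ≡⟨ trans (∑-cong λ a → trans (∑-*ʳ (κ 0#) _) (cong (_* κ 0#) (∑-*ʳ (# B * # X′) (w a))))
                 (trans (∑-*ʳ (κ 0#) _) (cong (_* κ 0#) (trans (∑-*ʳ (# B * # X′) _) (cong (_* (# B * # X′)) total-w)))) ⟩
          # B * # X′ * (# B * # X′) * κ 0#
            ≡⟨ cong (_* κ 0#) (interchange (# B) (# X′)) ⟩
          M * κ 0# ∎
          where
          interchange : ∀ b x → b * x * (b * x) ≡ b * b * (x * x)
          interchange = solve-∀

-- The base kernel of an interval and the descent through level sets.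

module LevelSetDescent (p : ℕ) .{{_ : NonZero p}} (p-prime : Prime p) where

  open import Data.Nat.Properties
  open FiniteSums
  open PrimeField p p-prime
  open Subsets p p-prime
  open ApproximateSubrings p p-prime
  open PositiveDefiniteKernels p p-prime
  open LevelSets p p-prime

  Units : Subset → Set
  Units B = ∀ {a} → a ∈ B → ∃ λ u → a ⊗ u ≡ 1#

  square-abs : ∀ i → i ℤ.* i ≡ pos (∣ i ∣ * ∣ i ∣)
  square-abs (pos n) = sym (ℤ.pos-* n n)
  square-abs ℤ.-[1+ n ] = refl

  module BaseKernel (B J : Subset) (r : ℕ) (p≡ : p ≡ # J + r) where
    private
      ℓ = # J

    -- `p` times the balanced indicator function of `J`, so that the values are integers.
    φ : F → ℤ
    φ z = pos p ℤ.* 𝟙ᶻ (J z) ℤ.+ ℤ.- pos ℓ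

    open Autocorrelation φ

    private
      constant : ∀ c → ∑ᶻ {p} (λ _ → c) ≡ pos p ℤ.* c
      constant c = trans (∑ᶻ-cong λ _ → sym (ℤ.*-identityˡ c)) (trans (∑ᶻ-*ʳ c _) (cong (ℤ._* c)
        (trans (sym (pos-∑ {p} (λ _ → 1))) (cong pos (trans (∑-const p 1) (*-identityʳ p))))))

      ∑-J : ∑ᶻ (λ z → 𝟙ᶻ (J z)) ≡ pos ℓ
      ∑-J = sym (pos-∑ (λ z → 𝟙 (J z)))

      ∑-B : ∑ᶻ (λ t → 𝟙ᶻ (B t)) ≡ pos (# B)
      ∑-B = sym (pos-∑ (λ t → 𝟙 (B t)))

    mean-zero : ∑ᶻ φ ≡ 0ℤ
    mean-zero = trans (∑ᶻ-+ _ _)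
      (trans (cong₂ ℤ._+_ (trans (∑ᶻ-*ˡ (pos p) _) (cong (pos p ℤ.*_) ∑-J)) (constant (ℤ.- pos ℓ))) (cancel (pos p) (pos ℓ)))
      where
      cancel : ∀ p l → p ℤ.* l ℤ.+ p ℤ.* (ℤ.- l) ≡ 0ℤ
      cancel = ℤ-Solver.solve-∀

    K0 : K 0# ≡ pos (p * ℓ * r)
    K0 = begin
      ∑ᶻ (λ z → φ z ℤ.* φ (z ⊕ 0#))
        ≡⟨ ∑ᶻ-cong (λ z → trans (cong (λ v → φ z ℤ.* φ v) (solve 1 (λ z → z :+ con 0ℤ := z) refl z)) (expand (pos p) (𝟙ᶻ (J z)) (pos ℓ))) ⟩
      ∑ᶻ (λ z → pos p ℤ.* pos p ℤ.* (𝟙ᶻ (J z) ℤ.* 𝟙ᶻ (J z)) ℤ.+ ℤ.- (pos 2 ℤ.* pos p ℤ.* pos ℓ) ℤ.* 𝟙ᶻ (J z) ℤ.+ pos ℓ ℤ.* pos ℓ)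
        ≡⟨ ∑ᶻ-cong (λ z → trans (cong (λ v → pos p ℤ.* pos p ℤ.* v ℤ.+ ℤ.- (pos 2 ℤ.* pos p ℤ.* pos ℓ) ℤ.* 𝟙ᶻ (J z) ℤ.+ pos ℓ ℤ.* pos ℓ) (𝟙ᶻ² (J z)))
             (collect (pos p) (𝟙ᶻ (J z)) (pos ℓ))) ⟩
      ∑ᶻ (λ z → C ℤ.* 𝟙ᶻ (J z) ℤ.+ pos ℓ ℤ.* pos ℓ)
        ≡⟨ trans (∑ᶻ-+ _ _)
             (cong₂ ℤ._+_ (trans (∑ᶻ-*ˡ C _) (cong (C ℤ.*_) ∑-J)) (constant (pos ℓ ℤ.* pos ℓ))) ⟩
      C ℤ.* pos ℓ ℤ.+ pos p ℤ.* (pos ℓ ℤ.* pos ℓ)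
        ≡⟨ factor (pos p) (pos ℓ) ⟩
      pos p ℤ.* pos ℓ ℤ.* (pos p ℤ.+ ℤ.- pos ℓ)
        ≡⟨ cong (λ t → pos p ℤ.* pos ℓ ℤ.* (t ℤ.+ ℤ.- pos ℓ)) (trans (cong pos p≡) (ℤ.pos-+ ℓ r)) ⟩
      pos p ℤ.* pos ℓ ℤ.* ((pos ℓ ℤ.+ pos r) ℤ.+ ℤ.- pos ℓ)
        ≡⟨ drop (pos p ℤ.* pos ℓ) (pos ℓ) (pos r) ⟩
      pos p ℤ.* pos ℓ ℤ.* pos r
        ≡⟨ trans (cong (ℤ._* pos r) (sym (ℤ.pos-* p ℓ))) (sym (ℤ.pos-* (p * ℓ) r)) ⟩
      pos (p * ℓ * r) ∎
      where
      open ≡-Reasoning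
      C = pos p ℤ.* (pos p ℤ.+ ℤ.- (pos 2 ℤ.* pos ℓ))
      expand : ∀ p j l → (p ℤ.* j ℤ.+ ℤ.- l) ℤ.* (p ℤ.* j ℤ.+ ℤ.- l) ≡ p ℤ.* p ℤ.* (j ℤ.* j) ℤ.+ ℤ.- (pos 2 ℤ.* p ℤ.* l) ℤ.* j ℤ.+ l ℤ.* l
      expand = ℤ-Solver.solve-∀
      collect : ∀ p j l → p ℤ.* p ℤ.* j ℤ.+ ℤ.- (pos 2 ℤ.* p ℤ.* l) ℤ.* j ℤ.+ l ℤ.* l ≡ p ℤ.* (p ℤ.+ ℤ.- (pos 2 ℤ.* l)) ℤ.* j ℤ.+ l ℤ.* l
      collect = ℤ-Solver.solve-∀
      factor : ∀ p l → p ℤ.* (p ℤ.+ ℤ.- (pos 2 ℤ.* l)) ℤ.* l ℤ.+ p ℤ.* (l ℤ.* l) ≡ p ℤ.* l ℤ.* (p ℤ.+ ℤ.- l)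
      factor = ℤ-Solver.solve-∀
      drop : ∀ c l r → c ℤ.* ((l ℤ.+ r) ℤ.+ ℤ.- l) ≡ c ℤ.* r
      drop = ℤ-Solver.solve-∀

    -- `κ₀` is a sum of squares, so the absolute value only moves it to `ℕ`.
    base : F → ℕ
    base y = ∣ κ₀ B y ∣

    pos-base : ∀ y → pos (base y) ≡ κ₀ B y
    pos-base y = ℤ.0≤i⇒+∣i∣≡i (0≤κ₀ B y)

    base-zero : base 0# ≡ # B * (# B * (p * ℓ * r))
    base-zero = cong ∣_∣ (trans (κ₀-zero B) (trans (cong₂ (λ b k → b ℤ.* (b ℤ.* k)) ∑-B K0)
      (trans (cong (pos (# B) ℤ.*_) (sym (ℤ.pos-* (# B) (p * ℓ * r)))) (sym (ℤ.pos-* (# B) _)))))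

    admissible-base : ∀ {N} → N ≤ # B → 1 ≤ N → 1 ≤ ℓ → 1 ≤ r → Admissible N base
    admissible-base {N} N≤B 1≤N 1≤ℓ 1≤r = record
      { pd = pd-cong {κ₀ B} (λ y → sym (pos-base y)) (pd-κ₀ B)
      ; positive = ≤-trans (*-mono-≤ 1≤B (*-mono-≤ 1≤B (*-mono-≤ (*-mono-≤ (>-nonZero⁻¹ p) 1≤ℓ) 1≤r))) (≤-reflexive (sym base-zero))
      ; mass = begin
          N * ∑ base ≤⟨ *-mono-≤ N≤B (ℤ.drop‿+≤+ total) ⟩
          # B * (p * (p * ℓ * r) * # B) ≡⟨ regroup (# B) p (p * ℓ * r) ⟩
          p * (# B * (# B * (p * ℓ * r))) ≡⟨ cong (p *_) base-zero ⟨
          p * base 0# ∎ }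
      where
      open ≤-Reasoning
      1≤B = ≤-trans 1≤N N≤B
      regroup : ∀ b p k → b * (p * k * b) ≡ p * (b * (b * k))
      regroup = solve-∀
      total : pos (∑ base) ℤ.≤ pos (p * (p * ℓ * r) * # B)
      total = subst₂ ℤ._≤_ (sym (trans (pos-∑ base) (∑ᶻ-cong pos-base)))
        (trans (cong₂ (λ k b → pos p ℤ.* k ℤ.* b) K0 ∑-B) (trans (cong (ℤ._* pos (# B)) (sym (ℤ.pos-* p (p * ℓ * r)))) (sym (ℤ.pos-* (p * (p * ℓ * r)) (# B)))))
        (∑-κ₀ B mean-zero)

    -- For `z` in `Z` every `z + x t` misses `J`, so `φ` is `- ℓ` at all of them and the inner sum
    -- over `B` is `- ℓ * # B`. Its square, summed over `Z`, is compared with `base-zero` by means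
    -- of `r ≤ p ≤ c ℓ`.
    base-avoid : ∀ {x c} Z → ℓ ≤ # Z → p ≤ c * ℓ → (∀ {z t} → z ∈ Z → t ∈ B → J (z ⊕ x ⊗ t) ≡ false) → base 0# ≤ c * c * base x
    base-avoid {x} {c} Z ℓ≤Z p≤cℓ avoid = begin
      base 0# ≡⟨ base-zero ⟩
      # B * (# B * (p * ℓ * r)) ≤⟨ *-monoʳ-≤ (# B) (*-monoʳ-≤ (# B) (*-mono-≤ (*-monoˡ-≤ ℓ p≤cℓ) (≤-trans r≤p p≤cℓ))) ⟩
      # B * (# B * (c * ℓ * ℓ * (c * ℓ))) ≡⟨ regroup (# B) c ℓ ⟩
      c * c * (ℓ * ((# B * ℓ) * (# B * ℓ))) ≤⟨ *-monoʳ-≤ (c * c) (*-monoˡ-≤ ((# B * ℓ) * (# B * ℓ)) ℓ≤Z) ⟩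
      c * c * (# Z * ((# B * ℓ) * (# B * ℓ))) ≤⟨ *-monoʳ-≤ (c * c) (#-bound {Z} (λ z → ∣ T z ∣ * ∣ T z ∣) member) ⟩
      c * c * ∑ (λ z → ∣ T z ∣ * ∣ T z ∣) ≡⟨ cong (c * c *_) base-squares ⟨
      c * c * base x ∎
      where
      open ≤-Reasoning
      r≤p : r ≤ p
      r≤p = ≤-trans (m≤n+m r ℓ) (≤-reflexive (sym p≡))
      regroup : ∀ b c l → b * (b * (c * l * l * (c * l))) ≡ c * c * (l * ((b * l) * (b * l)))
      regroup = solve-∀
      T : F → ℤ
      T z = ∑ᶻ λ t → 𝟙ᶻ (B t) ℤ.* φ (z ⊕ x ⊗ t)
      base-squares : base x ≡ ∑ (λ z → ∣ T z ∣ * ∣ T z ∣)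
      base-squares = cong ∣_∣ (trans (κ₀-squares B x) (trans (∑ᶻ-cong λ z → square-abs (T z)) (sym (pos-∑ (λ z → ∣ T z ∣ * ∣ T z ∣)))))
      outside : ∀ {v} → J v ≡ false → φ v ≡ ℤ.- pos ℓ
      outside {v} h = trans (cong (λ b → pos p ℤ.* 𝟙ᶻ b ℤ.+ ℤ.- pos ℓ) h) (trans (cong (ℤ._+ ℤ.- pos ℓ) (ℤ.*-zeroʳ (pos p))) (ℤ.+-identityˡ _))
      T-value : ∀ {z} → z ∈ Z → T z ≡ pos (# B) ℤ.* ℤ.- pos ℓ
      T-value {z} z∈ = trans (∑ᶻ-cong pointwise) (trans (∑ᶻ-*ʳ (ℤ.- pos ℓ) _) (cong (ℤ._* ℤ.- pos ℓ) ∑-B))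
        where
        pointwise : ∀ t → 𝟙ᶻ (B t) ℤ.* φ (z ⊕ x ⊗ t) ≡ 𝟙ᶻ (B t) ℤ.* ℤ.- pos ℓ
        pointwise t with B t in t∈
        ... | false = refl
        ... | true = cong (pos 1 ℤ.*_) (outside {z ⊕ x ⊗ t} (avoid z∈ t∈))
      member : ∀ {z} → z ∈ Z → (# B * ℓ) * (# B * ℓ) ≤ ∣ T z ∣ * ∣ T z ∣
      member {z} z∈ = ≤-reflexive (sym (cong (λ k → k * k) (trans (cong ∣_∣ (T-value z∈))
        (trans (ℤ.abs-* (pos (# B)) (ℤ.- pos ℓ)) (cong (# B *_) (ℤ.∣-i∣≡∣i∣ (pos ℓ)))))))

  kernels : (ℕ → Subset) → (F → ℕ) → ℕ → F → ℕ
  kernels B κ zero = κ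
  kernels B κ (suc r) = step (B (suc r)) (kernels B κ r)

  module _ (B : ℕ → Subset) (κ : F → ℕ) (N q : ℕ) (1≤N : 1 ≤ N) (B-units : ∀ r → Units (B r)) (N≤B : ∀ r → N ≤ # (B r))
    (adm : Admissible N κ) where

    private
      K : ℕ → F → ℕ
      K = kernels B κ

    admissible-kernels : ∀ r → Admissible N (K r)
    admissible-kernels zero = adm
    admissible-kernels (suc r) = admissible-step (B (suc r)) (B-units (suc r)) (≤-trans 1≤N (N≤B (suc r))) (admissible-kernels r)

    -- `P r x` will say that the factors used in `x` leave the blocks `0, …, r` available. The
    -- descent only has to know how a block is spent and what holds when block `0` remains.
    module _ (P : ℕ → F → Set) (τ₀ : ℕ) (P-step : ∀ {r x a} → P (suc r) x → a ∈ B (suc r) → P r (x ⊗ a))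
      (P-base : ∀ {x} → P 0 x → κ 0# ≤ τ₀ * κ x) where

      -- An average of values that are all at least `1 / τ₀` of the value at `0#` has the same
      -- property, so nothing is lost as `r` grows.
      kernel-large : ∀ r {x} → P r x → K r 0# ≤ τ₀ * K r x
      kernel-large zero h = P-base h
      kernel-large (suc r) {x} h = begin
        step (B (suc r)) (K r) 0# ≡⟨ step-zero (B (suc r)) (K r) ⟩
        # (B (suc r)) * K r 0# ≤⟨ #-bound {B (suc r)} (λ a → 𝟙 (B (suc r) a) * (τ₀ * K r (x ⊗ a))) member ⟩
        ∑ (λ a → 𝟙 (B (suc r) a) * (τ₀ * K r (x ⊗ a))) ≡⟨ ∑-weighted (B (suc r)) τ₀ (λ a → K r (x ⊗ a)) ⟩
        τ₀ * step (B (suc r)) (K r) x ∎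
        where
        open ≤-Reasoning
        member : ∀ {a} → a ∈ B (suc r) → K r 0# ≤ 𝟙 (B (suc r) a) * (τ₀ * K r (x ⊗ a))
        member {a} a∈ = ≤-trans (kernel-large r (P-step h a∈)) (≤-reflexive (sym (trans (cong (_* (τ₀ * K r (x ⊗ a))) (𝟙-true a∈)) (*-identityˡ _))))

      module _ (A : Subset) (J : ℕ) (N≤A : N ≤ # A) (A⊆P : ∀ {r x} → r ≤ J → x ∈ A → P r x) (1≤τ₀ : 1 ≤ τ₀)
        (rigid : ∀ X Y B → Units B → # Y ≤ q * # X → N ≤ # X → N ≤ # B → N * # X ≤ q * p →
          (∀ X′ → X′ ⊆ X → # B * # B * (# X′ * # X′) ≤ q * ∑ λ b → 𝟙 (B b) * ∑ λ a → 𝟙 (B a) * energy X′ Y a b) → ⊥) where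

        A⊆level : ∀ {r τ} → r ≤ J → τ₀ ≤ τ → A ⊆ level (K r) τ
        A⊆level {r} {τ} r≤J τ₀≤τ {x} x∈ = does⁺ (K r 0# ≤? τ * K r x) (≤-trans (kernel-large r (A⊆P r≤J x∈)) (*-monoˡ-≤ (K r x) τ₀≤τ))

        -- The level sets would grow by a factor q at each step, unless rigid applies.
        descent : ∀ r τ → r ≤ J → τ₀ ≤ τ → (2 * τ) ^ (2 ^ r) ≤ q → p < q ^ r * # (level (K r) τ) → ⊥
        descent zero τ r≤J τ₀≤τ τ≤q p< = contradiction (≤-trans p< (≤-reflexive (*-identityˡ _))) (≤⇒≯ (#≤p (level (K 0) τ)))
        descent (suc r) τ r<J τ₀≤τ τ≤q p< = by-cases (# Y ≤? q * # X)
          where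
          open ≤-Reasoning
          τ′ = 2 * (τ * τ)
          X = level (K (suc r)) τ
          Y = level (K r) τ′
          1≤τ = ≤-trans 1≤τ₀ τ₀≤τ
          -- In terms of `2 τ` the map `τ ↦ 2 τ²` is squaring, so this power is invariant along the
          -- descent.
          square : (2 * τ′) ^ (2 ^ r) ≡ (2 * τ) ^ (2 ^ suc r)
          square = trans (cong (_^ (2 ^ r)) (four τ)) (^-*-assoc (2 * τ) 2 (2 ^ r))
            where
            four : ∀ τ → 2 * (2 * (τ * τ)) ≡ (2 * τ) * ((2 * τ) * 1)
            four = solve-∀
          τ′≤q : 2 * τ′ ≤ q
          τ′≤q = begin
            2 * τ′ ≡⟨ *-identityʳ (2 * τ′) ⟨
            (2 * τ′) ^ 1 ≤⟨ ^-monoʳ-≤ (2 * τ′) {{m*n≢0 2 τ′ {{_}} {{m*n≢0 2 (τ * τ) {{_}} {{m*n≢0 τ τ {{>-nonZero 1≤τ}} {{>-nonZero 1≤τ}}}}}}}} (m^n>0 2 r) ⟩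
            (2 * τ′) ^ (2 ^ r) ≡⟨ square ⟩
            (2 * τ) ^ (2 ^ suc r) ≤⟨ τ≤q ⟩
            q ∎
          τ≤τ′ : τ ≤ τ′
          τ≤τ′ = ≤-trans (m≤m*n τ τ {{>-nonZero 1≤τ}}) (m≤n*m (τ * τ) 2)
          by-cases : Dec (# Y ≤ q * # X) → ⊥
          by-cases (yes Y≤) = rigid X Y (B (suc r)) (B-units (suc r)) Y≤ (≤-trans N≤A (#-mono (A⊆level r<J τ₀≤τ))) (N≤B (suc r))
            (≤-trans (level-size (admissible-kernels (suc r)) τ) (*-monoˡ-≤ p (≤-trans τ≤τ′ (≤-trans (m≤n*m τ′ 2) τ′≤q))))
            (λ X′ X′⊆ → ≤-trans (level-hereditary (admissible-kernels r) (B (suc r)) τ X′ X′⊆) (*-monoˡ-≤ _ (≤-trans (m≤n*m τ′ 2) τ′≤q)))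
          by-cases (no Y>) = descent r τ′ (≤-trans (n≤1+n r) r<J) (≤-trans τ₀≤τ τ≤τ′) (≤-trans (≤-reflexive square) τ≤q) (begin-strict
            p <⟨ p< ⟩
            q * q ^ r * # X ≡⟨ swap q (q ^ r) (# X) ⟩
            q ^ r * (q * # X) ≤⟨ *-monoʳ-≤ (q ^ r) (<⇒≤ (≰⇒> Y>)) ⟩
            q ^ r * # Y ∎)
            where
            swap : ∀ a b c → a * b * c ≡ b * (a * c)
            swap = solve-∀

        no-descent : (2 * τ₀) ^ (2 ^ J) ≤ q → p < q ^ J → ⊥
        no-descent τ₀≤q p< = descent J τ₀ ≤-refl ≤-refl τ₀≤q (≤-trans p< (m≤m*n (q ^ J) (# (level (K J) τ₀))
          {{>-nonZero (≤-trans 1≤N (≤-trans N≤A (#-mono (A⊆level {J} {τ₀} ≤-refl ≤-refl))))}}))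

-- Application to cubes and intervals.

module CubesAndIntervals (p : ℕ) .{{_ : NonZero p}} (p-prime : Prime p) where

  open import Data.Nat.Properties
  open FiniteSums
  open ParameterSelection
  open PrimeField p p-prime
  open Subsets p p-prime
  open ApproximateSubrings p p-prime
  open LevelSetDescent p p-prime

  ⟨_⟩ : ℕ → F
  ⟨ n ⟩ = ⟦ pos n ⟧

  ⟨⟩-* : ∀ m n → ⟨ m * n ⟩ ≡ ⟨ m ⟩ ⊗ ⟨ n ⟩
  ⟨⟩-* m n = trans (cong ⟦_⟧ (ℤ.pos-* m n)) (*-homo (pos m) (pos n))

  ⟨⟩-+ : ∀ m n → ⟨ m + n ⟩ ≡ ⟨ m ⟩ ⊕ ⟨ n ⟩
  ⟨⟩-+ m n = trans (cong ⟦_⟧ (ℤ.pos-+ m n)) (+-homo (pos m) (pos n))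

  ⟨toℕ⟩ : ∀ x → ⟨ toℕ x ⟩ ≡ x
  ⟨toℕ⟩ x = trans (cong ⟦_⟧ (sym (ι-def x))) (⟦ι⟧ x)

  toℕ⟨⟩ : ∀ n → toℕ ⟨ n ⟩ ≡ n % p
  toℕ⟨⟩ n = remainder-unique (Fin.toℕ<n ⟨ n ⟩) (m%n<n n p) (pos n /ℕ p) (pos (n div p))
    (trans (⟦⟧-toℕ (pos n)) (trans (cong pos (m≡m%n+[m/n]*n n p)) (trans (ℤ.pos-+ (n % p) (n div p * p)) (cong (λ t → pos (n % p) ℤ.+ t) (ℤ.pos-* (n div p) p)))))

  ⟨⟩-injective : ∀ {m n} → ⟨ m ⟩ ≡ ⟨ n ⟩ → m % p ≡ n % p
  ⟨⟩-injective {m} {n} eq = trans (sym (toℕ⟨⟩ m)) (trans (cong toℕ eq) (toℕ⟨⟩ n))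

  ⟨⟩-% : ∀ n → ⟨ n % p ⟩ ≡ ⟨ n ⟩
  ⟨⟩-% n = trans (cong ⟨_⟩ (sym (toℕ⟨⟩ n))) (⟨toℕ⟩ ⟨ n ⟩)

  0#-% : ∀ {n} → ⟨ n ⟩ ≡ 0# → n % p ≡ 0
  0#-% {n} eq = trans (⟨⟩-injective {n} {0} eq) (%0)
    where
    %0 : 0 % p ≡ 0
    %0 = n≤0⇒n≡0 (≤-trans (m≤m+n (0 % p) (0 div p * p)) (≤-reflexive (sym (m≡m%n+[m/n]*n 0 p))))

  selProd-cong : ∀ d (a : Fin d → ℕ) {s t} → (∀ i → s i ≡ t i) → selProd d a s ≡ selProd d a t
  selProd-cong zero a eq = refl
  selProd-cong (suc d) a eq = cong₂ (λ b r → (if b then a zero else 1) * r) (eq zero) (selProd-cong d (a ∘ suc) (eq ∘ suc))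

  insert : ∀ {d} → Fin d → (Fin d → Bool) → Fin d → Bool
  insert i s j = does (i Fin.≟ j) ∨ s j

  insert-false : ∀ {d} {i j : Fin d} {s} → i ≢ j → s j ≡ false → insert i s j ≡ false
  insert-false {i = i} {j} i≢j sj with i Fin.≟ j
  ... | yes eq = contradiction eq i≢j
  ... | no _ = sj

  selProd-insert : ∀ d (a : Fin d → ℕ) s i → s i ≡ false → selProd d a (insert i s) ≡ a i * selProd d a s
  selProd-insert (suc d) a s zero s0 = trans (cong (a zero *_) (selProd-cong d (a ∘ suc) (λ i → refl)))
    (cong (a zero *_) (sym (trans (cong (λ b → (if b then a zero else 1) * selProd d (a ∘ suc) (s ∘ suc)) s0) (*-identityˡ _))))
  selProd-insert (suc d) a s (suc i) si = trans (cong ((if s zero then a zero else 1) *_)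
      (trans (selProd-cong d (a ∘ suc) same) (selProd-insert d (a ∘ suc) (s ∘ suc) i si)))
    (*-swap (if s zero then a zero else 1) (a (suc i)) _)
    where
    same : ∀ j → insert (suc i) s (suc j) ≡ insert i (s ∘ suc) j
    same j with i Fin.≟ j
    ... | yes _ = refl
    ... | no _ = refl

  count-below : ∀ {n} ℓ → ℓ ≤ n → ∑ {n} (λ i → 𝟙 (toℕ i <ᵇ ℓ)) ≡ ℓ
  count-below {n} zero z≤n = trans (∑-cong {f = λ i → 𝟙 (toℕ i <ᵇ 0)} {g = λ _ → 0} λ i → refl) (∑-zero n)
  count-below {suc n} (suc ℓ) (s≤s ℓ≤n) = trans (∑-suc {n} (λ i → 𝟙 (toℕ i <ᵇ suc ℓ))) (cong suc (count-below {n} ℓ ℓ≤n))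

  module _ (k d a₀ : ℕ) (a : Fin d → ℕ) (cube : IsCubeData p d a₀ a) (b L : ℕ) (disjoint : CubeDisjoint p d a₀ a b L)
    (J m : ℕ) (L-large : p ^ m ≤ L ^ suc m) (choice : ParameterChoice k J m d p) where

    open ParameterChoice choice

    private
      instance
        q-nonZero : NonZero q
        q-nonZero = >-nonZero (≤-trans (s≤s z≤n) 32≤q)

      -- Rounding up serves both purposes: `L ≤ 2 ℓ` for the density, and `2 ℓ ≤ L + 1`, so that two
      -- numbers below `ℓ` have a sum of at most `2 ℓ - 2 < L`.
      ℓ : ℕ
      ℓ = ⌈ L /2⌉

      L≤2ℓ : L ≤ 2 * ℓ
      L≤2ℓ = ≤-trans (≤-reflexive (sym (⌊n/2⌋+⌈n/2⌉≡n L))) (≤-trans (+-monoˡ-≤ ℓ (⌊n/2⌋≤⌈n/2⌉ L)) (≤-reflexive (cong (ℓ +_) (sym (+-identityʳ ℓ)))))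

      2ℓ≤sucL : ℓ + ℓ ≤ suc L
      2ℓ≤sucL = ≤-trans (+-monoʳ-≤ ℓ (⌊n/2⌋≤⌈n/2⌉ (suc L))) (≤-reflexive (⌊n/2⌋+⌈n/2⌉≡n (suc L)))

      p≤σℓ : p ≤ σ * ℓ
      p≤σℓ = interval-ratio {L} {ℓ} L-large L≤2ℓ

      1≤ℓ : 1 ≤ ℓ
      1≤ℓ = n≢0⇒n>0 λ eq → contradiction (≤-trans (>-nonZero⁻¹ p) (≤-trans p≤σℓ (≤-reflexive (trans (cong (σ *_) eq) (*-zeroʳ σ))))) λ ()

      value : (Fin d → Bool) → F
      value s = ⟨ a₀ ⟩ ⊗ ⟨ selProd d a s ⟩

      avoids : ∀ s j → j < L → value s ≢ ⟨ b ⟩ ⊕ ⟨ j ⟩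
      avoids s j j<L eq = disjoint s (j , j<L , ⟨⟩-injective {cubeElem p d a₀ a s} {b + j}
        (trans (⟨⟩-% (a₀ * selProd d a s)) (trans (⟨⟩-* a₀ (selProd d a s)) (trans eq (sym (⟨⟩-+ b j))))))

      L<p : L < p
      L<p = ≰⇒> λ p≤L → avoids (λ _ → false) (toℕ (v ⊖ ⟨ b ⟩)) (≤-trans (Fin.toℕ<n (v ⊖ ⟨ b ⟩)) p≤L)
        (sym (trans (cong (⟨ b ⟩ ⊕_) (⟨toℕ⟩ (v ⊖ ⟨ b ⟩))) (solve 2 (λ v b → b :+ (v :- b) := v) refl v ⟨ b ⟩)))
        where
        v = value (λ _ → false)

      -- The half-interval is placed at `0#`; the position `b` enters through the reflected set `Z`.
      I : Subset
      I x = toℕ x <ᵇ ℓ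

      ℓ<p : ℓ < p
      ℓ<p = ≤-<-trans (⌈n/2⌉≤n L) L<p

      #I : # I ≡ ℓ
      #I = count-below ℓ (<⇒≤ ℓ<p)

      I-below : ∀ {x} → x ∈ I → toℕ x < ℓ
      I-below {x} x∈ = <ᵇ⇒< (toℕ x) ℓ (subst Data.Bool.T (sym x∈) _)

      unit : ∀ i → ∃ λ u → ⟨ a i ⟩ ⊗ u ≡ 1#
      unit i = inverse ⟨ a i ⟩ λ eq → proj₁ (proj₂ cube) i (0#-% {a i} eq)

      distinct : ∀ i j → ⟨ a i ⟩ ≡ ⟨ a j ⟩ → i ≡ j
      distinct i j eq with i Fin.≟ j
      ... | yes i≡j = i≡j
      ... | no i≢j = contradiction (⟨⟩-injective {a i} {a j} eq) (proj₂ (proj₂ cube) i j i≢j)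

      block : ℕ → Subset
      block r x = does (Fin.any? λ i → (r * N ≤? toℕ i) ×-dec (toℕ i <? suc r * N) ×-dec (⟨ a i ⟩ Fin.≟ x))

      InBlock : ℕ → F → Set
      InBlock r x = ∃ λ i → r * N ≤ toℕ i × toℕ i < suc r * N × ⟨ a i ⟩ ≡ x

      block⁻ : ∀ {r x} → x ∈ block r → InBlock r x
      block⁻ = does⁻ (Fin.any? _)

      index : ∀ r → r ≤ suc J → Fin N → Fin d
      index r r≤ j = fromℕ< {r * N + toℕ j} (begin-strict
        r * N + toℕ j <⟨ +-monoʳ-< (r * N) (Fin.toℕ<n j) ⟩
        r * N + N ≡⟨ +-comm (r * N) N ⟩
        suc r * N ≤⟨ *-monoˡ-≤ N (s≤s r≤) ⟩
        suc (suc J) * N ≤⟨ N-blocks ⟩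
        d ∎)
        where open ≤-Reasoning

      toℕ-index : ∀ r r≤ j → toℕ (index r r≤ j) ≡ r * N + toℕ j
      toℕ-index r r≤ j = Fin.toℕ-fromℕ< _

      block-large : ∀ r → r ≤ suc J → N ≤ # (block r)
      block-large r r≤ = injection⇒≤# {N} {block r} (λ j → ⟨ a (index r r≤ j) ⟩) member λ i j eq →
        Fin.toℕ-injective (+-cancelˡ-≡ (r * N) _ _ (trans (sym (toℕ-index r r≤ i)) (trans (cong toℕ (distinct _ _ eq)) (toℕ-index r r≤ j))))
        where
        member : ∀ j → ⟨ a (index r r≤ j) ⟩ ∈ block r
        member j = does⁺ (Fin.any? _) (index r r≤ j ,
          ≤-trans (m≤m+n (r * N) (toℕ j)) (≤-reflexive (sym (toℕ-index r r≤ j))) ,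
          ≤-trans (s≤s (≤-reflexive (toℕ-index r r≤ j))) (≤-trans (+-monoʳ-< (r * N) (Fin.toℕ<n j)) (≤-reflexive (+-comm (r * N) N))) , refl)

      -- x is built without using the blocks 0, … , r, which remain free to extend it.
      Free : ℕ → F → Set
      Free r x = r ≤ J × ∃ λ s → (∀ i → toℕ i < suc r * N → s i ≡ false) × x ≡ value s

      -- Truncation at `J` makes the sequence total with every block large; the descent reaches only
      -- the indices `0, …, J`.
      B : ℕ → Subset
      B r = block (r ⊓ J)

      B-large : ∀ r → N ≤ # (B r)
      B-large r = block-large (r ⊓ J) (≤-trans (m⊓n≤n r J) (n≤1+n J))

      B-units : ∀ r → Units (B r)
      B-units r {x} x∈ = from-index (block⁻ {r ⊓ J} x∈)
        where
        from-index : InBlock (r ⊓ J) x → ∃ λ u → x ⊗ u ≡ 1#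
        from-index (i , _ , _ , refl) = unit i

      extend : ∀ {s i x y} → s i ≡ false → x ≡ value s → ⟨ a i ⟩ ≡ y → x ⊗ y ≡ value (insert i s)
      extend {s} {i} si refl refl = sym (trans (cong (λ n → ⟨ a₀ ⟩ ⊗ ⟨ n ⟩) (selProd-insert d a s i si))
        (trans (cong (⟨ a₀ ⟩ ⊗_) (⟨⟩-* (a i) (selProd d a s)))
          (solve 3 (λ x y z → x :* (y :* z) := (x :* z) :* y) refl ⟨ a₀ ⟩ ⟨ a i ⟩ ⟨ selProd d a s ⟩)))

      Free-step : ∀ {r x y} → Free (suc r) x → y ∈ B (suc r) → Free r (x ⊗ y)
      Free-step {r} {x} {y} (r<J , s , free , x≡) y∈ = from-index (block⁻ {suc r} (subst (λ t → y ∈ block t) (m≤n⇒m⊓n≡m r<J) y∈))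
        where
        from-index : InBlock (suc r) y → Free r (x ⊗ y)
        from-index (i , lower , upper , eq) = ≤-trans (n≤1+n r) r<J , insert i s ,
          (λ j j< → insert-false {i = i} {j} {s} (λ { refl → <⇒≱ j< lower }) (free j (≤-trans j< (m≤n+m (suc r * N) N)))) ,
          extend {s} {i} (free i upper) x≡ eq

      -- The reflection `- b - I`: if `z` lies in it and `z + y` in `I`, then `y = b + u + v` with
      -- `u, v < ℓ`, so `y` would lie in the forbidden interval.
      Z : Subset
      Z z = I ((⊝ ⟨ b ⟩) ⊖ z)

      Free-avoids : ∀ {x} → Free 0 x → ∀ {z t} → z ∈ Z → t ∈ B 0 → I (z ⊕ x ⊗ t) ≡ false
      Free-avoids {x} (_ , s , free , x≡) {z} {t} z∈ t∈ = from-index (block⁻ {0} t∈)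
        where
        from-index : InBlock 0 t → I (z ⊕ x ⊗ t) ≡ false
        from-index (i , _ , upper , eq) = decide (I (z ⊕ x ⊗ t)) refl
          where
          decide : ∀ c → I (z ⊕ x ⊗ t) ≡ c → c ≡ false
          decide false _ = refl
          decide true v∈ = contradiction collision (avoids (insert i s) (toℕ u + toℕ v) sum<L)
            where
            u = (⊝ ⟨ b ⟩) ⊖ z
            v = z ⊕ x ⊗ t
            sum<L : toℕ u + toℕ v < L
            sum<L = ≤-pred (≤-trans (≤-reflexive (cong suc (sym (+-suc (toℕ u) (toℕ v))))) (≤-trans (+-mono-≤ (I-below {u} z∈) (I-below {v} v∈)) 2ℓ≤sucL))
            collision : value (insert i s) ≡ ⟨ b ⟩ ⊕ ⟨ toℕ u + toℕ v ⟩
            collision = trans (sym (extend {s} {i} (free i upper) x≡ eq))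
              (trans (solve 3 (λ w z b → w := b :+ (((:- b) :- z) :+ (z :+ w))) refl (x ⊗ t) z ⟨ b ⟩)
                (cong (⟨ b ⟩ ⊕_) (sym (trans (⟨⟩-+ (toℕ u) (toℕ v)) (cong₂ _⊕_ (⟨toℕ⟩ u) (⟨toℕ⟩ v))))))

      -- Cube elements with one factor besides `a₀`, taken beyond the blocks `0, …, J`. They are
      -- `Free r` for every `r ≤ J` and so lie in all level sets of the descent.
      A : Subset
      A x = does (Fin.any? λ i → (suc J * N ≤? toℕ i) ×-dec (x Fin.≟ ⟨ a₀ ⟩ ⊗ ⟨ a i ⟩))

      A-large : N ≤ # A
      A-large = injection⇒≤# {N} {A} (λ j → ⟨ a₀ ⟩ ⊗ ⟨ a (index (suc J) ≤-refl j) ⟩) member λ i j eq →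
        Fin.toℕ-injective (+-cancelˡ-≡ (suc J * N) _ _ (trans (sym (toℕ-index (suc J) ≤-refl i))
          (trans (cong toℕ (distinct _ _ (⊗-cancelʳ (proj₂ a₀-unit) (trans (⊗-comm _ ⟨ a₀ ⟩) (trans eq (⊗-comm ⟨ a₀ ⟩ _)))))) (toℕ-index (suc J) ≤-refl j))))
        where
        a₀-unit : ∃ λ u → ⟨ a₀ ⟩ ⊗ u ≡ 1#
        a₀-unit = inverse ⟨ a₀ ⟩ λ eq → proj₁ cube (0#-% {a₀} eq)
        member : ∀ j → ⟨ a₀ ⟩ ⊗ ⟨ a (index (suc J) ≤-refl j) ⟩ ∈ A
        member j = does⁺ (Fin.any? _) (index (suc J) ≤-refl j , ≤-trans (m≤m+n (suc J * N) (toℕ j)) (≤-reflexive (sym (toℕ-index (suc J) ≤-refl j))) , refl)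

      selProd-none : ∀ d (a : Fin d → ℕ) → selProd d a (λ _ → false) ≡ 1
      selProd-none zero a = refl
      selProd-none (suc d) a = trans (*-identityˡ _) (selProd-none d (a ∘ suc))

      A-Free : ∀ {r x} → r ≤ J → x ∈ A → Free r x
      A-Free {r} {x} r≤J x∈ = from-index (does⁻ (Fin.any? _) x∈)
        where
        from-index : (∃ λ i → suc J * N ≤ toℕ i × x ≡ ⟨ a₀ ⟩ ⊗ ⟨ a i ⟩) → Free r x
        from-index (i , lower , refl) = r≤J , insert i (λ _ → false) ,
          (λ j j< → insert-false {i = i} {j} {λ _ → false} (λ { refl → <⇒≱ j< (≤-trans (*-monoˡ-≤ N (s≤s r≤J)) lower) }) refl) ,
          extend {λ _ → false} {i} refl (sym (trans (cong (λ n → ⟨ a₀ ⟩ ⊗ ⟨ n ⟩) (selProd-none d a)) (solve 1 (λ x → x :* con ℤ.1ℤ := x) refl ⟨ a₀ ⟩))) refl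

      p≡ : p ≡ # I + (p ∸ ℓ)
      p≡ = trans (sym (m+[n∸m]≡n (<⇒≤ ℓ<p))) (cong (_+ (p ∸ ℓ)) (sym #I))

      open BaseKernel (B 0) I (p ∸ ℓ) p≡

      Q-nonZero : NonZero Q
      Q-nonZero = >-nonZero (≤-trans (*-mono-≤ {1} {8} (s≤s z≤n) (1≤n⁶ 1≤qq)) (≤-reflexive (sym Q-def)))
        where
        1≤qq : 1 ≤ q * q
        1≤qq = *-mono-≤ {1} {q} {1} {q} (≤-trans (s≤s z≤n) 32≤q) (≤-trans (s≤s z≤n) 32≤q)
        1≤n⁶ : ∀ {n} → 1 ≤ n → 1 ≤ n * n * n * n * n * n
        1≤n⁶ {n} h = *-mono-≤ {1} {n * n * n * n * n} (*-mono-≤ {1} {n * n * n * n} (*-mono-≤ {1} {n * n * n} (*-mono-≤ {1} {n * n} (*-mono-≤ {1} {n} h h) h) h) h) h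

      rigid : ∀ X Y B → Units B → # Y ≤ q * # X → N ≤ # X → N ≤ # B → N * # X ≤ q * p →
        (∀ X′ → X′ ⊆ X → # B * # B * (# X′ * # X′) ≤ q * ∑ λ b → 𝟙 (B b) * ∑ λ a → 𝟙 (B a) * energy X′ Y a b) → ⊥
      rigid X Y B units Y≤ N≤X N≤B NX≤ hereditary = no-approximate-subring X Y B q N 32≤q units Y≤ 1≤N N≤X N≤B NX≤ hereditary
        Q c {{Q-nonZero}} Q-def Q≤c q-bound W-bound T-bound k p<N^ q²≤N K≤N N-large

    large-cube-meets-interval : ⊥
    large-cube-meets-interval = no-descent B base N q 1≤N B-units B-large
      (admissible-base (B-large 0) 1≤N (≤-trans 1≤ℓ (≤-reflexive (sym #I))) (m<n⇒0<n∸m ℓ<p))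
      Free (σ * σ) Free-step
      (λ {x} free → base-avoid {x} {σ} Z (≤-reflexive (sym (∑-reflect (⊝ ⟨ b ⟩) (λ z → 𝟙 (I z)))))
        (≤-trans p≤σℓ (≤-reflexive (cong (σ *_) (sym #I)))) (Free-avoids free))
      A J A-large A-Free (*-mono-≤ {1} {σ} 1≤σ 1≤σ) rigid σ≤q p<q^J

-- The exponents are `ε = 1 / (k + 1)` and `δ = 1 / (m + 1)`, with both inequalities raised to
-- integer powers; every `ε > 0` is at least some `1 / (k + 1)`.
theorem1p5 : (k : ℕ) → Σ ℕ λ m → Σ ℕ λ C → (1 ≤ C) ×
    ((p : ℕ) .{{_ : NonZero p}} → Prime p →
    (b L : ℕ) → p ^ m ≤ L ^ suc m →
    (d : ℕ) (a₀ : ℕ) (a : Fin d → ℕ) → IsCubeData p d a₀ a →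
    CubeDisjoint p d a₀ a b L →
    d ^ suc k ≤ C ^ suc k * p)
theorem1p5 k = m , C , 1≤C , λ p p-prime b L L-large d a₀ a cube disjoint → ≮⇒≥ λ d-large →
    CubesAndIntervals.large-cube-meets-interval p p-prime k d a₀ a cube b L disjoint J m L-large
      (choose (>-nonZero⁻¹ p) d-large)
  where
  open ParameterSelection.Parameters k using (m; C; J; 1≤C; choose)
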